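{- Let $X$ be a simplicial surface. Then $X$ is face-transitive and the vertex-face type of $X$ satisfies $\mathrm{vf}(X)=(2,2)$ if and only if $H:=\lambda_X(\mathrm{Aut}(X))$ is a $(2,2)$-group of the face graph $\mathcal F(X)$ and the cycle double cover $\mathcal C^{(2,2)}(H)$ (for a suitable choice of the data defining it) contains exactly the vertex-defining cycles of $X$.
   Context: A simplicial complex $X$ on a finite non-empty set $P$ is a non-empty family of subsets of $P$ closed under taking subsets; $X_i$ is the set of its elements of cardinality $i+1$; elements of $X_0,X_1,X_2$ are vertices, edges, faces. A simplicial surface is a simplicial complex $X$ such that: all inclusion-maximal elements have cardinality $3$; every edge lies in exactly two faces; and for every vertex $v$ the faces containing $v$ can be arranged in a cyclic sequence $u(v)=(F_1,\dots,F_n)$ (each once), the umbrella of $v$, with $|F_i\cap F_{i+1}|=2$ (subscripts mod $n$). Simplicial surfaces are assumed strongly connected (any two faces joined by a sequence of faces with consecutive ones sharing an edge). $\mathrm{Aut}(X)$ is the automorphism group (permutations of $X_0$ mapping faces to faces). $X$ is face-transitive if $\mathrm{Aut}(X)$ is transitive on $X_2$; then $\mathrm{vf}(X)=(a,s)$ with $a$ the number of $\mathrm{Aut}(X)$-orbits on $X_0$ and $s$ the order of the stabiliser in $\mathrm{Aut}(X)$ of a face. All graphs are finite, simple, undirected, connected; their elements are called nodes and arcs. The face graph $\mathcal F(X)$ has node set $X_2$, two faces being joined by an arc iff they share an edge; it is cubic. $\lambda_X:\mathrm{Aut}(X)\to\mathrm{Aut}(\mathcal F(X))$ is the injective homomorphism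 sending an automorphism to the permutation it induces on $X_2$. Each umbrella $u(v)$ is a cycle in $\mathcal F(X)$, called a vertex-defining cycle of $X$. Cycles are considered up to rotation and reversal; for a subgroup $H$ of the automorphism group of a graph and a cycle $C$, $C^H$ denotes the $H$-orbit of $C$ under the induced action on cycles. A cycle double cover of a cubic graph is a set of cycles such that every arc lies in exactly two of them. It is vertex-faithful if all its cycles are chordless and any two distinct cycles share at most one arc. $\alpha$-cycles: let $\mathcal G=(V,E)$ be a cubic node-transitive graph (i.e. $\mathrm{Aut}(\mathcal G)$ is transitive on $V$), $F_1,\dots,F_n\in V$ with $\{F_i,F_{i+1}\}\in E$ for $1\le i\le n-1$, and $\sigma\in\mathrm{Aut}(\mathcal G)$ of order $\ell$ with $\sigma(F_1)=F_n$. Put $\Sigma=\{\sigma^i(F_j): 0\le i\le \ell-1,\ 1\le j\le n-1\}$. If $|\Sigma|=(n-1)\ell$, then $\alpha(\sigma,F_1,\dots,F_n)$ is the cycle $(\sigma(F_1),\dots,\sigma(F_{n-1}),\sigma^2(F_1),\dots,\sigma^2(F_{n-1}),\dots,\sigma^\ell(F_1),\dots,\sigma^\ell(F_{n-1}))$; otherwise it is the empty cycle. A subgroup $H\le\mathrm{Aut}(\mathcal G)$ is a $(2,2)$-group of $\mathcal G$ if: (1) $H$ acts transitively on $V$ with $|H|=2|V|$; (2) $E$ partitions into two $H$-orbits $E_1,E_2$ with $|E_1|=|V|$ and $|E_2|=\tfrac12|V|$; (3) there exist nodes $F_m',F_1',F_2'\in V$ with $\{F_1',F_2'\}\in E_1$,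 $\{F_m',F_1'\}\in E_2$ and $\sigma\in H$ with $\sigma(F_m')=F_2'$, such that, with $u$ a mono-coloured cycle of $\mathcal G$ (a cycle all of whose arcs have the same colour, where arcs in $E_i$ have colour $i$), the set $u^H\cup\alpha(\sigma,F_m',F_1',F_2')^H$ is a vertex-faithful cycle double cover of $\mathcal G$. This cover is denoted $\mathcal C^{(2,2)}(H)$. -}

module Defs where

open import Level using (Level; 0ℓ; _⊔_)
open import Data.Bool using (if_then_else_)
open import Data.Empty using (⊥)
open import Data.Fin using (Fin)
open import Data.Fin.Properties using (1↔⊤; +↔⊎) renaming (_≟_ to _≟ᶠ_)
open import Data.Fin.Subset using (Subset; inside; outside; _∈_; _⊆_; _∩_; ⁅_⁆; ∣_∣)
open import Data.Irrelevant using () renaming ([_] to irr)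
open import Data.List using (List; []; _∷_; _++_; [_]; map; length; reverse; concatMap; upTo; deduplicate)
open import Data.List.Membership.Propositional using () renaming (_∈_ to _∈ₗ_)
open import Data.List.Relation.Unary.Linked using (Linked)
open import Data.List.Relation.Unary.Unique.Propositional using (Unique)
open import Data.Nat using (ℕ; zero; suc; _+_; _*_; _≤_; _<_; _≡ᵇ_; _≟_)
open import Data.Product using (∃; ∃₂; _×_; _,_; proj₁; proj₂; uncurry)
open import Data.Refinement using (Refinement-syntax; _,_; value)
open import Data.Sum using (_⊎_; inj₁; inj₂)
open import Data.Sum.Function.Propositional using (_⊎-↔_)
open import Data.Vec using (Vec; []; _∷_; toList; init)
open import Data.Unit using (⊤)
open import Function using (_∘_; _↔_; _⇔_; Inverse; mk↔ₛ′; mk⇔; Congruent; Bijective)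
open import Function.Bundles using (Equivalence)
open import Function.Construct.Composition using (_↔-∘_; _⇔-∘_)
open import Function.Construct.Identity using (↔-id; ⇔-id)
open import Function.Construct.Symmetry using (↔-sym; ⇔-sym)
open import Function.Properties.Inverse using (↔⇒↣)
open import Relation.Binary using (Rel; DecidableEquality; Symmetric)
open import Relation.Binary.Construct.Closure.ReflexiveTransitive using (Star; ε; _◅_)
open import Relation.Binary.PropositionalEquality using (_≡_; _≢_; refl; sym; trans; cong; subst; subst₂)
open import Relation.Nullary using (¬_; yes; no; contradiction; recompute)
open import Relation.Nullary.Decidable using (via-injection; _×-dec_)
open import Relation.Unary using (Pred; Decidable)

open Inverse using (to; from; strictlyInverseˡ; strictlyInverseʳ)

private
  variable
    a ℓ ℓ′ : Level
    p k : ℕ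

-- The quotient of A by _≈_ has exactly k elements: f factors through a
-- bijection from the quotient to Fin k.
HasCard : (A : Set a) → Rel A ℓ → ℕ → Set (a ⊔ ℓ)
HasCard A _≈_ k = ∃ λ (f : A → Fin k) → Congruent _≈_ _≡_ f × Bijective _≈_ _≡_ f

-- Exactly two elements, up to _≈_, satisfy P.
ExactlyTwo : {A : Set a} → Rel A ℓ → Pred A ℓ′ → Set (a ⊔ ℓ ⊔ ℓ′)
ExactlyTwo _≈_ P = ∃₂ λ x y → P x × P y × ¬ (x ≈ y) × (∀ z → P z → (z ≈ x) ⊎ (z ≈ y))

-- Consecutive entries, the last and the first included, are related.
Cyclic : {A : Set a} → Rel A ℓ → List A → Set (a ⊔ ℓ)
Cyclic R []       = Level.Lift _ ⊥
Cyclic R (x ∷ xs) = Linked R (x ∷ xs ++ [ x ])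

-- Equality up to rotation and reversal.
infix 4 _≈ᶜ_
_≈ᶜ_ : {A : Set a} → Rel (List A) a
C ≈ᶜ D = ∃₂ λ xs ys → C ≡ xs ++ ys × ((D ≡ ys ++ xs) ⊎ (D ≡ reverse (ys ++ xs)))

record Graph : Set₁ where
  infix 4 _~_
  field
    Node        : Set
    _~_         : Rel Node 0ℓ
    order       : ℕ
    enumeration : Node ↔ Fin order
    ~-sym       : Symmetric _~_
    ~-irrefl    : ∀ {x} → ¬ (x ~ x)
    connected   : ∀ x y → Star _~_ x y

  _≟ₙ_ : DecidableEquality Node
  _≟ₙ_ = via-injection (↔⇒↣ enumeration) _≟ᶠ_

  -- Arcs are unordered pairs: ordered pairs up to _≈ₐ_.
  infix 4 _≈ₐ_
  _≈ₐ_ : Rel (Node × Node) 0ℓ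
  (x , y) ≈ₐ (x′ , y′) = (x ≡ x′ × y ≡ y′) ⊎ (x ≡ y′ × y ≡ x′)

  IsArc : Pred (Node × Node) 0ℓ
  IsArc = uncurry _~_

  Cubic : Set
  Cubic = ∀ x → HasCard (∃ λ y → x ~ y) (λ s t → proj₁ s ≡ proj₁ t) 3

module _ (G : Graph) where
  open Graph G

  record GraphAut : Set where
    field
      perm      : Node ↔ Node
      preserves : ∀ {x y} → (x ~ y) ⇔ (to perm x ~ to perm y)

module _ {G : Graph} where
  open Graph G
  open GraphAut

  infixr 8 _·_ _·ₐ_ _·ᶜ_
  _·_ : GraphAut G → Node → Node
  σ · x = to (perm σ) x

  _·ₐ_ : GraphAut G → Node × Node → Node × Node
  σ ·ₐ (x , y) = σ · x , σ · y

  _·ᶜ_ : GraphAut G → List Node → List Node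
  σ ·ᶜ C = map (σ ·_) C

  infix 4 _≈ᵍ_
  _≈ᵍ_ : Rel (GraphAut G) 0ℓ
  σ ≈ᵍ τ = ∀ x → σ · x ≡ τ · x

  idᵍ : GraphAut G
  idᵍ = record { perm = ↔-id _ ; preserves = ⇔-id _ }

  infixr 9 _∘ᵍ_
  _∘ᵍ_ : GraphAut G → GraphAut G → GraphAut G
  σ ∘ᵍ τ = record
    { perm      = perm σ ↔-∘ perm τ
    ; preserves = preserves σ ⇔-∘ preserves τ
    }

  _⁻¹ᵍ : GraphAut G → GraphAut G
  σ ⁻¹ᵍ = record
    { perm      = ↔-sym (perm σ)
    ; preserves = λ {x} {y} → ⇔-sym (subst₂ (λ s t → (from (perm σ) x ~ from (perm σ) y) ⇔ (s ~ t))
        (strictlyInverseˡ (perm σ) x) (strictlyInverseˡ (perm σ) y) (preserves σ))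
    }

  infixr 10 _^_
  _^_ : GraphAut G → ℕ → GraphAut G
  σ ^ zero  = idᵍ
  σ ^ suc i = σ ∘ᵍ (σ ^ i)

  HasOrder : GraphAut G → ℕ → Set
  HasOrder σ l = 0 < l × σ ^ l ≈ᵍ idᵍ × (∀ i → 0 < i → i < l → ¬ (σ ^ i ≈ᵍ idᵍ))

record Subgroup (G : Graph) : Set₁ where
  field
    Member    : Pred (GraphAut G) 0ℓ
    ≈-closed  : ∀ {σ τ} → σ ≈ᵍ τ → Member σ → Member τ
    id-closed : Member idᵍ
    ∘-closed  : ∀ {σ τ} → Member σ → Member τ → Member (σ ∘ᵍ τ)
    ⁻¹-closed : ∀ {σ} → Member σ → Member (σ ⁻¹ᵍ)

module _ (G : Graph) where
  open Graph G

  IsCycle : Pred (List Node) 0ℓ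
  IsCycle C = 3 ≤ length C × Unique C × Cyclic _~_ C

  -- x and y are cyclically consecutive in C, in either order.
  ArcOf : Node × Node → Pred (List Node) 0ℓ
  ArcOf (x , y) C = ∃ λ zs → C ≈ᶜ (x ∷ y ∷ zs)

  Chordless : Pred (List Node) 0ℓ
  Chordless C = ∀ {x y} → x ∈ₗ C → y ∈ₗ C → x ~ y → ArcOf (x , y) C

  IsCycleDoubleCover : Pred (List Node) 0ℓ → Set
  IsCycleDoubleCover 𝒞 =
    (∀ {C} → 𝒞 C → IsCycle C) ×
    (∀ e → IsArc e → ExactlyTwo _≈ᶜ_ (λ C → 𝒞 C × ArcOf e C))

  IsVertexFaithful : Pred (List Node) 0ℓ → Set
  IsVertexFaithful 𝒞 =
    (∀ {C} → 𝒞 C → Chordless C) ×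
    (∀ {C D} → 𝒞 C → 𝒞 D → ¬ (C ≈ᶜ D) →
       ∀ {e f} → ArcOf e C → ArcOf e D → ArcOf f C → ArcOf f D → e ≈ₐ f)

  -- α(σ, F₁, …, Fₙ), where n = suc m and l is the order of σ.  The list Σσ
  -- enumerates Σ, possibly with repetitions; the empty cycle is [].
  α : ∀ {m} → GraphAut G → (l : ℕ) → Vec Node (suc m) → List Node
  α {m} σ l Fs =
    if length (deduplicate _≟ₙ_ Σσ) ≡ᵇ m * l
    then concatMap (λ i → (σ ^ suc i) ·ᶜ F₁⋯Fₘ) (upTo l)
    else []
    where
    F₁⋯Fₘ Σσ : List Node
    F₁⋯Fₘ = toList (init Fs)
    Σσ    = concatMap (λ i → (σ ^ i) ·ᶜ F₁⋯Fₘ) (upTo l)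

module _ {G : Graph} (H : Subgroup G) where
  open Graph G
  open Subgroup H

  ArcOrbit : Node × Node → Pred (Node × Node) 0ℓ
  ArcOrbit e f = ∃ λ h → Member h × (f ≈ₐ (h ·ₐ e))

  CycleOrbit : List Node → Pred (List Node) 0ℓ
  CycleOrbit C D = ∃ λ h → Member h × (D ≈ᶜ (h ·ᶜ C))

  -- H is a (2,2)-group of G, together with a choice of the data
  -- (F′ₘ, F′₁, F′₂, σ, u) defining its cover.
  record TwoTwoGroup : Set where
    field
      cubic      : Cubic
      transitive : ∀ x y → ∃ λ h → Member h × h · x ≡ y
      order-H    : HasCard (∃ Member) (λ s t → proj₁ s ≈ᵍ proj₁ t) (2 * order)
      -- The two orbits E₁ and E₂ are given by representatives e₁ and e₂.
      e₁ e₂      : Node × Node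
      e₁-arc     : IsArc e₁
      e₂-arc     : IsArc e₂

    E₁ : Pred (Node × Node) 0ℓ
    E₁ = ArcOrbit e₁

    E₂ : Pred (Node × Node) 0ℓ
    E₂ = ArcOrbit e₂

    field
      covering : ∀ e → IsArc e → E₁ e ⊎ E₂ e
      disjoint : ∀ e → E₁ e → ¬ E₂ e
      card-E₁  : HasCard (∃ E₁) (λ s t → proj₁ s ≈ₐ proj₁ t) order
      card-E₂  : ∃ λ j → HasCard (∃ E₂) (λ s t → proj₁ s ≈ₐ proj₁ t) j × 2 * j ≡ order

      Fₘ F₁ F₂ : Node
      F₁F₂∈E₁  : E₁ (F₁ , F₂)
      FₘF₁∈E₂  : E₂ (Fₘ , F₁)
      σ        : GraphAut G
      σ∈H      : Member σ
      σFₘ≡F₂   : σ · Fₘ ≡ F₂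
      l        : ℕ
      σ-order  : HasOrder σ l

      u             : List Node
      u-cycle       : IsCycle G u
      u-monochrome  : (∀ e → ArcOf G e u → E₁ e) ⊎ (∀ e → ArcOf G e u → E₂ e)

    cover : Pred (List Node) 0ℓ
    cover C = CycleOrbit u C ⊎ CycleOrbit (α G σ l (Fₘ ∷ F₁ ∷ F₂ ∷ [])) C

    field
      cover-isCycleDoubleCover : IsCycleDoubleCover G cover
      cover-isVertexFaithful   : IsVertexFaithful G cover

-- The underlying non-empty finite set is Fin (suc p).
record SimplicialComplex (p : ℕ) : Set₁ where
  field
    IsSimplex  : Pred (Subset (suc p)) 0ℓ
    isSimplex? : Decidable IsSimplex
    nonEmpty   : ∃ IsSimplex
    downClosed : ∀ {s t} → s ⊆ t → IsSimplex t → IsSimplex s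

  -- Membership proofs are irrelevant, so _≡_ is equality of subsets.
  Simplex : ℕ → Set
  Simplex i = [ s ∈ Subset (suc p) ∣ IsSimplex s × ∣ s ∣ ≡ suc i ]

  Edge Face : Set
  Edge = Simplex 1
  Face = Simplex 2

  -- A vertex ⁅ x ⁆ is identified with its element x; note that not every
  -- element of Fin (suc p) need be a vertex.
  Vertex : Set
  Vertex = [ x ∈ Fin (suc p) ∣ IsSimplex ⁅ x ⁆ ]

  infix 4 _∈ᵥ_
  _∈ᵥ_ : Vertex → Face → Set
  v ∈ᵥ F = value v ∈ value F

  infix 4 _⊆ₑ_
  _⊆ₑ_ : Edge → Face → Set
  e ⊆ₑ F = value e ⊆ value F

  ShareEdge : Rel Face 0ℓ
  ShareEdge F G = ∃ λ e → e ⊆ₑ F × e ⊆ₑ G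

  IsUmbrella : Vertex → Pred (List Face) 0ℓ
  IsUmbrella v u =
    Unique u ×
    (∀ F → (F ∈ₗ u) ⇔ (v ∈ᵥ F)) ×
    Cyclic (λ F G → ∣ value F ∩ value G ∣ ≡ 2) u

  VertexDefining : Pred (List Face) 0ℓ
  VertexDefining C = ∃ λ v → IsUmbrella v C

record SimplicialSurface (p : ℕ) : Set₁ where
  field
    complex : SimplicialComplex p
  open SimplicialComplex complex public
  field
    maximal⇒card3     : ∀ s → IsSimplex s → (∀ t → IsSimplex t → s ⊆ t → t ≡ s) → ∣ s ∣ ≡ 3
    edge-in-two-faces : ∀ (e : Edge) → ExactlyTwo _≡_ (λ F → e ⊆ₑ F)
    umbrella          : ∀ v → ∃ (IsUmbrella v)
    stronglyConnected : ∀ F G → Star ShareEdge F G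

module _ (X : SimplicialSurface p) where
  open SimplicialSurface X

  -- π(F) = G: the vertices of G are exactly the images of the vertices of F.
  IsImage : Vertex ↔ Vertex → Face → Face → Set
  IsImage π F G = ∀ w → (w ∈ᵥ G) ⇔ (∃ λ v → v ∈ᵥ F × to π v ≡ w)

  record Aut : Set where
    field
      perm        : Vertex ↔ Vertex
      faceToFaces : ∀ F → ∃ λ G → IsImage perm F G

  open Aut

  infix 4 _≈ᴬ_
  _≈ᴬ_ : Rel Aut 0ℓ
  π ≈ᴬ ρ = ∀ v → to (perm π) v ≡ to (perm ρ) v

  FaceTransitive : Set
  FaceTransitive = ∀ F G → ∃ λ π → IsImage (perm π) F G

  SameVertexOrbit : Rel Vertex 0ℓ
  SameVertexOrbit v w = ∃ λ π → to (perm π) v ≡ w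

  Stabiliser : Face → Set
  Stabiliser F = ∃ λ π → IsImage (perm π) F F

  -- vf(X) = (a , s), for X face-transitive.
  HasVertexFaceType : ℕ → ℕ → Set
  HasVertexFaceType a s =
    HasCard Vertex SameVertexOrbit a ×
    (∀ F → HasCard (Stabiliser F) (λ π ρ → proj₁ π ≈ᴬ proj₁ ρ) s)

finite-refinement : ∀ {n} (P : Pred (Subset n) 0ℓ) → Decidable P →
                    ∃ λ k → [ s ∈ Subset n ∣ P s ] ↔ Fin k
finite-refinement {zero} P P? with P? []
... | yes P[] = 1 , ↔-sym 1↔⊤ ↔-∘
  mk↔ₛ′ {B = ⊤} _ (λ _ → point) (λ _ → refl) (λ { ([] , _) → refl })
  where
  point : [ s ∈ Subset 0 ∣ P s ]
  point = [] , irr P[]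
... | no ¬P[] = 0 , mk↔ₛ′ (λ s → contradiction (holds s) ¬P[]) (λ ()) (λ ())
                      (λ s → contradiction (holds s) ¬P[])
  where
  holds : [ s ∈ Subset 0 ∣ P s ] → P []
  holds ([] , irr q) = recompute (P? []) q
finite-refinement {suc n} P P?
  with finite-refinement (λ s → P (inside ∷ s)) (λ s → P? (inside ∷ s))
     | finite-refinement (λ s → P (outside ∷ s)) (λ s → P? (outside ∷ s))
... | i , in↔ | o , out↔ = i + o , ↔-sym +↔⊎ ↔-∘ ((in↔ ⊎-↔ out↔) ↔-∘ mk↔ₛ′ split join split∘join join∘split)
  where
  In Out All : Set
  In  = [ s ∈ Subset n ∣ P (inside ∷ s) ]
  Out = [ s ∈ Subset n ∣ P (outside ∷ s) ]
  All = [ s ∈ Subset (suc n) ∣ P s ]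

  split : All → In ⊎ Out
  split ((inside  ∷ s) , q) = inj₁ (s , q)
  split ((outside ∷ s) , q) = inj₂ (s , q)

  join : In ⊎ Out → All
  join (inj₁ (s , q)) = (inside  ∷ s) , q
  join (inj₂ (s , q)) = (outside ∷ s) , q

  split∘join : ∀ x → split (join x) ≡ x
  split∘join (inj₁ _) = refl
  split∘join (inj₂ _) = refl

  join∘split : ∀ x → join (split x) ≡ x
  join∘split ((inside  ∷ s) , q) = refl
  join∘split ((outside ∷ s) , q) = refl

module _ (X : SimplicialSurface p) where
  open SimplicialSurface X

  faces : ∃ λ k → Face ↔ Fin k
  faces = finite-refinement (λ s → IsSimplex s × ∣ s ∣ ≡ 3) (λ s → isSimplex? s ×-dec (∣ s ∣ ≟ 3))

  Adjacent : Rel Face 0ℓ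
  Adjacent F G = F ≢ G × ShareEdge F G

  skipEqual : ∀ {F G} → Star ShareEdge F G → Star Adjacent F G
  skipEqual ε = ε
  skipEqual (_◅_ {F} {G} e es) with via-injection (↔⇒↣ (proj₂ faces)) _≟ᶠ_ F G
  ... | yes refl = skipEqual es
  ... | no  F≢G  = (F≢G , e) ◅ skipEqual es

  faceGraph : Graph
  faceGraph = record
    { Node        = Face
    ; _~_         = Adjacent
    ; order       = proj₁ faces
    ; enumeration = proj₂ faces
    ; ~-sym       = λ (F≢G , e , e⊆F , e⊆G) → F≢G ∘ sym , e , e⊆G , e⊆F
    ; ~-irrefl    = λ (F≢F , _) → F≢F refl
    ; connected   = λ F G → skipEqual (stronglyConnected F G)
    }

  open Aut
  open GraphAut using () renaming (perm to permᵍ)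

  -- λ_X(π) = ρ, that is, ρ is the permutation of the faces induced by π;
  -- λAut below is the image of λ_X.
  Induces : Aut X → GraphAut faceGraph → Set
  Induces π ρ = ∀ F → IsImage X (perm π) F (ρ · F)

  λAut : Subgroup faceGraph
  λAut = record
    { Member    = λ ρ → ∃ λ π → Induces π ρ
    ; ≈-closed  = λ σ≈τ (π , ind) → π , λ F → subst (IsImage X (perm π) F) (σ≈τ F) (ind F)
    ; id-closed = record { perm = ↔-id _ ; faceToFaces = λ F → F , id-image F } , id-image
    ; ∘-closed  = λ {σ} {τ} (π , indπ) (ρ , indρ) →
        let ind = λ F → ∘-image π ρ {F} {τ · F} {σ · τ · F} (indρ F) (indπ (τ · F))
        in record { perm = perm π ↔-∘ perm ρ ; faceToFaces = λ F → (σ · τ · F) , ind F } , ind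
    ; ⁻¹-closed = λ {σ} (π , indπ) →
        let ind = λ F → ⁻¹-image π {F} {(σ ⁻¹ᵍ) · F} (subst (IsImage X (perm π) ((σ ⁻¹ᵍ) · F))
                          (strictlyInverseˡ (permᵍ σ) F) (indπ ((σ ⁻¹ᵍ) · F)))
        in record { perm = ↔-sym (perm π) ; faceToFaces = λ F → ((σ ⁻¹ᵍ) · F) , ind F } , ind
    }
    where
    preimage : ∀ π {F G w} → IsImage X π F G → w ∈ᵥ G → ∃ λ v → v ∈ᵥ F × to π v ≡ w
    preimage _ {w = w} F↦G = Equivalence.to (F↦G w)

    image : ∀ π {F G v} → IsImage X π F G → v ∈ᵥ F → to π v ∈ᵥ G
    image _ F↦G v∈F = Equivalence.from (F↦G _) (_ , v∈F , refl)

    id-image : ∀ F → IsImage X (↔-id _) F F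
    id-image F w = mk⇔ (λ w∈F → w , w∈F , refl) (λ { (_ , v∈F , refl) → v∈F })

    ∘-image : ∀ π ρ {F G K} → IsImage X (perm ρ) F G → IsImage X (perm π) G K →
              IsImage X (perm π ↔-∘ perm ρ) F K
    ∘-image π ρ {F} {G} {K} F↦G G↦K w = mk⇔
      (λ w∈K → let (v , v∈G , πv≡w) = preimage (perm π) {G} {K} G↦K w∈K
                   (x , x∈F , ρx≡v) = preimage (perm ρ) {F} {G} F↦G v∈G
               in x , x∈F , trans (cong (to (perm π)) ρx≡v) πv≡w)
      (λ (x , x∈F , eq) → subst (_∈ᵥ K) eq (image (perm π) {G} {K} G↦K (image (perm ρ) {F} {G} F↦G x∈F)))

    ⁻¹-image : ∀ π {F G} → IsImage X (perm π) G F → IsImage X (↔-sym (perm π)) F G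
    ⁻¹-image π {F} {G} G↦F w = mk⇔
      (λ w∈G → to (perm π) w , image (perm π) {G} {F} G↦F w∈G , strictlyInverseʳ (perm π) w)
      (λ (v , v∈F , eq) → let (x , x∈G , πx≡v) = preimage (perm π) {G} {F} G↦F v∈F
                          in subst (_∈ᵥ G) (trans (sym (strictlyInverseʳ (perm π) x))
                                                  (trans (cong (from (perm π)) πx≡v) eq)) x∈G)

{-# OPTIONS --safe #-}

-- If vf(X) = (2,2), the stabiliser of a face F₀ contains an involution φ swapping
-- two corners a₀, b₀ and fixing the third, c₀.  The two vertex orbits colour the
-- vertices so that every face has exactly one corner of the colour κ of c₀; an arc
-- of the face graph belongs to E₁ if the edge shared by its two faces has a vertex
-- of colour κ, and to E₂ otherwise.  The umbrella of c₀ has all its arcs in E₁,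
-- that of a₀ alternates between E₁ and E₂, and an automorphism fixing a₀ that
-- advances its umbrella by two faces presents it as an α-cycle.  The sizes of E₁
-- and E₂ follow by counting ordered arcs face by face and dividing out the free
-- involution which reverses arcs.
--
-- Conversely the cycle u carries one colour and the α-cycle both, so their vertices
-- lie in different orbits; these are all the orbits, since the umbrella of every
-- vertex is an image of one of the two cycles.  The order of a face stabiliser is
-- read off |H| = 2|V|.

module Submission where

open import Defs
open import Level using (Level; 0ℓ)
open import Data.Bool using (Bool; true; false; if_then_else_)
open import Data.Fin using (Fin; combine; remQuot) renaming (zero to 0F; suc to sucᶠ)
import Data.Fin as Fin
import Data.Fin.Properties as Fin
open import Data.Fin.Subset using (Subset; inside; outside; ⁅_⁆; _∈_; _∉_; _⊆_; _∩_; _-_; ∣_∣)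
import Data.Fin.Subset.Properties as Subset
open import Data.Irrelevant using () renaming ([_] to irr)
open import Data.List using (List; []; _∷_; _++_; _∷ʳ_; length; map; concatMap; upTo; applyUpTo; reverse; deduplicate; filter; InitLast; initLast; _∷ʳ′_)
open import Data.List.Properties
open import Data.List.Membership.Propositional using () renaming (_∈_ to _∈ₗ_)
open import Data.List.Membership.Propositional.Properties using (∈-∃++; ∈-++⁺ʳ; ∈-map⁺; ∈-map⁻; ∈-applyUpTo⁺)
open import Data.List.Relation.Binary.Permutation.Propositional using (_↭_; ↭-sym; ↭-trans; ↭⇒↭ₛ)
open import Data.List.Relation.Binary.Permutation.Propositional.Properties using (++-comm; ↭-reverse; ∈-resp-↭; ↭-length)
import Data.List.Relation.Binary.Permutation.Setoid.Properties as Permutation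
open import Data.List.Relation.Unary.All using (All; []; _∷_)
import Data.List.Relation.Unary.All as All
import Data.List.Relation.Unary.All.Properties as All
open import Data.List.Relation.Unary.AllPairs using ([]; _∷_)
open import Data.List.Relation.Unary.Any using (here; there)
open import Data.List.Relation.Unary.Linked using (Linked; []; [-]; _∷_)
import Data.List.Relation.Unary.Linked as Linked
import Data.List.Relation.Unary.Linked.Properties as Linked
open import Data.List.Relation.Unary.Unique.Propositional using (Unique)
import Data.List.Relation.Unary.Unique.Propositional.Properties as Unique
open import Data.Nat using (ℕ; zero; suc; _+_; _*_; _≤_; _<_; _≡ᵇ_; _≟_; z≤n; s≤s)
import Data.Nat.Properties as ℕ
open import Data.Product using (∃; ∃₂; Σ-syntax; _×_; _,_; proj₁; proj₂)
open import Data.Product.Relation.Binary.Pointwise.NonDependent using (Pointwise)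
open import Data.Refinement using (_,_; value; value-injective)
open import Data.Sum using (_⊎_; inj₁; inj₂; [_,_]′)
open import Data.Vec using ([]; _∷_; here; there)
open import Function using (_∘_; id; _⇔_; mk⇔; Equivalence; Inverse; mk↔ₛ′; Congruent; Injective)
open import Relation.Binary using (Rel; Symmetric; DecidableEquality; IsEquivalence; tri<; tri≈; tri>)
open import Relation.Binary.Construct.Closure.ReflexiveTransitive using (Star; ε; _◅_)
open import Relation.Binary.PropositionalEquality hiding ([_])
open import Relation.Nullary using (¬_; yes; no; contradiction; recompute; Dec)
open import Relation.Nullary.Decidable using (map′)
open import Relation.Unary using (Pred; Decidable; _≐_)

open Inverse using (to; from; strictlyInverseˡ; strictlyInverseʳ)

-- Two facts carry the proof. The faces around a vertex, with adjacency restricted to them, have at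
-- most two neighbours each; hence an umbrella is determined by two consecutive faces, and a
-- non-backtracking walk around the vertex can only trace it. This replaces a direct computation of
-- the α-cycle: the walk `Fₘ`, `F₀`, `σFₘ`, `σF₀`, ... stays at `a₀` and never backtracks, so it is
-- the umbrella. The other fact is rigidity: by strong connectivity, an automorphism fixing the
-- corners of one face is the identity. So a stabiliser acts faithfully on three corners, and a
-- power of `σ`, which fixes `a₀`, is trivial as soon as it fixes `F₀`. That is why the order of `σ`
-- is half the length of the umbrella. The umbrellas of any surface form a vertex-faithful cycle
-- double cover, so the conditions on the cover reduce to identifying the orbits of `u` and of the
-- α-cycle with the set of umbrellas.

private
  variable
    ℓᴬ ℓᴮ ℓ ℓ′ ℓ″ : Level
    A : Set ℓᴬ
    B : Set ℓᴮ
    k m n p : ℕ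

-- Cardinalities of finite quotients

card : {_≈_ : Rel A ℓ} (f : A → Fin k) → Congruent _≈_ _≡_ f → Injective _≈_ _≡_ f →
       (∀ i → ∃ λ x → f x ≡ i) → HasCard A _≈_ k
card f cong-f inj surj = f , cong-f , inj , λ i →
  let (x , fx≡i) = surj i in x , λ z≈x → trans (cong-f z≈x) fx≡i

module _ {_≈_ : Rel A ℓ} where

  index : HasCard A _≈_ k → A → Fin k
  index (f , _) = f

  index-cong : (h : HasCard A _≈_ k) → Congruent _≈_ _≡_ (index h)
  index-cong (_ , cong-f , _) = cong-f

  index-injective : (h : HasCard A _≈_ k) → Injective _≈_ _≡_ (index h)
  index-injective (_ , _ , inj , _) = inj

  element : HasCard A _≈_ k → Fin k → A
  element (_ , _ , _ , surj) i = proj₁ (surj i)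

  index-element : (h : HasCard A _≈_ k) → (∀ {x} → x ≈ x) → ∀ i → index h (element h i) ≡ i
  index-element (_ , _ , _ , surj) ≈-refl i = proj₂ (surj i) ≈-refl

card-via : {_≈₁_ : Rel A ℓ} {_≈₂_ : Rel B ℓ′} (g : A → B) →
           Congruent _≈₁_ _≈₂_ g → Injective _≈₁_ _≈₂_ g → (∀ y → ∃ λ x → g x ≈₂ y) →
           HasCard B _≈₂_ k → HasCard A _≈₁_ k
card-via g cong-g inj-g surj-g (f , cong-f , inj-f , surj-f) =
  card (f ∘ g) (cong-f ∘ cong-g) (inj-g ∘ inj-f) λ i →
    let (y , fy≡i) = surj-f i
        (x , gx≈y) = surj-g y
    in x , fy≡i gx≈y

card-⇔ : {_≈₁_ : Rel A ℓ} {_≈₂_ : Rel A ℓ′} → (∀ {x y} → x ≈₁ y → x ≈₂ y) →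
         (∀ {x y} → x ≈₂ y → x ≈₁ y) → (∀ {x} → x ≈₂ x) →
         HasCard A _≈₂_ k → HasCard A _≈₁_ k
card-⇔ 1⇒2 2⇒1 refl₂ = card-via id 1⇒2 2⇒1 λ y → y , refl₂

card-unique : {_≈_ : Rel A ℓ} → (∀ {x} → x ≈ x) → HasCard A _≈_ m → HasCard A _≈_ n → m ≡ n
card-unique {_≈_ = _≈_} ≈-refl h h′ = ℕ.≤-antisym (le h h′) (le h′ h)
  where
  le : HasCard _ _≈_ k → HasCard _ _≈_ n → k ≤ n
  le g g′ = Fin.injective⇒≤ {f = index g′ ∘ element g} λ {i} {j} eq →
    trans (sym (index-element g ≈-refl i))
      (trans (index-cong g (index-injective g′ eq)) (index-element g ≈-refl j))

card-× : {_≈₁_ : Rel A ℓ} {_≈₂_ : Rel B ℓ′} → (∀ {x} → x ≈₁ x) → (∀ {y} → y ≈₂ y) →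
         HasCard A _≈₁_ m → HasCard B _≈₂_ n → HasCard (A × B) (Pointwise _≈₁_ _≈₂_) (m * n)
card-× {m = m} {n = n} refl₁ refl₂ h₁ h₂ = card
  (λ (x , y) → combine (index h₁ x) (index h₂ y))
  (λ (x≈ , y≈) → cong₂ combine (index-cong h₁ x≈) (index-cong h₂ y≈))
  (λ {(x , y)} {(x′ , y′)} eq →
    let (eq₁ , eq₂) = Fin.combine-injective (index h₁ x) (index h₂ y) (index h₁ x′) (index h₂ y′) eq
    in index-injective h₁ eq₁ , index-injective h₂ eq₂)
  (λ i → let (j , k) = remQuot {m} n i in
    (element h₁ j , element h₂ k) ,
    trans (cong₂ combine (index-element h₁ refl₁ j) (index-element h₂ refl₂ k))
          (Fin.combine-remQuot {m} n i))

card-Fin : HasCard (Fin k) _≡_ k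
card-Fin = card id id id λ i → i , refl

card-subset-Fin : ∀ {k} {P : Pred (Fin k) ℓ} → Decidable P →
                  ∃ λ s → HasCard (∃ P) (λ x y → proj₁ x ≡ proj₁ y) s
card-subset-Fin {k = zero}  P? = 0 , card (λ ()) (λ { {()} }) (λ { {()} }) λ ()
card-subset-Fin {k = suc k} {P = P} P? with P? 0F | card-subset-Fin (P? ∘ sucᶠ)
... | no ¬p0 | s , h = s , card f (λ {x} {y} → f-cong x y) (λ {x} {y} → f-inj x y) λ i →
        (sucᶠ (proj₁ (element h i)) , proj₂ (element h i)) , index-element h refl i
  where
  f : ∃ P → Fin s
  f (0F , p)     = contradiction p ¬p0
  f (sucᶠ i , p) = index h (i , p)
  f-cong : ∀ x y → proj₁ x ≡ proj₁ y → f x ≡ f y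
  f-cong (0F , p) _ _ = contradiction p ¬p0
  f-cong (sucᶠ i , p) (sucᶠ .i , q) refl = index-cong h refl
  f-inj : ∀ x y → f x ≡ f y → proj₁ x ≡ proj₁ y
  f-inj (0F , p) _ _ = contradiction p ¬p0
  f-inj (sucᶠ i , p) (0F , q) _ = contradiction q ¬p0
  f-inj (sucᶠ i , p) (sucᶠ j , q) eq = cong sucᶠ (index-injective h eq)
... | yes p0 | s , h = suc s , card f (λ {x} {y} → f-cong x y) (λ {x} {y} → f-inj x y) surj
  where
  f : ∃ P → Fin (suc s)
  f (0F , p)     = 0F
  f (sucᶠ i , p) = sucᶠ (index h (i , p))
  f-cong : ∀ x y → proj₁ x ≡ proj₁ y → f x ≡ f y
  f-cong (0F , p) (0F , q) _ = refl
  f-cong (sucᶠ i , p) (sucᶠ .i , q) refl = cong sucᶠ (index-cong h refl)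
  f-inj : ∀ x y → f x ≡ f y → proj₁ x ≡ proj₁ y
  f-inj (0F , p) (0F , q) _ = refl
  f-inj (sucᶠ i , p) (sucᶠ j , q) eq = cong sucᶠ (index-injective h (Fin.suc-injective eq))
  surj : ∀ i → ∃ λ x → f x ≡ i
  surj 0F       = (0F , p0) , refl
  surj (sucᶠ i) = (sucᶠ (proj₁ (element h i)) , proj₂ (element h i)) ,
                  cong sucᶠ (index-element h refl i)

module _ {_≈_ : Rel A ℓ} (≈-equiv : IsEquivalence _≈_) (h : HasCard A _≈_ n) where
  private module ≈ = IsEquivalence ≈-equiv

  element-index : ∀ x → element h (index h x) ≈ x
  element-index x = index-injective h (index-element h ≈.refl (index h x))

  card-subset : {P : Pred A ℓ′} → Decidable P → (∀ {x y} → x ≈ y → P x → P y) →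
                ∃ λ s → HasCard (∃ P) (λ x y → proj₁ x ≈ proj₁ y) s
  card-subset {P = P} P? resp with card-subset-Fin (λ i → P? (element h i))
  ... | s , hP = s , card-via {_≈₂_ = λ x y → proj₁ x ≡ proj₁ y}
    (λ (x , px) → index h x , resp (≈.sym (element-index x)) px)
    (index-cong h) (index-injective h)
    (λ (i , p) → (element h i , p) , index-element h ≈.refl i) hP

  module _ (s : A → A) (s-cong : ∀ {x y} → x ≈ y → s x ≈ s y)
           (s-involutive : ∀ x → s (s x) ≈ x) (s-free : ∀ x → ¬ (s x ≈ x)) where

    private
      infix 4 _∼_
      _∼_ : Rel A _
      x ∼ y = (x ≈ y) ⊎ (x ≈ s y)

      ∼-sym : ∀ {x y} → x ∼ y → y ∼ x
      ∼-sym (inj₁ x≈y)  = inj₁ (≈.sym x≈y)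
      ∼-sym (inj₂ x≈sy) = inj₂ (≈.trans (≈.sym (s-involutive _)) (≈.sym (s-cong x≈sy)))

      ∼-trans : ∀ {x y z} → x ∼ y → y ∼ z → x ∼ z
      ∼-trans (inj₁ p) (inj₁ q) = inj₁ (≈.trans p q)
      ∼-trans (inj₁ p) (inj₂ q) = inj₂ (≈.trans p q)
      ∼-trans (inj₂ p) (inj₁ q) = inj₂ (≈.trans p (s-cong q))
      ∼-trans (inj₂ p) (inj₂ q) = inj₁ (≈.trans p (≈.trans (s-cong q) (s-involutive _)))

      P : Pred A _
      P x = index h x Fin.< index h (s x)

      P-resp : ∀ {x y} → x ≈ y → P x → P y
      P-resp x≈y = subst₂ Fin._<_ (index-cong h x≈y) (index-cong h (s-cong x≈y))

      P-or-P-s : ∀ x → P x ⊎ P (s x)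
      P-or-P-s x with Fin.<-cmp (index h x) (index h (s x))
      ... | tri< lt _ _ = inj₁ lt
      ... | tri≈ _ eq _ = contradiction (≈.sym (index-injective h eq)) (s-free x)
      ... | tri> _ _ gt = inj₂ (subst (index h (s x) Fin.<_) (index-cong h (≈.sym (s-involutive x))) gt)

      P-exclusive : ∀ {x} → P x → ¬ P (s x)
      P-exclusive px psx =
        Fin.<-asym px (subst (index h (s _) Fin.<_) (index-cong h (s-involutive _)) psx)

      P-∼⇒≈ : ∀ {x y} → P x → P y → x ∼ y → x ≈ y
      P-∼⇒≈ px py (inj₁ x≈y)  = x≈y
      P-∼⇒≈ px py (inj₂ x≈sy) = contradiction (P-resp x≈sy px) (P-exclusive py)

      _≈ₚ_ : Rel (∃ P) _
      x ≈ₚ y = proj₁ x ≈ proj₁ y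

      rep : A → ∃ P
      rep x with P-or-P-s x
      ... | inj₁ px  = x , px
      ... | inj₂ psx = s x , psx

      rep-∼ : ∀ x → x ∼ proj₁ (rep x)
      rep-∼ x with P-or-P-s x
      ... | inj₁ px  = inj₁ ≈.refl
      ... | inj₂ psx = inj₂ (≈.sym (s-involutive x))

      rep-P : ∀ x → P (proj₁ (rep x))
      rep-P x = proj₂ (rep x)

      side : A → Fin 2
      side x with P-or-P-s x
      ... | inj₁ _ = 0F
      ... | inj₂ _ = sucᶠ 0F

      split : ∀ {x y} → side x ≡ side y → rep x ≈ₚ rep y → x ≈ y
      split {x} {y} eq r with P-or-P-s x | P-or-P-s y
      ... | inj₁ _ | inj₁ _ = r
      ... | inj₂ _ | inj₂ _ = ≈.trans (≈.sym (s-involutive x)) (≈.trans (s-cong r) (s-involutive y))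

      side-cong : ∀ {x y} → x ≈ y → side x ≡ side y
      side-cong {x} {y} x≈y with P-or-P-s x | P-or-P-s y
      ... | inj₁ _  | inj₁ _  = refl
      ... | inj₂ _  | inj₂ _  = refl
      ... | inj₁ px | inj₂ psy = contradiction psy (P-exclusive (P-resp x≈y px))
      ... | inj₂ psx | inj₁ py = contradiction (P-resp (s-cong x≈y) psx) (P-exclusive py)

      lift : Fin 2 × ∃ P → A
      lift (0F , x , _)      = x
      lift (sucᶠ 0F , x , _) = s x

      side-lift : ∀ i x → side (lift (i , x)) ≡ i
      side-lift 0F (x , px) with P-or-P-s x
      ... | inj₁ _   = refl
      ... | inj₂ psx = contradiction psx (P-exclusive px)
      side-lift (sucᶠ 0F) (x , px) with P-or-P-s (s x)
      ... | inj₁ psx = contradiction psx (P-exclusive px)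
      ... | inj₂ _   = refl

      lift-∼ : ∀ i x → lift (i , x) ∼ proj₁ x
      lift-∼ 0F x        = inj₁ ≈.refl
      lift-∼ (sucᶠ 0F) x = inj₂ ≈.refl

      rep-cong : ∀ {x y} → x ∼ y → rep x ≈ₚ rep y
      rep-cong {x} {y} x∼y =
        P-∼⇒≈ (rep-P x) (rep-P y) (∼-trans (∼-sym (rep-∼ x)) (∼-trans x∼y (rep-∼ y)))

      rep-of-P : ∀ {y} (x : ∃ P) → y ∼ proj₁ x → rep y ≈ₚ x
      rep-of-P {y} (x , px) y∼x = P-∼⇒≈ (rep-P y) px (∼-trans (∼-sym (rep-∼ y)) y∼x)

    -- Of `x` and `s x` exactly one has a smaller index than its `s`-image, equality being excluded
    -- by freeness. These elements, the predicate `P`, represent the pairs; recording in `side`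
    -- which member of its pair an element is identifies `A` with `Fin 2 × ∃ P`, which gives
    -- `2 * j ≡ n`.
    card-free-involution : ∃ λ j → HasCard A (λ x y → (x ≈ y) ⊎ (x ≈ s y)) j × 2 * j ≡ n
    card-free-involution =
      let (j , hP) = card-subset (λ x → index h x Fin.<? index h (s x)) P-resp
      in j ,
        card-via rep rep-cong
          (λ {x} {y} r → ∼-trans (rep-∼ x) (∼-trans (inj₁ r) (∼-sym (rep-∼ y))))
          (λ x → proj₁ x , rep-of-P x (inj₁ ≈.refl)) hP ,
        card-unique ≈.refl
          (card-via {_≈₂_ = Pointwise _≡_ _≈ₚ_} (λ x → side x , rep x)
            (λ x≈y → side-cong x≈y , rep-cong (inj₁ x≈y)) (λ (eq , r) → split eq r)
            (λ (i , x) → lift (i , x) , side-lift i x , rep-of-P x (lift-∼ i x))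
            (card-× refl ≈.refl card-Fin hP))
          h

module _ (h : HasCard A _≡_ n) (f : A → A) (f-injective : ∀ {x y} → f x ≡ f y → x ≡ y) where

  -- Two of y, f y, f (f y), … coincide; cancelling f leads back to y.
  injective⇒surjective : ∀ y → ∃ λ x → f x ≡ y
  injective⇒surjective y =
    let (i , j , i<j , eq) = Fin.pigeonhole (ℕ.n<1+n n) (index h ∘ iter ∘ Fin.toℕ)
    in cancel (Fin.toℕ i) (Fin.toℕ j) i<j (index-injective h eq)
    where
    iter : ℕ → A
    iter zero    = y
    iter (suc i) = f (iter i)
    cancel : ∀ i j → i < j → iter i ≡ iter j → ∃ λ x → f x ≡ y
    cancel zero    (suc j) _         eq = iter j , sym eq
    cancel (suc i) (suc j) (s≤s i<j) eq = cancel i j i<j (f-injective eq)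

-- Cyclic lists

≈ᶜ-refl : {C : List A} → C ≈ᶜ C
≈ᶜ-refl {C = C} = [] , C , refl , inj₁ (sym (++-identityʳ C))

-- Any rotation iterates moving the head to the end, so closure under this one move and under
-- reversal covers all of `_≈ᶜ_`.
≈ᶜ-resp : (P : Pred (List A) ℓ) → (∀ {x xs} → P (x ∷ xs) → P (xs ∷ʳ x)) →
          (∀ {xs} → P xs → P (reverse xs)) → ∀ {C D} → C ≈ᶜ D → P C → P D
≈ᶜ-resp P P-rotate P-reverse = λ where
    (xs , ys , refl , inj₁ refl) p → rotate xs ys p
    (xs , ys , refl , inj₂ refl) p → P-reverse (rotate xs ys p)
  where
  rotate : ∀ xs ys → P (xs ++ ys) → P (ys ++ xs)
  rotate []       ys p = subst P (sym (++-identityʳ ys)) p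
  rotate (x ∷ xs) ys p = subst P (++-assoc ys (x ∷ []) xs)
    (rotate xs (ys ∷ʳ x) (subst P (++-assoc xs ys (x ∷ [])) (P-rotate p)))

≈ᶜ⇒↭ : {C D : List A} → C ≈ᶜ D → C ↭ D
≈ᶜ⇒↭ (xs , ys , refl , inj₁ refl) = ++-comm xs ys
≈ᶜ⇒↭ (xs , ys , refl , inj₂ refl) = ↭-trans (++-comm xs ys) (↭-sym (↭-reverse (ys ++ xs)))

≈ᶜ-∈ : ∀ {x : A} {C D} → C ≈ᶜ D → x ∈ₗ C → x ∈ₗ D
≈ᶜ-∈ C≈D = ∈-resp-↭ (≈ᶜ⇒↭ C≈D)

≈ᶜ-∈⁻ : ∀ {x : A} {C D} → C ≈ᶜ D → x ∈ₗ D → x ∈ₗ C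
≈ᶜ-∈⁻ C≈D = ∈-resp-↭ (↭-sym (≈ᶜ⇒↭ C≈D))

≈ᶜ-length : {C D : List A} → C ≈ᶜ D → length C ≡ length D
≈ᶜ-length C≈D = ↭-length (≈ᶜ⇒↭ C≈D)

≈ᶜ-Unique : {C D : List A} → C ≈ᶜ D → Unique C → Unique D
≈ᶜ-Unique {A = A} C≈D = Permutation.Unique-resp-↭ (setoid A) (↭⇒↭ₛ (≈ᶜ⇒↭ C≈D))

module _ {R : Rel A ℓ} where

  Linked-∷ʳ : ∀ {x y} xs → Linked R (xs ∷ʳ x) → R x y → Linked R (xs ∷ʳ x ∷ʳ y)
  Linked-∷ʳ []            [-]     r = r ∷ [-]
  Linked-∷ʳ (_ ∷ [])      (q ∷ l) r = q ∷ Linked-∷ʳ [] l r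
  Linked-∷ʳ (_ ∷ z ∷ zs)  (q ∷ l) r = q ∷ Linked-∷ʳ (z ∷ zs) l r

  Linked-reverse : Symmetric R → ∀ {xs} → Linked R xs → Linked R (reverse xs)
  Linked-reverse R-sym []  = []
  Linked-reverse R-sym [-] = [-]
  Linked-reverse R-sym {x ∷ y ∷ xs} (r ∷ l) =
    subst (Linked R) (sym (trans (unfold-reverse x (y ∷ xs)) (cong (_∷ʳ x) (unfold-reverse y xs))))
      (Linked-∷ʳ (reverse xs) (subst (Linked R) (unfold-reverse y xs) (Linked-reverse R-sym l)) (R-sym r))

  Cyclic-rotate : ∀ {x xs} → Cyclic R (x ∷ xs) → Cyclic R (xs ∷ʳ x)
  Cyclic-rotate {xs = []}     c       = c
  Cyclic-rotate {xs = y ∷ ys} (r ∷ l) = Linked-∷ʳ (y ∷ ys) l r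

  -- The closed list `x ∷ xs ∷ʳ x` read backwards is the closed list of `x ∷ reverse xs`, which is
  -- one rotation away from `reverse (x ∷ xs)`.
  Cyclic-reverse : Symmetric R → ∀ {C} → Cyclic R C → Cyclic R (reverse C)
  Cyclic-reverse R-sym {x ∷ xs} c =
    subst (Cyclic R) (sym (unfold-reverse x xs))
      (Cyclic-rotate {x = x} {xs = reverse xs} (subst (Linked R) lemma (Linked-reverse R-sym c)))
    where
    lemma : reverse (x ∷ xs ∷ʳ x) ≡ x ∷ reverse xs ∷ʳ x
    lemma = trans (reverse-++ (x ∷ xs) (x ∷ [])) (cong (x ∷_) (unfold-reverse x xs))

  ≈ᶜ-Cyclic : Symmetric R → ∀ {C D} → C ≈ᶜ D → Cyclic R C → Cyclic R D
  ≈ᶜ-Cyclic R-sym = ≈ᶜ-resp (Cyclic R) (λ {x} {xs} → Cyclic-rotate {x} {xs})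
                                        (λ {C} → Cyclic-reverse R-sym {C})

Linked-map-All : {P : Pred A ℓ} {R : Rel A ℓ′} {S : Rel A ℓ″} →
                 (∀ {x y} → P x → P y → R x y → S x y) →
                 ∀ {xs} → All P xs → Linked R xs → Linked S xs
Linked-map-All f _              []      = []
Linked-map-All f _              [-]     = [-]
Linked-map-All f (p ∷ ps@(q ∷ _)) (r ∷ l) = f p q r ∷ Linked-map-All f ps l

Cyclic-map-All : {P : Pred A ℓ} {R : Rel A ℓ′} {S : Rel A ℓ″} →
                 (∀ {x y} → P x → P y → R x y → S x y) →
                 ∀ {C} → All P C → Cyclic R C → Cyclic S C
Cyclic-map-All f {x ∷ xs} (p ∷ ps) = Linked-map-All f (p ∷ All.++⁺ ps (p ∷ []))

AtMostTwoNeighbours : {A : Set ℓᴬ} → Rel A ℓ → Set _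
AtMostTwoNeighbours R = ∀ {x c d y} → R x c → R x d → c ≢ d → R x y → (y ≡ c) ⊎ (y ≡ d)

module _ {R : Rel A ℓ} (deg : AtMostTwoNeighbours R) (R-sym : Symmetric R) where

  next-unique : ∀ {p x c d} → R p x → R x c → p ≢ c → R x d → p ≢ d → c ≡ d
  next-unique p∼x x∼c p≢c x∼d p≢d with deg (R-sym p∼x) x∼d p≢d x∼c
  ... | inj₁ c≡p = contradiction (sym c≡p) p≢c
  ... | inj₂ c≡d = c≡d

  -- In `C` rotated to begin at `x`, the second and the last entry are distinct neighbours of `x`,
  -- so `y` is one of them; if it is the last, the reversed list begins with `x` and `y`.
  startAt : ∀ {x y C} → 3 ≤ length C → Unique C → Cyclic R C → x ∈ₗ C → R x y →
            ∃ λ zs → C ≈ᶜ (x ∷ y ∷ zs)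
  startAt {x} {y} C≥3 C! C∼ x∈C x∼y with ∈-∃++ x∈C
  ... | xs , ys , refl = go (ys ++ xs) refl (initLast (ys ++ xs))
    where
    rotation : (xs ++ x ∷ ys) ≈ᶜ (x ∷ ys ++ xs)
    rotation = xs , x ∷ ys , refl , inj₁ refl
    go : ∀ ws → ys ++ xs ≡ ws → InitLast ws → ∃ λ zs → (xs ++ x ∷ ys) ≈ᶜ (x ∷ y ∷ zs)
    go _ eq [] = contradiction (subst (3 ≤_) (trans (≈ᶜ-length rotation) (cong (suc ∘ length) eq)) C≥3)
                   λ { (s≤s ()) }
    go _ eq ([] ∷ʳ′ d) = contradiction (subst (3 ≤_) (trans (≈ᶜ-length rotation) (cong (suc ∘ length) eq)) C≥3)
                   λ { (s≤s (s≤s ())) }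
    go _ eq ((c ∷ us) ∷ʳ′ d)
      with ≈ᶜ-Unique rotation C! | ≈ᶜ-Cyclic R-sym rotation C∼
    ... | D! | D∼ with subst (λ ws → Unique (x ∷ ws)) eq D! | subst (λ ws → Cyclic R (x ∷ ws)) eq D∼
    ... | _ ∷ c∉ ∷ _ | x∼c ∷ l with deg x∼c (R-sym (last-two (c ∷ us) l)) (All.lookup c∉ (∈-++⁺ʳ us (here refl))) x∼y
      where
      last-two : ∀ zs {d e} → Linked R ((zs ∷ʳ d) ∷ʳ e) → R d e
      last-two []           (r ∷ _) = r
      last-two (_ ∷ [])     (_ ∷ l) = last-two [] l
      last-two (_ ∷ z ∷ zs) (_ ∷ l) = last-two (z ∷ zs) l
    ... | inj₁ refl = us ∷ʳ d , subst ((xs ++ x ∷ ys) ≈ᶜ_) (cong (x ∷_) eq) rotation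
    -- Cutting `C` just after `x` and reversing gives `x`, then `d`, then the other entries
    -- backwards.
    ... | inj₂ refl = reverse (c ∷ us) , xs ∷ʳ x , ys , sym (++-assoc xs (x ∷ []) ys) , inj₂ (begin
        x ∷ d ∷ reverse (c ∷ us)         ≡⟨ cong (x ∷_) (reverse-++ (c ∷ us) (d ∷ [])) ⟨
        x ∷ reverse ((c ∷ us) ∷ʳ d)      ≡⟨ reverse-++ ((c ∷ us) ∷ʳ d) (x ∷ []) ⟨
        reverse ((c ∷ us) ∷ʳ d ∷ʳ x)     ≡⟨ cong (reverse ∘ (_∷ʳ x)) eq ⟨
        reverse ((ys ++ xs) ∷ʳ x)        ≡⟨ cong reverse (++-assoc ys xs (x ∷ [])) ⟩
        reverse (ys ++ xs ∷ʳ x)          ∎)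
      where open ≡-Reasoning

  private
    -- Each entry is forced by the two before it. The paths also stop together: where only one of
    -- them has arrived at `x`, `next-unique` would make the next entry of the other equal to `x`,
    -- which it avoids.
    path-unique : ∀ {x p q} rs rs′ →
      Unique (p ∷ q ∷ rs) → Linked R (p ∷ q ∷ rs ∷ʳ x) → All (x ≢_) (p ∷ q ∷ rs) →
      Unique (p ∷ q ∷ rs′) → Linked R (p ∷ q ∷ rs′ ∷ʳ x) → All (x ≢_) (p ∷ q ∷ rs′) → rs ≡ rs′
    path-unique [] [] _ _ _ _ _ _ = refl
    path-unique [] (r ∷ rs) _ (p∼q ∷ q∼x ∷ _) (x≢p ∷ _) ((_ ∷ p≢r ∷ _) ∷ _) (_ ∷ q∼r ∷ _) (_ ∷ _ ∷ x≢r ∷ _) =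
      contradiction (next-unique p∼q q∼x (≢-sym x≢p) q∼r p≢r) x≢r
    path-unique (r ∷ rs) [] ((_ ∷ p≢r ∷ _) ∷ _) (_ ∷ q∼r ∷ _) (_ ∷ _ ∷ x≢r ∷ _) _ (p∼q ∷ q∼x ∷ _) (x≢p ∷ _) =
      contradiction (next-unique p∼q q∼x (≢-sym x≢p) q∼r p≢r) x≢r
    path-unique (r ∷ rs) (r′ ∷ rs′)
      ((_ ∷ p≢r ∷ _) ∷ u) (p∼q ∷ l@(q∼r ∷ _)) (_ ∷ ≢s) ((_ ∷ p≢r′ ∷ _) ∷ u′) (_ ∷ l′@(q∼r′ ∷ _)) (_ ∷ ≢s′)
      with next-unique p∼q q∼r p≢r q∼r′ p≢r′
    ... | refl = cong (r ∷_) (path-unique rs rs′ u l ≢s u′ l′ ≢s′)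

  cycle-unique : ∀ {x y zs zs′} → 3 ≤ length (x ∷ y ∷ zs) → Unique (x ∷ y ∷ zs) → Cyclic R (x ∷ y ∷ zs) →
                 3 ≤ length (x ∷ y ∷ zs′) → Unique (x ∷ y ∷ zs′) → Cyclic R (x ∷ y ∷ zs′) → zs ≡ zs′
  cycle-unique {zs = []} (s≤s (s≤s ()))
  cycle-unique {zs = _ ∷ _} {zs′ = []} _ _ _ (s≤s (s≤s ()))
  cycle-unique {zs = r ∷ rs} {zs′ = r′ ∷ rs′}
    _ (x≢@(_ ∷ x≢r ∷ _) ∷ u) (x∼y ∷ l@(y∼r ∷ _)) _ (x≢′@(_ ∷ x≢r′ ∷ _) ∷ u′) (_ ∷ l′@(y∼r′ ∷ _))
    with next-unique x∼y y∼r x≢r y∼r′ x≢r′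
  ... | refl = cong (r ∷_) (path-unique rs rs′ u l x≢ u′ l′ x≢′)

  private
    -- Path and walk are forced to agree entry by entry. The last component records that `f` does
    -- not backtrack across the closing point, for use in `cycle-walk`.
    path-walk : ∀ {x} (f : ℕ → A) → (∀ i → R (f i) (f (1 + i))) → (∀ i → f i ≢ f (2 + i)) → ∀ rs →
      Unique (f 0 ∷ f 1 ∷ rs) → Linked R (f 0 ∷ f 1 ∷ rs ∷ʳ x) → All (x ≢_) (f 0 ∷ f 1 ∷ rs) →
      rs ≡ applyUpTo (λ i → f (2 + i)) (length rs) × f (2 + length rs) ≡ x ×
      f (1 + length rs) ≢ f (3 + length rs)
    path-walk f f∼ f≢ [] _ (_ ∷ q ∷ _) (x≢ ∷ _) with next-unique (f∼ 0) (f∼ 1) (f≢ 0) q (≢-sym x≢)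
    ... | refl = refl , refl , f≢ 1
    path-walk f f∼ f≢ (r ∷ rs) ((_ ∷ p≢r ∷ _) ∷ u) (_ ∷ l@(q ∷ _)) (_ ∷ ≢s)
      with next-unique (f∼ 0) (f∼ 1) (f≢ 0) q p≢r
    ... | refl = let (eq , rest) = path-walk (f ∘ suc) (f∼ ∘ suc) (f≢ ∘ suc) rs u l ≢s
                 in cong (f 2 ∷_) eq , rest

  -- A non-backtracking walk along a cycle has no choice at any step.
  cycle-walk : ∀ (f : ℕ → A) → (∀ i → R (f i) (f (1 + i))) → (∀ i → f i ≢ f (2 + i)) → ∀ {zs} →
    3 ≤ length (f 0 ∷ f 1 ∷ zs) → Unique (f 0 ∷ f 1 ∷ zs) → Cyclic R (f 0 ∷ f 1 ∷ zs) →
    ∃ λ n → f 0 ∷ f 1 ∷ zs ≡ applyUpTo f n × f n ≡ f 0 × f (suc n) ≡ f 1 × 3 ≤ n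
  cycle-walk f f∼ f≢ {[]} (s≤s (s≤s ()))
  cycle-walk f f∼ f≢ {r ∷ rs} _ (x≢@(_ ∷ x≢r ∷ _) ∷ u@(f1≢ ∷ _)) (x∼y ∷ l@(y∼r ∷ l′))
    with next-unique (f∼ 0) (f∼ 1) (f≢ 0) y∼r x≢r
  ... | refl with path-walk (f ∘ suc) (f∼ ∘ suc) (f≢ ∘ suc) rs u l x≢
  -- Back at `f 0`, both `f 1` and `f (suc len)` differ from the entry `f (2 + length rs)` just
  -- left, so they coincide.
  ... | eq , fn≡f0 , back≢ = len , cong (λ zs → f 0 ∷ f 1 ∷ f 2 ∷ zs) eq , fn≡f0 ,
        sym (next-unique prev∼f0 (f∼ 0) prev≢f1 f0∼ back≢) , s≤s (s≤s (s≤s z≤n))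
    where
    len = 3 + length rs
    prev∼f0 : R (f (2 + length rs)) (f 0)
    prev∼f0 = subst (R (f (2 + length rs))) fn≡f0 (f∼ (2 + length rs))
    f0∼ : R (f 0) (f (suc len))
    f0∼ = subst (λ z → R z (f (suc len))) fn≡f0 (f∼ len)
    prev∈ : ∀ k (g : ℕ → A) → g k ∈ₗ applyUpTo g (suc k)
    prev∈ zero    g = here refl
    prev∈ (suc k) g = there (prev∈ k (g ∘ suc))
    prev≢f1 : f (2 + length rs) ≢ f 1
    prev≢f1 p≡ = All.lookup (subst (λ zs → All (f 1 ≢_) (f 2 ∷ zs)) eq f1≢)
                   (prev∈ (length rs) (λ i → f (2 + i))) (sym p≡)

-- Geometry of a simplicial surface

uncons-subset : (S : Subset n) → ∣ S ∣ ≡ suc k → ∃ λ x → x ∈ S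
uncons-subset (inside  ∷ S) _  = 0F , here
uncons-subset (outside ∷ S) eq = let (x , x∈S) = uncons-subset S eq in sucᶠ x , there x∈S

card-zero : (S : Subset n) {x : Fin n} → ∣ S ∣ ≡ 0 → x ∉ S
card-zero S {x} eq x∈S with () ← subst (∣ S - x ∣ <_) eq (Subset.x∈p⇒∣p-x∣<∣p∣ x∈S)

remove-card : (S : Subset n) {x : Fin n} → x ∈ S → ∣ S ∣ ≡ suc k → ∣ S - x ∣ ≡ k
remove-card (inside ∷ S) here eq = trans (cong ∣_∣ (Subset.p─⊥≡p S)) (ℕ.suc-injective eq)
remove-card (outside ∷ S) (there x∈S) eq = remove-card S x∈S eq
remove-card {k = zero} (inside ∷ S) (there x∈S) eq =
  contradiction x∈S (card-zero S (ℕ.suc-injective eq))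
remove-card {k = suc k} (inside ∷ S) (there x∈S) eq = cong suc (remove-card S x∈S (ℕ.suc-injective eq))

remove-∈ : {S : Subset n} {x y : Fin n} → y ∈ S - x → y ∈ S × y ≢ x
remove-∈ {S = S} {x} y∈ = Subset.p─q⊆p S _ y∈ , λ { refl → x∉ S y∈ }
  where
  x∉ : ∀ {n} (S : Subset n) {x} → x ∉ S - x
  x∉ (_ ∷ S) {0F}     ()
  x∉ (_ ∷ S) {sucᶠ x} (there x∈) = x∉ S x∈

⊆-card⇒≡ : {S T : Subset n} → S ⊆ T → ∣ S ∣ ≡ ∣ T ∣ → S ≡ T
⊆-card⇒≡ {S = S} {T} S⊆T eq = Subset.⊆-antisym S⊆T λ {x} x∈T → case x x∈T
  where
  case : ∀ x → x ∈ T → x ∈ S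
  case x x∈T with x Subset.∈? S
  ... | yes x∈S = x∈S
  ... | no  x∉S = contradiction (Subset.p⊂q⇒∣p∣<∣q∣ (S⊆T , x , x∈T , x∉S)) (ℕ.<-irrefl eq)

module Geometry (X : SimplicialSurface p) where
  open SimplicialSurface X

  _≟ᵥ_ : DecidableEquality Vertex
  v ≟ᵥ w = map′ value-injective (cong value) (value v Fin.≟ value w)

  _∈ᵥ?_ : ∀ v F → Dec (v ∈ᵥ F)
  v ∈ᵥ? F = value v Subset.∈? value F

  -- The size of `F` is known only irrelevantly; decidable equality on `ℕ` recovers it.
  face-card : ∀ (F : Face) → ∣ value F ∣ ≡ 3
  face-card (s , irr q) = recompute (∣ s ∣ ≟ 3) (proj₂ q)

  edge-card : ∀ (e : Edge) → ∣ value e ∣ ≡ 2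
  edge-card (s , irr q) = recompute (∣ s ∣ ≟ 2) (proj₂ q)

  vertexIn : ∀ (F : Face) {x} → x ∈ value F → Vertex
  vertexIn (s , irr q) {x} x∈s = x , irr (downClosed x⊆s (proj₁ q))
    where
    x⊆s : ⁅ x ⁆ ⊆ s
    x⊆s y∈ = subst (_∈ s) (sym (Subset.x∈⁅y⁆⇒x≡y x y∈)) x∈s

  subEdge : ∀ (F : Face) {t} → t ⊆ value F → ∣ t ∣ ≡ 2 → Edge
  subEdge (_ , irr q) {t} t⊆s ∣t∣≡2 = t , irr (downClosed t⊆s (proj₁ q) , ∣t∣≡2)

  face-ext : ∀ {F G : Face} → (∀ v → v ∈ᵥ F → v ∈ᵥ G) → F ≡ G
  face-ext {F} {G} F⊆G = value-injective
    (⊆-card⇒≡ (λ x∈F → F⊆G (vertexIn F x∈F) x∈F) (trans (face-card F) (sym (face-card G))))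

  record Corners (F : Face) (a b c : Vertex) : Set where
    constructor corners
    field
      a∈F      : a ∈ᵥ F
      b∈F      : b ∈ᵥ F
      c∈F      : c ∈ᵥ F
      a≢b      : a ≢ b
      a≢c      : a ≢ c
      b≢c      : b ≢ c
      complete : ∀ {v} → v ∈ᵥ F → v ≡ a ⊎ v ≡ b ⊎ v ≡ c

  corner₁ : ∀ F → ∃ λ a → a ∈ᵥ F
  corner₁ F = let (x , x∈F) = uncons-subset (value F) (face-card F) in vertexIn F x∈F , x∈F

  corner₂ : ∀ {F a} → a ∈ᵥ F → ∃ λ b → b ∈ᵥ F × a ≢ b
  corner₂ {F} {a} a∈F with uncons-subset (value F - value a) (remove-card (value F) a∈F (face-card F))
  ... | y , y∈ = let (y∈F , y≢a) = remove-∈ y∈ in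
    vertexIn F y∈F , y∈F , y≢a ∘ sym ∘ cong value

  corner₃ : ∀ {F a b} → a ∈ᵥ F → b ∈ᵥ F → a ≢ b → ∃ λ c → Corners F a b c
  corner₃ {F} {a} {b} a∈F b∈F a≢b
    with remove-card (value F - value a) (Subset.x∈p∧x≢y⇒x∈p-y b∈F (a≢b ∘ sym ∘ value-injective))
                     (remove-card (value F) a∈F (face-card F))
  ... | rest with uncons-subset (value F - value a - value b) rest
  ... | z , z∈ with remove-∈ z∈
  ... | z∈F-a , z≢b with remove-∈ z∈F-a
  ... | z∈F , z≢a = vertexIn F z∈F ,
    corners a∈F b∈F z∈F a≢b (z≢a ∘ sym ∘ cong value) (z≢b ∘ sym ∘ cong value) complete
    where
    complete : ∀ {v} → v ∈ᵥ F → v ≡ a ⊎ v ≡ b ⊎ v ≡ vertexIn F z∈F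
    complete {v} v∈F with v ≟ᵥ a | v ≟ᵥ b | value v Fin.≟ z
    ... | yes v≡a | _       | _       = inj₁ v≡a
    ... | _       | yes v≡b | _       = inj₂ (inj₁ v≡b)
    ... | _       | _       | yes v≡z = inj₂ (inj₂ (value-injective v≡z))
    ... | no v≢a  | no v≢b  | no v≢z = contradiction
      (Subset.x∈p∧x≢y⇒x∈p-y (Subset.x∈p∧x≢y⇒x∈p-y (Subset.x∈p∧x≢y⇒x∈p-y v∈F
        (v≢a ∘ value-injective)) (v≢b ∘ value-injective)) v≢z)
      (card-zero (value F - value a - value b - z) (remove-card (value F - value a - value b) z∈ rest))

  corner₁₂₃ : ∀ F → ∃ λ a → ∃₂ λ b c → Corners F a b c
  corner₁₂₃ F = let (a , a∈F) = corner₁ F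
                    (b , b∈F , a≢b) = corner₂ {F} a∈F
                    (c , abc) = corner₃ {F} a∈F b∈F a≢b
                in a , b , c , abc

  three-corners : ∀ {F a b c} → a ∈ᵥ F → b ∈ᵥ F → c ∈ᵥ F → a ≢ b → a ≢ c → b ≢ c → Corners F a b c
  three-corners {F} {a} {b} {c} a∈F b∈F c∈F a≢b a≢c b≢c with corner₃ {F} a∈F b∈F a≢b
  ... | d , abd with Corners.complete abd c∈F
  ... | inj₁ c≡a        = contradiction (sym c≡a) a≢c
  ... | inj₂ (inj₁ c≡b) = contradiction (sym c≡b) b≢c
  ... | inj₂ (inj₂ refl) = abd

  corners⊆ : ∀ {F G a b c} → Corners F a b c → a ∈ᵥ G → b ∈ᵥ G → c ∈ᵥ G → F ≡ G
  corners⊆ {F} {G} {a} {b} {c} abc a∈G b∈G c∈G = face-ext {F} {G} λ v v∈F → case v (Corners.complete abc {v} v∈F)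
    where
    case : ∀ v → v ≡ a ⊎ v ≡ b ⊎ v ≡ c → v ∈ᵥ G
    case _ (inj₁ refl)        = a∈G
    case _ (inj₂ (inj₁ refl)) = b∈G
    case _ (inj₂ (inj₂ refl)) = c∈G

  infix 4 _~_
  _~_ : Rel Face 0ℓ
  _~_ = Adjacent X

  ~-sym : Symmetric _~_
  ~-sym = Graph.~-sym (faceGraph X)

  card2⇒two : ∀ (F : Face) {t} → t ⊆ value F → ∣ t ∣ ≡ 2 →
              ∃₂ λ (v w : Vertex) → v ≢ w × value v ∈ t × value w ∈ t
  card2⇒two F {t} t⊆F ∣t∣≡2 =
    let (x , x∈t)  = uncons-subset t ∣t∣≡2
        (y , y∈-)  = uncons-subset (t - x) (remove-card t x∈t ∣t∣≡2)
        (y∈t , y≢x) = remove-∈ y∈-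
    in vertexIn F (t⊆F x∈t) , vertexIn F (t⊆F y∈t) , y≢x ∘ sym ∘ cong value , x∈t , y∈t

  -- Built as `F` without its third corner, so that downward closure makes it a simplex. The last
  -- component frees it from the choice of `F`.
  edgeOf : ∀ {F v w} → v ∈ᵥ F → w ∈ᵥ F → v ≢ w →
           ∃ λ (e : Edge) → e ⊆ₑ F × value v ∈ value e × value w ∈ value e ×
             (∀ {G} → v ∈ᵥ G → w ∈ᵥ G → e ⊆ₑ G)
  edgeOf {F} {v} {w} v∈F w∈F v≢w with corner₃ {F} v∈F w∈F v≢w
  ... | q , vwq = subEdge F -q⊆F (remove-card (value F) c∈F (face-card F)) , -q⊆F ,
      Subset.x∈p∧x≢y⇒x∈p-y v∈F (a≢c ∘ value-injective) ,
      Subset.x∈p∧x≢y⇒x∈p-y w∈F (b≢c ∘ value-injective) ,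
      λ {G} v∈G w∈G → e⊆G {G} v∈G w∈G
    where
    open Corners vwq
    -q⊆F : value F - value q ⊆ value F
    -q⊆F = proj₁ ∘ remove-∈
    e⊆G : ∀ {G} → v ∈ᵥ G → w ∈ᵥ G → value F - value q ⊆ value G
    e⊆G v∈G w∈G x∈ with remove-∈ x∈
    ... | x∈F , x≢q with complete {vertexIn F x∈F} x∈F
    ... | inj₁ refl        = v∈G
    ... | inj₂ (inj₁ refl) = w∈G
    ... | inj₂ (inj₂ refl) = contradiction refl x≢q

  ~-intro : ∀ {F G v w} → F ≢ G → v ≢ w → v ∈ᵥ F → w ∈ᵥ F → v ∈ᵥ G → w ∈ᵥ G → F ~ G
  ~-intro {F} {G} F≢G v≢w v∈F w∈F v∈G w∈G =
    let (e , e⊆F , _ , _ , e⊆) = edgeOf {F} v∈F w∈F v≢w in F≢G , e , e⊆F , e⊆ {G} v∈G w∈G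

  ~-common : ∀ {F G} → F ~ G → ∃₂ λ v w → v ≢ w × v ∈ᵥ F × w ∈ᵥ F × v ∈ᵥ G × w ∈ᵥ G
  ~-common {F} {G} (F≢G , e , e⊆F , e⊆G) =
    let (v , w , v≢w , v∈e , w∈e) = card2⇒two F e⊆F (edge-card e)
    in v , w , v≢w , e⊆F v∈e , e⊆F w∈e , e⊆G v∈e , e⊆G w∈e

  -- A pigeonhole on `edge-in-two-faces`: `G` and `K` are both the face other than `F` on the edge
  -- `vw`.
  two-faces : ∀ {F G K v w} → v ≢ w → v ∈ᵥ F → w ∈ᵥ F → v ∈ᵥ G → w ∈ᵥ G → v ∈ᵥ K → w ∈ᵥ K →
              F ≢ G → F ≢ K → G ≡ K
  two-faces {F} {G} {K} v≢w v∈F w∈F v∈G w∈G v∈K w∈K F≢G F≢K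
    with edgeOf {F} v∈F w∈F v≢w
  ... | e , e⊆F , _ , _ , e⊆ with edge-in-two-faces e
  ... | A , B , _ , _ , _ , only
    with only F e⊆F | only G (e⊆ {G} v∈G w∈G) | only K (e⊆ {K} v∈K w∈K)
  ... | inj₁ refl | inj₁ refl | _         = contradiction refl F≢G
  ... | inj₁ refl | inj₂ refl | inj₁ refl = contradiction refl F≢K
  ... | inj₁ refl | inj₂ refl | inj₂ refl = refl
  ... | inj₂ refl | inj₂ refl | _         = contradiction refl F≢G
  ... | inj₂ refl | inj₁ refl | inj₂ refl = contradiction refl F≢K
  ... | inj₂ refl | inj₁ refl | inj₁ refl = refl

  opposite : ∀ {F v w} → v ≢ w → v ∈ᵥ F → w ∈ᵥ F → ∃ λ G → F ≢ G × v ∈ᵥ G × w ∈ᵥ G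
  opposite {F} v≢w v∈F w∈F with edgeOf {F} v∈F w∈F v≢w
  ... | e , e⊆F , v∈e , w∈e , _ with edge-in-two-faces e
  ... | A , B , e⊆A , e⊆B , A≢B , only with only F e⊆F
  ... | inj₁ refl = B , A≢B , e⊆B v∈e , e⊆B w∈e
  ... | inj₂ refl = A , A≢B ∘ sym , e⊆A v∈e , e⊆A w∈e

  ~-third : ∀ {F G v} → F ~ G → v ∈ᵥ F → v ∈ᵥ G → ∃ λ w → v ≢ w × w ∈ᵥ F × w ∈ᵥ G
  ~-third {F} {G} {v} F~G v∈F v∈G with ~-common {F} {G} F~G
  ... | x , y , x≢y , x∈F , y∈F , x∈G , y∈G with v ≟ᵥ x
  ... | yes refl = y , x≢y , y∈F , y∈G
  ... | no  v≢x  = x , v≢x , x∈F , x∈G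

  ~-at-most-two : ∀ {F G v w x} → F ≢ G → v ≢ w → v ∈ᵥ F → w ∈ᵥ F → v ∈ᵥ G → w ∈ᵥ G →
                  x ∈ᵥ F → x ∈ᵥ G → x ≡ v ⊎ x ≡ w
  ~-at-most-two {F} {G} {v} {w} {x} F≢G v≢w v∈F w∈F v∈G w∈G x∈F x∈G with x ≟ᵥ v | x ≟ᵥ w
  ... | yes x≡v | _       = inj₁ x≡v
  ... | no  _   | yes x≡w = inj₂ x≡w
  ... | no  x≢v | no x≢w  = contradiction
    (corners⊆ {F} {G} (three-corners {F} v∈F w∈F x∈F v≢w (x≢v ∘ sym) (x≢w ∘ sym)) v∈G w∈G x∈G) F≢G

  -- Umbrellas are defined through intersections of size 2, the face graph through shared edges;
  -- this and its converse reconcile the two.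
  ∩-card⇒~ : ∀ {F G : Face} → ∣ value F ∩ value G ∣ ≡ 2 → F ~ G
  ∩-card⇒~ {F} {G} eq = F≢G , subEdge F (Subset.p∩q⊆p _ _) eq , Subset.p∩q⊆p _ _ , Subset.p∩q⊆q _ _
    where
    F≢G : F ≢ G
    F≢G refl with () ← trans (sym (face-card F)) (trans (cong ∣_∣ (sym (Subset.∩-idem (value F)))) eq)

  ~⇒∩-card : ∀ {F G} → F ~ G → ∣ value F ∩ value G ∣ ≡ 2
  ~⇒∩-card {F} {G} F~G with ~-common {F} {G} F~G
  ... | v , w , v≢w , v∈F , w∈F , v∈G , w∈G with corner₃ {F} v∈F w∈F v≢w
  ... | q , vwq = trans (cong ∣_∣ (Subset.⊆-antisym ⊆₁ ⊆₂)) (remove-card (value F) c∈F (face-card F))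
    where
    open Corners vwq
    ⊆₁ : value F ∩ value G ⊆ value F - value q
    ⊆₁ x∈ with Subset.x∈p∩q⁻ (value F) (value G) x∈
    ... | x∈F , x∈G = Subset.x∈p∧x≢y⇒x∈p-y x∈F λ { refl →
      proj₁ F~G (corners⊆ {F} {G} vwq v∈G w∈G x∈G) }
    ⊆₂ : value F - value q ⊆ value F ∩ value G
    ⊆₂ x∈ with remove-∈ x∈
    ... | x∈F , x≢q with complete {vertexIn F x∈F} x∈F
    ... | inj₁ refl        = Subset.x∈p∩q⁺ (v∈F , v∈G)
    ... | inj₂ (inj₁ refl) = Subset.x∈p∩q⁺ (w∈F , w∈G)
    ... | inj₂ (inj₂ refl) = contradiction refl x≢q

  -- A face has three neighbours in the face graph but only two around `v`, which brings the lemmas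
  -- on `AtMostTwoNeighbours` to bear on umbrellas.
  record AdjacentAt (v : Vertex) (F G : Face) : Set where
    constructor adjacentAt
    field
      adjacent : F ~ G
      ∈ˡ       : v ∈ᵥ F
      ∈ʳ       : v ∈ᵥ G

  AdjacentAt-sym : ∀ {v} → Symmetric (AdjacentAt v)
  AdjacentAt-sym {x = F} {G} (adjacentAt F~G v∈F v∈G) = adjacentAt (~-sym {F} {G} F~G) v∈G v∈F

  -- The edges that `F` shares with `C` and `D` are its two sides at `v`; the edge shared with `G`
  -- is one of them, and only one other face lies across it.
  AdjacentAt-degree : ∀ {v} → AtMostTwoNeighbours (AdjacentAt v)
  AdjacentAt-degree {v} {F} {C} {D} {G} (adjacentAt F~C v∈F v∈C) (adjacentAt F~D _ v∈D) C≢D (adjacentAt F~G _ v∈G)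
    with ~-third {F} {C} {v} F~C v∈F v∈C | ~-third {F} {D} {v} F~D v∈F v∈D | ~-third {F} {G} {v} F~G v∈F v∈G
  ... | p , v≢p , p∈F , p∈C | q , v≢q , q∈F , q∈D | r , v≢r , r∈F , r∈G
    with Corners.complete (three-corners {F} v∈F p∈F q∈F v≢p v≢q p≢q) {r} r∈F
    where
    p≢q : p ≢ q
    p≢q refl = C≢D (two-faces {F} {C} {D} v≢p v∈F p∈F v∈C p∈C v∈D q∈D (proj₁ F~C) (proj₁ F~D))
  ... | inj₁ r≡v         = contradiction (sym r≡v) v≢r
  ... | inj₂ (inj₁ refl) = inj₁ (two-faces {F} v≢p v∈F p∈F v∈G r∈G v∈C p∈C (proj₁ F~G) (proj₁ F~C))
  ... | inj₂ (inj₂ refl) = inj₂ (two-faces {F} v≢q v∈F q∈F v∈G r∈G v∈D q∈D (proj₁ F~G) (proj₁ F~D))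

  -- The working form of `IsUmbrella`, related to it by `umbrella⁺` and `umbrella⁻`: consecutive
  -- faces are linked by `AdjacentAt v`, so that the degree bound applies.
  record Umbrella (v : Vertex) (C : List Face) : Set where
    field
      unique : Unique C
      faces∋ : ∀ {F} → F ∈ₗ C → v ∈ᵥ F
      ∋faces : ∀ {F} → v ∈ᵥ F → F ∈ₗ C
      cyclic : Cyclic (AdjacentAt v) C

  umbrella⁺ : ∀ {v C} → IsUmbrella v C → Umbrella v C
  umbrella⁺ {v} {C} (C! , F∈⇔ , C∼) = record
    { unique = C!
    ; faces∋ = Equivalence.to (F∈⇔ _)
    ; ∋faces = Equivalence.from (F∈⇔ _)
    ; cyclic = Cyclic-map-All (λ {F} {G} v∈F v∈G eq → adjacentAt (∩-card⇒~ {F} {G} eq) v∈F v∈G)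
                 {C} (All.tabulate (Equivalence.to (F∈⇔ _))) C∼
    }

  umbrella⁻ : ∀ {v C} → Umbrella v C → IsUmbrella v C
  umbrella⁻ {v} {C} U = unique , (λ F → mk⇔ faces∋ ∋faces) ,
      Cyclic-map-All {P = v ∈ᵥ_} (λ {F} {G} _ _ F∼G → ~⇒∩-card {F} {G} (AdjacentAt.adjacent F∼G)) {C} (All.tabulate faces∋) cyclic
    where open Umbrella U

  umbrella-≈ᶜ : ∀ {v C D} → C ≈ᶜ D → Umbrella v C → Umbrella v D
  umbrella-≈ᶜ {C = C} {D} C≈D U = record
    { unique = ≈ᶜ-Unique C≈D unique
    ; faces∋ = faces∋ ∘ ≈ᶜ-∈⁻ C≈D
    ; ∋faces = ≈ᶜ-∈ C≈D ∘ ∋faces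
    ; cyclic = ≈ᶜ-Cyclic AdjacentAt-sym C≈D cyclic
    }
    where open Umbrella U

  -- A one-face umbrella would make a face adjacent to itself. In one with faces `F` and `G`, the
  -- faces across both sides of `F` at `v` could only be `G`, which would then have all corners of
  -- `F`.
  umbrella-length : ∀ {v C} → Umbrella v C → 3 ≤ length C
  umbrella-length {C = []} U with () ← Umbrella.cyclic U
  umbrella-length {C = F ∷ []} U with adjacentAt (F≢F , _) _ _ ∷ _ ← Umbrella.cyclic U = contradiction refl F≢F
  umbrella-length {v} {F ∷ G ∷ []} U with faces∋ (here refl)
    where open Umbrella U
  ... | v∈F with corner₂ {F} {v} v∈F
  ... | p , p∈F , v≢p with corner₃ {F} v∈F p∈F v≢p
  ... | q , vpq with opposite {F} v≢p v∈F p∈F | opposite {F} (Corners.a≢c vpq) v∈F (Corners.c∈F vpq)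
  ... | A , F≢A , v∈A , p∈A | B , F≢B , v∈B , q∈B with Umbrella.∋faces U {A} v∈A | Umbrella.∋faces U {B} v∈B
  ... | here refl         | _                 = contradiction refl F≢A
  ... | _                 | here refl         = contradiction refl F≢B
  ... | there (here refl) | there (here refl) = contradiction (corners⊆ {F} {G} vpq v∈A p∈A q∈B) F≢A
  umbrella-length {C = _ ∷ _ ∷ _ ∷ _} U = s≤s (s≤s (s≤s z≤n))

  umbrella-arc : ∀ {v C F G} → Umbrella v C → AdjacentAt v F G → ArcOf (faceGraph X) (F , G) C
  umbrella-arc {F = F} {G} U F∼G@(adjacentAt _ v∈F _) =
    startAt AdjacentAt-degree AdjacentAt-sym (umbrella-length U) unique cyclic (∋faces {F} v∈F) F∼G
    where open Umbrella U

  umbrella-arc⁻ : ∀ {v C F G} → Umbrella v C → ArcOf (faceGraph X) (F , G) C → AdjacentAt v F G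
  umbrella-arc⁻ U (zs , C≈) with F∼G ∷ _ ← Umbrella.cyclic (umbrella-≈ᶜ C≈ U) = F∼G

  -- Once turned to begin with the first two faces of `D`, the cycle `C` has no freedom left.
  umbrella-unique : ∀ {v C D} → Umbrella v C → Umbrella v D → C ≈ᶜ D
  umbrella-unique {D = []} U V with () ← Umbrella.cyclic V
  umbrella-unique {D = _ ∷ []} U V with s≤s () ← umbrella-length V
  umbrella-unique {v} {C} {D = F ∷ G ∷ zs} U V with F∼G ∷ _ ← Umbrella.cyclic V
    with umbrella-arc U F∼G
  ... | zs′ , C≈ with umbrella-≈ᶜ C≈ U
  ... | U′ = subst (λ ws → C ≈ᶜ (F ∷ G ∷ ws))
    (cycle-unique AdjacentAt-degree AdjacentAt-sym
      (umbrella-length U′) (Umbrella.unique U′) (Umbrella.cyclic U′)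
      (umbrella-length V) (Umbrella.unique V) (Umbrella.cyclic V)) C≈

-- Umbrellas as a vertex-faithful cycle double cover

module VertexCycles {p} (X : SimplicialSurface p) where
  open SimplicialSurface X
  open Geometry X public
  open Graph (faceGraph X) using (_≟ₙ_; IsArc; _≈ₐ_)

  faceAt : ∀ v → ∃ λ F → v ∈ᵥ F
  faceAt v with umbrella v
  ... | []    , _ , _ , ()
  ... | F ∷ _ , _ , F∈⇔ , _ = F , Equivalence.to (F∈⇔ F) (here refl)

  -- If `w` differed from `v`, it would be a second corner of a face `F` at `v`. The face across the
  -- side joining `v` to the third corner contains `v`, hence `w`, hence all corners of `F`.
  vertex-determined : ∀ {v w} → (∀ F → v ∈ᵥ F → w ∈ᵥ F) → v ≡ w
  vertex-determined {v} {w} v⊆w with v ≟ᵥ w | faceAt v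
  ... | yes v≡w | _       = v≡w
  ... | no  v≢w | F , v∈F with corner₃ {F} {v} {w} v∈F (v⊆w F v∈F) v≢w
  ... | q , vwq with opposite {F} {v} {q} (Corners.a≢c vwq) v∈F (Corners.c∈F vwq)
  ... | G , F≢G , v∈G , q∈G = contradiction (corners⊆ {F} {G} vwq v∈G (v⊆w G v∈G) q∈G) F≢G

  umbrellaAt : ∀ v → ∃ (Umbrella v)
  umbrellaAt v = let (C , U) = umbrella v in C , umbrella⁺ U

  umbrella-vertex : ∀ {v w C} → Umbrella v C → Umbrella w C → v ≡ w
  umbrella-vertex {v} {w} U V = vertex-determined {v} {w} λ F v∈F →
    Umbrella.faces∋ V (Umbrella.∋faces U {F} v∈F)

  umbrella-isCycle : ∀ {v C} → Umbrella v C → IsCycle (faceGraph X) C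
  umbrella-isCycle {v} {C} U = umbrella-length U , unique ,
      Cyclic-map-All {P = v ∈ᵥ_} (λ _ _ → AdjacentAt.adjacent) {C} (All.tabulate faces∋) cyclic
    where open Umbrella U

  umbrella-chordless : ∀ {v C} → Umbrella v C → Chordless (faceGraph X) C
  umbrella-chordless U F∈C G∈C F~G = umbrella-arc U (adjacentAt F~G (faces∋ F∈C) (faces∋ G∈C))
    where open Umbrella U

  -- Both pairs consist of the two faces on the one edge spanned by `v` and `w`.
  ∋-common-edge : ∀ {v w} → v ≢ w → ∀ {F G K L} → AdjacentAt v F G → AdjacentAt w F G →
                  AdjacentAt v K L → AdjacentAt w K L → (F , G) ≈ₐ (K , L)
  ∋-common-edge {v} {w} v≢w {F} {G} {K} {L}
    (adjacentAt (F≢G , _) v∈F v∈G) (adjacentAt _ w∈F w∈G)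
    (adjacentAt (K≢L , _) v∈K v∈L) (adjacentAt _ w∈K w∈L) with F ≟ₙ K
  ... | yes refl = inj₁ (refl , two-faces {F} {G} {L} {v} {w} v≢w v∈F w∈F v∈G w∈G v∈L w∈L F≢G K≢L)
  ... | no  F≢K with two-faces {F} {G} {K} {v} {w} v≢w v∈F w∈F v∈G w∈G v∈K w∈K F≢G F≢K
  ... | refl = inj₂ (two-faces {G} {F} {L} {v} {w} v≢w v∈G w∈G v∈F w∈F v∈L w∈L (F≢G ∘ sym) K≢L , refl)

  module _ {𝒞 : Pred (List Face) 0ℓ} (𝒞≐VD : 𝒞 ≐ VertexDefining) where

    private
      umbrellaOf : ∀ {C} → 𝒞 C → ∃ λ v → Umbrella v C
      umbrellaOf c = let (v , U) = proj₁ 𝒞≐VD c in v , umbrella⁺ U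

    -- An arc lies on the umbrellas of the two ends of the edge shared by its faces, and on no
    -- others. Working with any `𝒞 ≐ VertexDefining` makes this applicable to a cover given by
    -- orbits.
    vertexDefining-isCycleDoubleCover : IsCycleDoubleCover (faceGraph X) 𝒞
    vertexDefining-isCycleDoubleCover =
      (λ c → umbrella-isCycle (proj₂ (umbrellaOf c))) , double
      where
      double : ∀ e → IsArc e → ExactlyTwo _≈ᶜ_ (λ C → 𝒞 C × ArcOf (faceGraph X) e C)
      double (F , G) F~G with ~-common {F} {G} F~G
      ... | v , w , v≢w , v∈F , w∈F , v∈G , w∈G =
        proj₁ Uᵥ , proj₁ U𝓌 ,
        (proj₂ 𝒞≐VD (v , umbrella⁻ (proj₂ Uᵥ)) , umbrella-arc (proj₂ Uᵥ) (adjacentAt F~G v∈F v∈G)) ,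
        (proj₂ 𝒞≐VD (w , umbrella⁻ (proj₂ U𝓌)) , umbrella-arc (proj₂ U𝓌) (adjacentAt F~G w∈F w∈G)) ,
        (λ C≈D → v≢w (umbrella-vertex {v} {w} (umbrella-≈ᶜ C≈D (proj₂ Uᵥ)) (proj₂ U𝓌))) ,
        only
        where
        Uᵥ = umbrellaAt v
        U𝓌 = umbrellaAt w
        only : ∀ C → 𝒞 C × ArcOf (faceGraph X) (F , G) C → (C ≈ᶜ proj₁ Uᵥ) ⊎ (C ≈ᶜ proj₁ U𝓌)
        only C (c , arc) with umbrellaOf c
        ... | x , U with umbrella-arc⁻ U arc
        ... | adjacentAt _ x∈F x∈G
          with ~-at-most-two {F} {G} {v} {w} {x} (proj₁ F~G) v≢w v∈F w∈F v∈G w∈G x∈F x∈G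
        ... | inj₁ refl = inj₁ (umbrella-unique U (proj₂ Uᵥ))
        ... | inj₂ refl = inj₂ (umbrella-unique U (proj₂ U𝓌))

    -- Inequivalent cycles belong to distinct vertices, by `umbrella-unique`, and these have at most
    -- one edge in common.
    vertexDefining-isVertexFaithful : IsVertexFaithful (faceGraph X) 𝒞
    vertexDefining-isVertexFaithful =
      (λ c → umbrella-chordless (proj₂ (umbrellaOf c))) , λ c d C≉D e∈C e∈D f∈C f∈D →
        let (v , U) = umbrellaOf c
            (w , V) = umbrellaOf d
            v≢w = λ v≡w → C≉D (umbrella-unique U (subst (λ v → Umbrella v _) (sym v≡w) V))
        in ∋-common-edge {v} {w} v≢w (umbrella-arc⁻ U e∈C) (umbrella-arc⁻ V e∈D)
             (umbrella-arc⁻ U f∈C) (umbrella-arc⁻ V f∈D)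

-- Symmetries

module Automorphisms {p} (X : SimplicialSurface p) where
  open SimplicialSurface X
  open VertexCycles X public
  open Graph (faceGraph X) using (_≟ₙ_; order; enumeration)
  open GraphAut using (preserves) renaming (perm to permᵍ)
  open Subgroup (λAut X)

  infixr 8 _∙_
  _∙_ : Aut X → Vertex → Vertex
  π ∙ v = to (Aut.perm π) v

  ∙-injective : ∀ π {v w} → π ∙ v ≡ π ∙ w → v ≡ w
  ∙-injective π {v} {w} eq = trans (sym (strictlyInverseʳ (Aut.perm π) v))
    (trans (cong (from (Aut.perm π)) eq) (strictlyInverseʳ (Aut.perm π) w))

  _maps_to_ : Aut X → Face → Face → Set
  π maps F to G = IsImage X (Aut.perm π) F G

  maps-∈⁺ : ∀ π {F G v} → π maps F to G → v ∈ᵥ F → π ∙ v ∈ᵥ G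
  maps-∈⁺ π F↦G v∈F = Equivalence.from (F↦G _) (_ , v∈F , refl)

  maps-∈⁻ : ∀ π {F G v} → π maps F to G → π ∙ v ∈ᵥ G → v ∈ᵥ F
  maps-∈⁻ π {F} {G} {v} F↦G πv∈G with Equivalence.to (F↦G (π ∙ v)) πv∈G
  ... | w , w∈F , πw≡πv = subst (_∈ᵥ F) (∙-injective π πw≡πv) w∈F

  maps-preimage : ∀ π {F G w} → π maps F to G → w ∈ᵥ G → ∃ λ v → v ∈ᵥ F × π ∙ v ≡ w
  maps-preimage π {w = w} F↦G w∈G = Equivalence.to (F↦G w) w∈G

  maps-injective : ∀ π {F G K} → π maps F to K → π maps G to K → F ≡ G
  maps-injective π {F} {G} {K} F↦K G↦K = face-ext {F} {G} λ v v∈F →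
    maps-∈⁻ π {G} {K} {v} G↦K (maps-∈⁺ π {F} {K} {v} F↦K v∈F)

  card-Face : HasCard Face _≡_ order
  card-Face = card (to enumeration) (cong (to enumeration))
    (λ {F} {G} eq → trans (sym (strictlyInverseʳ enumeration F))
      (trans (cong (from enumeration) eq) (strictlyInverseʳ enumeration G)))
    λ i → from enumeration i , strictlyInverseˡ enumeration i

  -- An element of the image of `λ_X` together with a vertex automorphism inducing it, so that one
  -- value acts on vertices and on faces.
  Symmetry : Set
  Symmetry = ∃ Member

  infixr 8 _∙ᵛ_ _∙ᶠ_
  _∙ᵛ_ : Symmetry → Vertex → Vertex
  (_ , π , _) ∙ᵛ v = π ∙ v

  _∙ᶠ_ : Symmetry → Face → Face
  (ρ , _) ∙ᶠ F = ρ · F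

  abstract
    -- Different faces have different images, because the vertex permutation is injective;
    -- finiteness of the set of faces then gives surjectivity.
    induced : ∀ π → ∃ λ ρ → Induces X π ρ
    induced π = record
      { perm = mk↔ₛ′ πᶠ (proj₁ ∘ surjective) (proj₂ ∘ surjective)
                 λ F → πᶠ-injective (proj₂ (surjective (πᶠ F)))
      ; preserves = λ {F} {G} → mk⇔ (preserves⁺ {F} {G}) (preserves⁻ {F} {G})
      } , maps
      where
      πᶠ : Face → Face
      πᶠ F = proj₁ (Aut.faceToFaces π F)

      maps : ∀ F → π maps F to πᶠ F
      maps F = proj₂ (Aut.faceToFaces π F)

      πᶠ-injective : ∀ {F G} → πᶠ F ≡ πᶠ G → F ≡ G
      πᶠ-injective {F} {G} eq = maps-injective π {F} {G} {πᶠ G} (subst (π maps F to_) eq (maps F)) (maps G)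

      surjective : ∀ G → ∃ λ F → πᶠ F ≡ G
      surjective = injective⇒surjective card-Face πᶠ πᶠ-injective

      preserves⁺ : ∀ {F G} → F ~ G → πᶠ F ~ πᶠ G
      preserves⁺ {F} {G} F~G with ~-common {F} {G} F~G
      ... | v , w , v≢w , v∈F , w∈F , v∈G , w∈G =
        ~-intro {πᶠ F} {πᶠ G} {π ∙ v} {π ∙ w} (proj₁ F~G ∘ πᶠ-injective) (v≢w ∘ ∙-injective π)
          (maps-∈⁺ π {F} {πᶠ F} {v} (maps F) v∈F) (maps-∈⁺ π {F} {πᶠ F} {w} (maps F) w∈F)
          (maps-∈⁺ π {G} {πᶠ G} {v} (maps G) v∈G) (maps-∈⁺ π {G} {πᶠ G} {w} (maps G) w∈G)

      preserves⁻ : ∀ {F G} → πᶠ F ~ πᶠ G → F ~ G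
      preserves⁻ {F} {G} πF~πG with ~-common {πᶠ F} {πᶠ G} πF~πG
      ... | v , w , v≢w , v∈F , w∈F , v∈G , w∈G
        with maps-preimage π {F} {πᶠ F} {v} (maps F) v∈F | maps-preimage π {F} {πᶠ F} {w} (maps F) w∈F
      ... | x , x∈F , refl | y , y∈F , refl =
        ~-intro {F} {G} {x} {y} (proj₁ πF~πG ∘ cong πᶠ) (v≢w ∘ cong (π ∙_)) x∈F y∈F
          (maps-∈⁻ π {G} {πᶠ G} {x} (maps G) v∈G) (maps-∈⁻ π {G} {πᶠ G} {y} (maps G) w∈G)

    symmetry : ∀ π → ∃ λ (m : Symmetry) → ∀ v → m ∙ᵛ v ≡ π ∙ v
    symmetry π = let (ρ , ind) = induced π in (ρ , π , ind) , λ _ → refl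

    infixr 9 _⊙_
    _⊙_ : Symmetry → Symmetry → Symmetry
    (ρ , ρ∈H) ⊙ (σ , σ∈H) = ρ ∘ᵍ σ , ∘-closed {ρ} {σ} ρ∈H σ∈H

    ⊙-vertex : ∀ m n v → (m ⊙ n) ∙ᵛ v ≡ m ∙ᵛ n ∙ᵛ v
    ⊙-vertex m n v = refl

    ⊙-face : ∀ m n F → (m ⊙ n) ∙ᶠ F ≡ m ∙ᶠ n ∙ᶠ F
    ⊙-face m n F = refl

    _⁻¹ : Symmetry → Symmetry
    (ρ , ρ∈H) ⁻¹ = ρ ⁻¹ᵍ , ⁻¹-closed {ρ} ρ∈H

    ⁻¹-vertexˡ : ∀ m v → (m ⁻¹) ∙ᵛ m ∙ᵛ v ≡ v
    ⁻¹-vertexˡ (_ , π , _) v = strictlyInverseʳ (Aut.perm π) v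

    ⁻¹-vertexʳ : ∀ m v → m ∙ᵛ (m ⁻¹) ∙ᵛ v ≡ v
    ⁻¹-vertexʳ (_ , π , _) v = strictlyInverseˡ (Aut.perm π) v

    ⁻¹-faceˡ : ∀ m F → (m ⁻¹) ∙ᶠ m ∙ᶠ F ≡ F
    ⁻¹-faceˡ (ρ , _) F = strictlyInverseʳ (permᵍ ρ) F

    ⁻¹-faceʳ : ∀ m F → m ∙ᶠ (m ⁻¹) ∙ᶠ F ≡ F
    ⁻¹-faceʳ (ρ , _) F = strictlyInverseˡ (permᵍ ρ) F

    image-∈ : ∀ m {F v} → v ∈ᵥ F → m ∙ᵛ v ∈ᵥ m ∙ᶠ F
    image-∈ (ρ , π , ind) {F} {v} = maps-∈⁺ π {F} {ρ · F} {v} (ind F)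

    image-∈⁻ : ∀ m {F v} → m ∙ᵛ v ∈ᵥ m ∙ᶠ F → v ∈ᵥ F
    image-∈⁻ (ρ , π , ind) {F} {v} = maps-∈⁻ π {F} {ρ · F} {v} (ind F)

    image-~ : ∀ m {F G} → F ~ G → m ∙ᶠ F ~ m ∙ᶠ G
    image-~ (ρ , _) = Equivalence.to (preserves ρ)

  ∙ᵛ-injective : ∀ m {v w} → m ∙ᵛ v ≡ m ∙ᵛ w → v ≡ w
  ∙ᵛ-injective (_ , π , _) = ∙-injective π

  ∙ᶠ-injective : ∀ m {F G} → m ∙ᶠ F ≡ m ∙ᶠ G → F ≡ G
  ∙ᶠ-injective m {F} {G} eq = trans (sym (⁻¹-faceˡ m F)) (trans (cong ((m ⁻¹) ∙ᶠ_) eq) (⁻¹-faceˡ m G))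

  preimage-∈ : ∀ m {F v} → v ∈ᵥ m ∙ᶠ F → (m ⁻¹) ∙ᵛ v ∈ᵥ F
  preimage-∈ m {F} {v} v∈ = image-∈⁻ m {F} {(m ⁻¹) ∙ᵛ v} (subst (_∈ᵥ m ∙ᶠ F) (sym (⁻¹-vertexʳ m v)) v∈)

  vertex⇒face : ∀ m n → (∀ v → m ∙ᵛ v ≡ n ∙ᵛ v) → ∀ F → m ∙ᶠ F ≡ n ∙ᶠ F
  vertex⇒face m n m≈n F = face-ext {m ∙ᶠ F} {n ∙ᶠ F} λ v v∈mF →
    subst (_∈ᵥ n ∙ᶠ F) (trans (sym (m≈n _)) (⁻¹-vertexʳ m v))
      (image-∈ n {F} {(m ⁻¹) ∙ᵛ v} (preimage-∈ m {F} {v} v∈mF))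

  -- Injectivity of `λ_X`: a vertex is determined by the faces containing it.
  face⇒vertex : ∀ m n → (∀ F → m ∙ᶠ F ≡ n ∙ᶠ F) → ∀ v → m ∙ᵛ v ≡ n ∙ᵛ v
  face⇒vertex m n m≈n v = vertex-determined {m ∙ᵛ v} {n ∙ᵛ v} λ K mv∈K →
    let F    = (m ⁻¹) ∙ᶠ K
        mF≡K = ⁻¹-faceʳ m K
        v∈F  = image-∈⁻ m {F} {v} (subst (λ K → m ∙ᵛ v ∈ᵥ K) (sym mF≡K) mv∈K)
    in subst (λ K → n ∙ᵛ v ∈ᵥ K) (trans (sym (m≈n F)) mF≡K) (image-∈ n {F} {v} v∈F)

  stabiliser-symmetry : ∀ {F} → Stabiliser X F → ∃ λ (m : Symmetry) → m ∙ᶠ F ≡ F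
  stabiliser-symmetry {F} (π , F↦F) = let (m , m≈π) = symmetry π in
    m , face-ext {m ∙ᶠ F} {F} λ v v∈mF →
      subst (_∈ᵥ F) (trans (sym (m≈π _)) (⁻¹-vertexʳ m v))
        (maps-∈⁺ π {F} {F} {(m ⁻¹) ∙ᵛ v} F↦F (preimage-∈ m {F} {v} v∈mF))

  stabiliser-symmetry-vertex : ∀ {F} (s : Stabiliser X F) v → proj₁ (stabiliser-symmetry {F} s) ∙ᵛ v ≡ proj₁ s ∙ v
  stabiliser-symmetry-vertex (π , _) = proj₂ (symmetry π)

  stabiliser : ∀ m {F} → m ∙ᶠ F ≡ F → Stabiliser X F
  stabiliser (ρ , π , ind) {F} ρF≡F = π , subst (π maps F to_) ρF≡F (ind F)

  -- Fixing passes from `K` to an adjacent `L`: the image of `L` contains the two fixed common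
  -- corners and differs from `K`, the image of `K`, so it is `L`, and the third corner can only go
  -- to itself. Connectedness reaches every face.
  rigidᴬ : ∀ π (F : Face) → (∀ v → v ∈ᵥ F → π ∙ v ≡ v) → ∀ v → π ∙ v ≡ v
  rigidᴬ π F fixes v with faceAt v
  ... | G , v∈G = spread F (Graph.connected (faceGraph X) F G) fixes v v∈G
    where
    ρ : Face → Face
    ρ K = proj₁ (Aut.faceToFaces π K)
    Fixes : Face → Set
    Fixes K = ∀ v → v ∈ᵥ K → π ∙ v ≡ v
    ρ-fixes : ∀ K → Fixes K → π maps K to K
    ρ-fixes K fixes w = mk⇔ (λ w∈K → w , w∈K , fixes w w∈K)
      λ (x , x∈K , πx≡w) → subst (_∈ᵥ K) (trans (sym (fixes x x∈K)) πx≡w) x∈K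
    step : ∀ K L → K ~ L → Fixes K → Fixes L
    step K L K~L fixes u u∈L with ~-common {K} {L} K~L
    ... | v , w , v≢w , v∈K , w∈K , v∈L , w∈L with corner₃ {L} {v} {w} v∈L w∈L v≢w
    ... | q , vwq with Corners.complete vwq {u} u∈L
    ... | inj₁ refl = fixes v v∈K
    ... | inj₂ (inj₁ refl) = fixes w w∈K
    ... | inj₂ (inj₂ refl) with Corners.complete vwq {π ∙ q} πq∈L
      where
      in-ρL : ∀ {x} → x ∈ᵥ L → π ∙ x ∈ᵥ ρ L
      in-ρL {x} = maps-∈⁺ π {L} {ρ L} {x} (proj₂ (Aut.faceToFaces π L))
      K≢ρL : K ≢ ρ L
      K≢ρL K≡ρL = proj₁ K~L (maps-injective π {K} {L} {ρ L}
        (subst (π maps K to_) K≡ρL (ρ-fixes K fixes)) (proj₂ (Aut.faceToFaces π L)))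
      L≡ρL : L ≡ ρ L
      L≡ρL = two-faces {K} {L} {ρ L} {v} {w} v≢w v∈K w∈K v∈L w∈L
        (subst (_∈ᵥ ρ L) (fixes v v∈K) (in-ρL {v} v∈L)) (subst (_∈ᵥ ρ L) (fixes w w∈K) (in-ρL {w} w∈L))
        (proj₁ K~L) K≢ρL
      πq∈L : π ∙ q ∈ᵥ L
      πq∈L = subst (λ L → π ∙ q ∈ᵥ L) (sym L≡ρL) (in-ρL {q} u∈L)
    ... | inj₁ πq≡v = contradiction (∙-injective π (trans (fixes v v∈K) (sym πq≡v))) (Corners.a≢c vwq)
    ... | inj₂ (inj₁ πq≡w) = contradiction (∙-injective π (trans (fixes w w∈K) (sym πq≡w))) (Corners.b≢c vwq)
    ... | inj₂ (inj₂ πq≡q) = πq≡q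
    spread : ∀ K {L} → Star _~_ K L → Fixes K → Fixes L
    spread K ε fixes = fixes
    spread K (_◅_ {j = L} K~L L~*) fixes = spread L L~* (step K L K~L fixes)

  rigid : ∀ m F → (∀ v → v ∈ᵥ F → m ∙ᵛ v ≡ v) → ∀ v → m ∙ᵛ v ≡ v
  rigid (_ , π , _) = rigidᴬ π

  umbrella-map : ∀ m {v C} → Umbrella v C → Umbrella (m ∙ᵛ v) (map (m ∙ᶠ_) C)
  umbrella-map m {v} {C} U = record
    { unique = Unique.map⁺ (∙ᶠ-injective m) unique
    ; faces∋ = λ F∈ → let (K , K∈C , F≡mK) = ∈-map⁻ (m ∙ᶠ_) F∈ in
        subst (λ F → m ∙ᵛ v ∈ᵥ F) (sym F≡mK) (image-∈ m {K} {v} (faces∋ K∈C))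
    ; ∋faces = λ {F} mv∈F →
        let K    = (m ⁻¹) ∙ᶠ F
            mK≡F = ⁻¹-faceʳ m F
        in subst (_∈ₗ map (m ∙ᶠ_) C) mK≡F (∈-map⁺ (m ∙ᶠ_) (∋faces {K}
             (image-∈⁻ m {K} {v} (subst (λ F → m ∙ᵛ v ∈ᵥ F) (sym mK≡F) mv∈F))))
    ; cyclic = cyclic-map C cyclic
    }
    where
    open Umbrella U
    cyclic-map : ∀ C → Cyclic (AdjacentAt v) C → Cyclic (AdjacentAt (m ∙ᵛ v)) (map (m ∙ᶠ_) C)
    cyclic-map (F ∷ Fs) c = subst (Linked (AdjacentAt (m ∙ᵛ v)) ∘ (m ∙ᶠ F ∷_)) (map-++ (m ∙ᶠ_) Fs (F ∷ []))
      (Linked.map⁺ (Linked.map (λ {F} {G} (adjacentAt F~G v∈F v∈G) → adjacentAt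
        (image-~ m {F} {G} F~G) (image-∈ m {F} {v} v∈F) (image-∈ m {G} {v} v∈G)) c))

  FaceTransitiveᴴ : Set
  FaceTransitiveᴴ = ∀ F G → ∃ λ (m : Symmetry) → m ∙ᶠ F ≡ G

  infix 4 _≈ᴴ_ _≈ˢ_
  _≈ᴴ_ : Rel Symmetry 0ℓ
  m ≈ᴴ n = proj₁ m ≈ᵍ proj₁ n

  _≈ˢ_ : ∀ {F} → Rel (Stabiliser X F) 0ℓ
  s ≈ˢ t = _≈ᴬ_ X (proj₁ s) (proj₁ t)

  ≈ᴴ-equiv : IsEquivalence _≈ᴴ_
  ≈ᴴ-equiv = record { refl = λ _ → refl ; sym = λ e x → sym (e x) ; trans = λ e f x → trans (e x) (f x) }

  module _ (trans-H : FaceTransitiveᴴ) (F : Face) where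

    private
      t : Face → Symmetry
      t G = proj₁ (trans-H F G)

      coset : Symmetry → Stabiliser X F
      coset m = stabiliser ((t (m ∙ᶠ F) ⁻¹) ⊙ m) {F}
        (trans (⊙-face (t (m ∙ᶠ F) ⁻¹) m F)
          (trans (cong ((t (m ∙ᶠ F) ⁻¹) ∙ᶠ_) (sym (proj₂ (trans-H F (m ∙ᶠ F))))) (⁻¹-faceˡ (t (m ∙ᶠ F)) F)))

      coset-vertex : ∀ m v → t (m ∙ᶠ F) ∙ᵛ proj₁ (coset m) ∙ v ≡ m ∙ᵛ v
      coset-vertex m v = trans (cong (t (m ∙ᶠ F) ∙ᵛ_) (⊙-vertex (t (m ∙ᶠ F) ⁻¹) m v)) (⁻¹-vertexʳ (t (m ∙ᶠ F)) (m ∙ᵛ v))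

      coset-cong : ∀ m n → m ≈ᴴ n → ∀ v → proj₁ (coset m) ∙ v ≡ proj₁ (coset n) ∙ v
      coset-cong m n m≈n v = ∙ᵛ-injective (t (n ∙ᶠ F))
        (trans (cong (λ G → t G ∙ᵛ proj₁ (coset m) ∙ v) (sym (m≈n F)))
          (trans (coset-vertex m v) (trans (face⇒vertex m n m≈n v) (sym (coset-vertex n v)))))

      coset-injective : ∀ m n → m ∙ᶠ F ≡ n ∙ᶠ F → (∀ v → proj₁ (coset m) ∙ v ≡ proj₁ (coset n) ∙ v) → m ≈ᴴ n
      coset-injective m n mF≡nF eq = vertex⇒face m n λ v →
        trans (sym (coset-vertex m v)) (trans (cong₂ (λ G w → t G ∙ᵛ w) mF≡nF (eq v)) (coset-vertex n v))

      coset-surjective : ∀ G s → ∃ λ m → m ∙ᶠ F ≡ G × (∀ v → proj₁ (coset m) ∙ v ≡ proj₁ s ∙ v)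
      coset-surjective G s = g , gF≡G , λ v → ∙ᵛ-injective (t G)
          (trans (cong (λ K → t K ∙ᵛ proj₁ (coset g) ∙ v) (sym gF≡G))
            (trans (coset-vertex g v) (trans (⊙-vertex (t G) h v) (cong (t G ∙ᵛ_) (stabiliser-symmetry-vertex {F} s v)))))
        where
        h g : Symmetry
        h = proj₁ (stabiliser-symmetry {F} s)
        g = t G ⊙ h
        gF≡G : g ∙ᶠ F ≡ G
        gF≡G = trans (⊙-face (t G) h F) (trans (cong (t G ∙ᶠ_) (proj₂ (stabiliser-symmetry {F} s))) (proj₂ (trans-H F G)))

    -- With `t G` a symmetry taking `F` to `G`, sending `m` to the face `m ∙ᶠ F` and the stabiliser
    -- element `(t (m ∙ᶠ F) ⁻¹) ⊙ m` is a bijection onto all such pairs.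
    orbit-stabiliser : ∀ {s} → HasCard (Stabiliser X F) (_≈ˢ_ {F}) s → HasCard Symmetry _≈ᴴ_ (order * s)
    orbit-stabiliser h = card-via {_≈₁_ = _≈ᴴ_} {_≈₂_ = Pointwise _≡_ (_≈ˢ_ {F})} (λ m → m ∙ᶠ F , coset m)
      (λ {m} {n} m≈n → m≈n F , coset-cong m n m≈n)
      (λ {m} {n} (eq , eqs) → coset-injective m n eq eqs)
      (λ (G , s) → coset-surjective G s)
      (card-× {_≈₁_ = _≡_} {_≈₂_ = _≈ˢ_ {F}} refl (λ _ → refl) card-Face h)

  -- The stabiliser is a decidable part of a finite group. This supplies the unknown order that
  -- `orbit-stabiliser` then pins down.
  card-stabiliser : ∀ {n} → HasCard Symmetry _≈ᴴ_ n → ∀ F → ∃ λ s → HasCard (Stabiliser X F) (_≈ˢ_ {F}) s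
  card-stabiliser h F =
    let (k , hF) = card-subset ≈ᴴ-equiv h {P = λ m → m ∙ᶠ F ≡ F} (λ m → (m ∙ᶠ F) ≟ₙ F)
                     (λ m≈n mF≡F → trans (sym (m≈n F)) mF≡F)
    in k , card-via {_≈₁_ = _≈ˢ_ {F}} {_≈₂_ = λ m n → proj₁ m ≈ᴴ proj₁ n} (stabiliser-symmetry {F})
    (λ {s} {t} s≈t → vertex⇒face (g s) (g t) λ v → trans (g-vertex s v) (trans (s≈t v) (sym (g-vertex t v))))
    (λ {s} {t} gs≈gt v → trans (sym (g-vertex s v)) (trans (face⇒vertex (g s) (g t) gs≈gt v) (g-vertex t v)))
    (λ (m , mF≡F) → stabiliser m mF≡F ,
      vertex⇒face (g (stabiliser m mF≡F)) m (g-vertex (stabiliser m mF≡F)))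
    hF
    where
    g : Stabiliser X F → Symmetry
    g s = proj₁ (stabiliser-symmetry {F} s)
    g-vertex : ∀ s v → g s ∙ᵛ v ≡ proj₁ s ∙ v
    g-vertex = stabiliser-symmetry-vertex {F}

-- From a (2,2)-group to the vertex-face type

module _ {G : Graph} where
  open Graph G

  rotation₂ : GraphAut G → ℕ → Node → Node → List Node
  rotation₂ σ l x y = concatMap (λ i → (σ ^ suc i) ·ᶜ (x ∷ y ∷ [])) (upTo l)

  α-cases : ∀ σ l x y z → let C = α G σ l (x ∷ y ∷ z ∷ []) in
            C ≡ [] ⊎ C ≡ rotation₂ σ l x y
  α-cases σ l x y z = if-cases _
    where
    if-cases : ∀ {A : Set} (b : Bool) {s t : A} → (if b then s else t) ≡ t ⊎ (if b then s else t) ≡ s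
    if-cases true  = inj₂ refl
    if-cases false = inj₁ refl

  ArcOf-first : ∀ {C a b zs} → C ≡ a ∷ b ∷ zs → ArcOf G (a , b) C
  ArcOf-first {zs = zs} refl = zs , ≈ᶜ-refl

  ArcOf-second : ∀ {C a b c zs} → C ≡ a ∷ b ∷ c ∷ zs → ArcOf G (b , c) C
  ArcOf-second {a = a} {b} {c} {zs} refl = zs ++ a ∷ [] , a ∷ [] , b ∷ c ∷ zs , refl , inj₁ refl

  -- A length of at least 3 excludes the empty cycle and `l ≤ 1`; otherwise the list starts with
  -- `σ · x`, `σ · y`, `σ · σ · x`, as the powers are taken from exponent 1.
  α-arcs : ∀ σ l x y z → let C = α G σ l (x ∷ y ∷ z ∷ []) in
           3 ≤ length C → ArcOf G (σ · x , σ · y) C × ArcOf G (σ · y , σ · σ · x) C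
  α-arcs σ l x y z C≥3 = go l (α-cases σ l x y z) C≥3
    where
    go : ∀ {C} l → C ≡ [] ⊎ C ≡ rotation₂ σ l x y → 3 ≤ length C →
         ArcOf G (σ · x , σ · y) C × ArcOf G (σ · y , σ · σ · x) C
    go _             (inj₁ refl) ()
    go zero          (inj₂ refl) ()
    go (suc zero)    (inj₂ refl) (s≤s (s≤s ()))
    go (suc (suc l)) (inj₂ eq)   _ = ArcOf-first eq , ArcOf-second eq

module _ {G : Graph} (H : Subgroup G) where
  open Graph G
  open Subgroup H

  ArcOrbit-closed : ∀ {e f h} → Member h → ArcOrbit H e f → ArcOrbit H e (h ·ₐ f)
  ArcOrbit-closed {h = h} h∈H (g , g∈H , inj₁ (x , y)) =
    h ∘ᵍ g , ∘-closed {h} {g} h∈H g∈H , inj₁ (cong (h ·_) x , cong (h ·_) y)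
  ArcOrbit-closed {h = h} h∈H (g , g∈H , inj₂ (x , y)) =
    h ∘ᵍ g , ∘-closed {h} {g} h∈H g∈H , inj₂ (cong (h ·_) x , cong (h ·_) y)

  CycleOrbit-refl : ∀ C → CycleOrbit H C C
  CycleOrbit-refl C = idᵍ , id-closed , subst (C ≈ᶜ_) (sym (map-id C)) ≈ᶜ-refl

module Orbits {p} (X : SimplicialSurface p) where
  open SimplicialSurface X
  open Automorphisms X public
  open Subgroup (λAut X)

  vertexOrbit : ∀ {v w} (m : Symmetry) → m ∙ᵛ v ≡ w → SameVertexOrbit X v w
  vertexOrbit (_ , π , _) mv≡w = π , mv≡w

  orbit-symmetry : ∀ {v w} → SameVertexOrbit X v w → ∃ λ (m : Symmetry) → m ∙ᵛ v ≡ w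
  orbit-symmetry {v} (π , πv≡w) = let (m , m≈π) = symmetry π in m , trans (m≈π v) πv≡w

  orbit-sym : ∀ {v w} → SameVertexOrbit X v w → SameVertexOrbit X w v
  orbit-sym {v} {w} o = let (m , mv≡w) = orbit-symmetry o in
    vertexOrbit (m ⁻¹) (trans (cong ((m ⁻¹) ∙ᵛ_) (sym mv≡w)) (⁻¹-vertexˡ m v))

  orbit-trans : ∀ {u v w} → SameVertexOrbit X u v → SameVertexOrbit X v w → SameVertexOrbit X u w
  orbit-trans {u} o o′ =
    let (m , mu≡v) = orbit-symmetry o
        (n , nv≡w) = orbit-symmetry o′
    in vertexOrbit (n ⊙ m) (trans (⊙-vertex n m u) (trans (cong (n ∙ᵛ_) mu≡v) nv≡w))

  AdjacentAt-image : ∀ m {v F G} → AdjacentAt v F G → AdjacentAt (m ∙ᵛ v) (m ∙ᶠ F) (m ∙ᶠ G)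
  AdjacentAt-image m {v} {F} {G} (adjacentAt F~G v∈F v∈G) =
    adjacentAt (image-~ m {F} {G} F~G) (image-∈ m {F} {v} v∈F) (image-∈ m {G} {v} v∈G)

  cycleOrbit-umbrella : ∀ {v w C D} → Umbrella v C → Umbrella w D → CycleOrbit (λAut X) C D →
                        SameVertexOrbit X v w
  cycleOrbit-umbrella {v} {w} U V (h , h∈H , D≈hC) =
    vertexOrbit (h , h∈H) (umbrella-vertex (umbrella-map (h , h∈H) U) (umbrella-≈ᶜ D≈hC V))

module FromTwoTwoGroup {p} (X : SimplicialSurface p) (S : TwoTwoGroup (λAut X))
                       (cover≐ : TwoTwoGroup.cover S ≐ SimplicialSurface.VertexDefining X) where
  open SimplicialSurface X
  open Orbits X
  open TwoTwoGroup S
  open Graph (faceGraph X) using (order; enumeration)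
  open Subgroup (λAut X)

  private
    trans-H : FaceTransitiveᴴ
    trans-H F G = let (h , h∈H , hF≡G) = transitive F G in (h , h∈H) , hF≡G

    αC : List Face
    αC = α (faceGraph X) σ l (Fₘ ∷ F₁ ∷ F₂ ∷ [])

    u∈cover : cover u
    u∈cover = inj₁ (CycleOrbit-refl (λAut X) u)

    α∈cover : cover αC
    α∈cover = inj₂ (CycleOrbit-refl (λAut X) αC)

    v₀ w₀ : Vertex
    v₀ = proj₁ (proj₁ cover≐ u∈cover)
    w₀ = proj₁ (proj₁ cover≐ α∈cover)

    u-umbrella : Umbrella v₀ u
    u-umbrella = umbrella⁺ (proj₂ (proj₁ cover≐ u∈cover))

    α-umbrella : Umbrella w₀ αC
    α-umbrella = umbrella⁺ (proj₂ (proj₁ cover≐ α∈cover))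

    orbitOf : ∀ v → SameVertexOrbit X v₀ v ⊎ SameVertexOrbit X w₀ v
    orbitOf v = case (proj₂ cover≐ (v , umbrella⁻ (proj₂ (umbrellaAt v))))
      where
      case : cover (proj₁ (umbrellaAt v)) → SameVertexOrbit X v₀ v ⊎ SameVertexOrbit X w₀ v
      case (inj₁ o) = inj₁ (cycleOrbit-umbrella u-umbrella (proj₂ (umbrellaAt v)) o)
      case (inj₂ o) = inj₂ (cycleOrbit-umbrella α-umbrella (proj₂ (umbrellaAt v)) o)

    arcs : ArcOf (faceGraph X) (σ · Fₘ , σ · F₁) αC × ArcOf (faceGraph X) (σ · F₁ , σ · σ · Fₘ) αC
    arcs = α-arcs σ l Fₘ F₁ F₂ (umbrella-length α-umbrella)

    E₂-arc : E₂ (σ · Fₘ , σ · F₁)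
    E₂-arc = ArcOrbit-closed (λAut X) {e = e₂} {f = Fₘ , F₁} {h = σ} σ∈H FₘF₁∈E₂

    E₁-arc : E₁ (σ · F₁ , σ · σ · Fₘ)
    E₁-arc = subst (λ F → E₁ (σ · F₁ , σ · F)) (sym σFₘ≡F₂)
      (ArcOrbit-closed (λAut X) {e = e₁} {f = F₁ , F₂} {h = σ} σ∈H F₁F₂∈E₁)

    -- u is mono-coloured, whereas α carries arcs of both colours.
    distinct : ¬ SameVertexOrbit X w₀ v₀
    distinct o = clash u-monochrome
      where
      g : Symmetry
      g = proj₁ (orbit-symmetry o)
      moved : ∀ {F G} → ArcOf (faceGraph X) (F , G) αC → ArcOf (faceGraph X) (g ∙ᶠ F , g ∙ᶠ G) u
      moved {F} {G} arc = umbrella-arc u-umbrella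
        (subst (λ v → AdjacentAt v (g ∙ᶠ F) (g ∙ᶠ G)) (proj₂ (orbit-symmetry o))
          (AdjacentAt-image g (umbrella-arc⁻ α-umbrella arc)))
      closed : ∀ {e f} → ArcOrbit (λAut X) e f → ArcOrbit (λAut X) e (proj₁ g ·ₐ f)
      closed {e} {f} = ArcOrbit-closed (λAut X) {e = e} {f = f} {h = proj₁ g} (proj₂ g)
      clash : ¬ ((∀ e → ArcOf (faceGraph X) e u → E₁ e) ⊎ (∀ e → ArcOf (faceGraph X) e u → E₂ e))
      clash (inj₁ all-E₁) = disjoint _ (all-E₁ _ (moved (proj₁ arcs))) (closed {e₂} E₂-arc)
      clash (inj₂ all-E₂) = disjoint _ (closed {e₁} E₁-arc) (all-E₂ _ (moved (proj₂ arcs)))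

    side : ∀ {v} → SameVertexOrbit X v₀ v ⊎ SameVertexOrbit X w₀ v → Fin 2
    side (inj₁ _) = 0F
    side (inj₂ _) = sucᶠ 0F

    -- The proofs `s` and `t` are arbitrary, so the side does not depend on the one that `orbitOf`
    -- happens to give; a mixed case would put `v₀` and `w₀` into one orbit.
    side-cong : ∀ {v w} s t → SameVertexOrbit X v w → side {v} s ≡ side {w} t
    side-cong (inj₁ _) (inj₁ _) _ = refl
    side-cong (inj₂ _) (inj₂ _) _ = refl
    side-cong (inj₁ s) (inj₂ t) o = contradiction (orbit-trans t (orbit-sym (orbit-trans s o))) distinct
    side-cong (inj₂ s) (inj₁ t) o = contradiction (orbit-trans s (orbit-trans o (orbit-sym t))) distinct

    side-injective : ∀ {v w} s t → side {v} s ≡ side {w} t → SameVertexOrbit X v w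
    side-injective (inj₁ s) (inj₁ t) _ = orbit-trans (orbit-sym s) t
    side-injective (inj₂ s) (inj₂ t) _ = orbit-trans (orbit-sym s) t

    orbit-refl : ∀ v → SameVertexOrbit X v v
    orbit-refl v = proj₁ id-closed , refl

  faceTransitive : FaceTransitive X
  faceTransitive F G = let (h , (π , ind) , hF≡G) = transitive F G in
    π , subst (π maps F to_) hF≡G (ind F)

  vertexFaceType : HasVertexFaceType X 2 2
  vertexFaceType = card (λ v → side {v} (orbitOf v))
      (λ {v} {w} → side-cong {v} {w} (orbitOf v) (orbitOf w))
      (λ {v} {w} → side-injective {v} {w} (orbitOf v) (orbitOf w))
      (λ { 0F        → v₀ , side-cong {v₀} {v₀} (orbitOf v₀) (inj₁ (orbit-refl v₀)) (orbit-refl v₀)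
         ; (sucᶠ 0F) → w₀ , side-cong {w₀} {w₀} (orbitOf w₀) (inj₂ (orbit-refl w₀)) (orbit-refl w₀) }) ,
    -- The stabiliser order `s` solves `order * s ≡ order * 2`; the factor `order` cancels because
    -- `F₁` is a face.
    λ F → let (s , h) = card-stabiliser order-H F in
      subst (HasCard (Stabiliser X F) (_≈ˢ_ {F}))
        (cancel order F₁-index (trans (card-unique (λ _ → refl) (orbit-stabiliser trans-H F h) order-H) (ℕ.*-comm 2 order))) h
    where
    F₁-index : Fin order
    F₁-index = to enumeration F₁
    cancel : ∀ n → Fin n → ∀ {s t} → n * s ≡ n * t → s ≡ t
    cancel (suc n) _ {s} {t} eq = ℕ.*-cancelˡ-≡ s t (suc n) eq

-- α-cycles as walks

≈ᶜ-sym : {C D : List A} → C ≈ᶜ D → D ≈ᶜ C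
≈ᶜ-sym (xs , ys , refl , inj₁ refl) = ys , xs , refl , inj₁ refl
≈ᶜ-sym (xs , ys , refl , inj₂ refl) = reverse xs , reverse ys , reverse-++ ys xs ,
  inj₂ (trans (sym (reverse-involutive (xs ++ ys))) (cong reverse (reverse-++ xs ys)))

-- Recursive doubling, so that f (twice (suc i)) computes to f (2 + twice i).
twice : ℕ → ℕ
twice zero    = zero
twice (suc n) = suc (suc (twice n))

twice≡2* : ∀ n → twice n ≡ 2 * n
twice≡2* zero    = refl
twice≡2* (suc n) = cong suc (trans (cong suc (twice≡2* n)) (sym (ℕ.+-suc n (n + 0))))

twice-< : ∀ {m n} → m < n → twice m < twice n
twice-< {zero}  {suc n} _         = s≤s z≤n
twice-< {suc m} {suc n} (s≤s m<n) = s≤s (s≤s (twice-< m<n))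

parity : ∀ n → ∃ λ k → n ≡ twice k ⊎ n ≡ suc (twice k)
parity zero = zero , inj₁ refl
parity (suc n) with parity n
... | k , inj₁ eq = k , inj₂ (cong suc eq)
... | k , inj₂ eq = suc k , inj₁ (cong suc eq)

-- A general `h` in place of the `id` in `upTo` lets the induction shift the index while `f` moves
-- on by two.
concatMap-pairs : ∀ (g : ℕ → List A) (h : ℕ → ℕ) (f : ℕ → A) →
                  (∀ i → g (h i) ≡ f (twice i) ∷ f (suc (twice i)) ∷ []) →
                  ∀ n → concatMap g (applyUpTo h n) ≡ applyUpTo f (twice n)
concatMap-pairs g h f eq zero    = refl
concatMap-pairs g h f eq (suc n) = cong₂ _++_ (eq 0)
  (concatMap-pairs g (h ∘ suc) (λ i → f (2 + i)) (eq ∘ suc) n)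

deduplicate-Unique : (_≟_ : DecidableEquality A) → ∀ {xs} → Unique xs → deduplicate _≟_ xs ≡ xs
deduplicate-Unique _≟_ []        = refl
deduplicate-Unique _≟_ {x ∷ xs} (x∉ ∷ xs!) = cong (x ∷_)
  (trans (cong (filter _) (deduplicate-Unique _≟_ xs!)) (filter-all _ x∉))

-- The α-cycle lists the powers of `σ` from exponent 1, its set `Σ` from exponent 0; for a periodic
-- walk the two lists differ by a rotation by one pair.
applyUpTo-rotate₂ : ∀ (f : ℕ → A) n → f n ≡ f 0 → f (suc n) ≡ f 1 → 2 ≤ n →
                    applyUpTo f n ≈ᶜ applyUpTo (λ i → f (2 + i)) n
applyUpTo-rotate₂ f (suc (suc n)) fn fn+1 (s≤s (s≤s z≤n)) =
  f 0 ∷ f 1 ∷ [] , applyUpTo g n , refl , inj₁ (begin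
    applyUpTo g (2 + n)                ≡⟨ applyUpTo-∷ʳ g (suc n) ⟨
    applyUpTo g (1 + n) ∷ʳ g (1 + n)   ≡⟨ cong (_∷ʳ g (1 + n)) (applyUpTo-∷ʳ g n) ⟨
    applyUpTo g n ∷ʳ g n ∷ʳ g (1 + n)  ≡⟨ ++-assoc (applyUpTo g n) (g n ∷ []) (g (1 + n) ∷ []) ⟩
    applyUpTo g n ++ g n ∷ g (1 + n) ∷ [] ≡⟨ cong₂ (λ x y → applyUpTo g n ++ x ∷ y ∷ []) fn fn+1 ⟩
    applyUpTo g n ++ f 0 ∷ f 1 ∷ []    ∎)
  where
  open ≡-Reasoning
  g = λ i → f (2 + i)

module _ {G : Graph} where
  open Graph G

  α-Unique : ∀ σ l x y z → let Σσ = concatMap (λ i → (σ ^ i) ·ᶜ (x ∷ y ∷ [])) (upTo l) in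
             Unique Σσ → length Σσ ≡ 2 * l →
             α G σ l (x ∷ y ∷ z ∷ []) ≡ rotation₂ σ l x y
  α-Unique σ l x y z Σ! eq = if-true (trans (cong (_≡ᵇ 2 * l)
      (trans (cong length (deduplicate-Unique _≟ₙ_ Σ!)) eq)) (≡ᵇ-refl (2 * l)))
    where
    if-true : ∀ {A : Set} {b} {s t : A} → b ≡ true → (if b then s else t) ≡ s
    if-true refl = refl
    ≡ᵇ-refl : ∀ n → (n ≡ᵇ n) ≡ true
    ≡ᵇ-refl zero    = refl
    ≡ᵇ-refl (suc n) = ≡ᵇ-refl n

-- From the vertex-face type to a (2,2)-group

Fin2-dichotomy : {i j : Fin 2} → i ≢ j → ∀ k → k ≡ i ⊎ k ≡ j
Fin2-dichotomy {0F}      {0F}      i≢j _         = contradiction refl i≢j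
Fin2-dichotomy {sucᶠ 0F} {sucᶠ 0F} i≢j _         = contradiction refl i≢j
Fin2-dichotomy {0F}      {sucᶠ 0F} _   0F        = inj₁ refl
Fin2-dichotomy {0F}      {sucᶠ 0F} _   (sucᶠ 0F) = inj₂ refl
Fin2-dichotomy {sucᶠ 0F} {0F}      _   0F        = inj₂ refl
Fin2-dichotomy {sucᶠ 0F} {0F}      _   (sucᶠ 0F) = inj₁ refl

-- The face graph is cubic

module Cubicity {p} (X : SimplicialSurface p) where
  open SimplicialSurface X
  open Geometry X

  module _ {F a b c} (abc : Corners F a b c) where
    open Corners abc

    private
      -- Side i of F is the pair of corners other than the i-th one.
      OnSide : Fin 3 → Face → Set
      OnSide 0F               G = b ∈ᵥ G × c ∈ᵥ G
      OnSide (sucᶠ 0F)        G = c ∈ᵥ G × a ∈ᵥ G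
      OnSide (sucᶠ (sucᶠ 0F)) G = a ∈ᵥ G × b ∈ᵥ G

      side : ∀ {G} → F ~ G → ∃ λ i → OnSide i G
      side {G} F~G = case (~-common {F} {G} F~G)
        where
        case : (∃₂ λ v w → v ≢ w × v ∈ᵥ F × w ∈ᵥ F × v ∈ᵥ G × w ∈ᵥ G) → ∃ λ i → OnSide i G
        case (v , w , v≢w , v∈F , w∈F , v∈G , w∈G) with complete {v} v∈F | complete {w} w∈F
        ... | inj₁ refl        | inj₁ refl        = contradiction refl v≢w
        ... | inj₁ refl        | inj₂ (inj₁ refl) = sucᶠ (sucᶠ 0F) , v∈G , w∈G
        ... | inj₁ refl        | inj₂ (inj₂ refl) = sucᶠ 0F , w∈G , v∈G
        ... | inj₂ (inj₁ refl) | inj₁ refl        = sucᶠ (sucᶠ 0F) , w∈G , v∈G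
        ... | inj₂ (inj₁ refl) | inj₂ (inj₁ refl) = contradiction refl v≢w
        ... | inj₂ (inj₁ refl) | inj₂ (inj₂ refl) = 0F , v∈G , w∈G
        ... | inj₂ (inj₂ refl) | inj₁ refl        = sucᶠ 0F , v∈G , w∈G
        ... | inj₂ (inj₂ refl) | inj₂ (inj₁ refl) = 0F , w∈G , v∈G
        ... | inj₂ (inj₂ refl) | inj₂ (inj₂ refl) = contradiction refl v≢w

      side-unique : ∀ {G} i j → F ≢ G → OnSide i G → OnSide j G → i ≡ j
      side-unique {G} i j F≢G = go i j
        where
        ¬all : ∀ {A : Set} → a ∈ᵥ G → b ∈ᵥ G → c ∈ᵥ G → A
        ¬all a∈G b∈G c∈G = contradiction (corners⊆ {F} {G} abc a∈G b∈G c∈G) F≢G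
        go : ∀ i j → OnSide i G → OnSide j G → i ≡ j
        go 0F               0F               _         _         = refl
        go 0F               (sucᶠ 0F)        (b∈ , c∈) (_ , a∈)  = ¬all a∈ b∈ c∈
        go 0F               (sucᶠ (sucᶠ 0F)) (b∈ , c∈) (a∈ , _)  = ¬all a∈ b∈ c∈
        go (sucᶠ 0F)        0F               (c∈ , a∈) (b∈ , _)  = ¬all a∈ b∈ c∈
        go (sucᶠ 0F)        (sucᶠ 0F)        _         _         = refl
        go (sucᶠ 0F)        (sucᶠ (sucᶠ 0F)) (c∈ , a∈) (_ , b∈)  = ¬all a∈ b∈ c∈
        go (sucᶠ (sucᶠ 0F)) 0F               (a∈ , b∈) (_ , c∈)  = ¬all a∈ b∈ c∈
        go (sucᶠ (sucᶠ 0F)) (sucᶠ 0F)        (a∈ , b∈) (c∈ , _)  = ¬all a∈ b∈ c∈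
        go (sucᶠ (sucᶠ 0F)) (sucᶠ (sucᶠ 0F)) _         _         = refl

      side-face-unique : ∀ {G K} i → F ≢ G → F ≢ K → OnSide i G → OnSide i K → G ≡ K
      side-face-unique {G} {K} 0F F≢G F≢K (b∈G , c∈G) (b∈K , c∈K) =
        two-faces {F} {G} {K} {b} {c} b≢c b∈F c∈F b∈G c∈G b∈K c∈K F≢G F≢K
      side-face-unique {G} {K} (sucᶠ 0F) F≢G F≢K (c∈G , a∈G) (c∈K , a∈K) =
        two-faces {F} {G} {K} {a} {c} a≢c a∈F c∈F a∈G c∈G a∈K c∈K F≢G F≢K
      side-face-unique {G} {K} (sucᶠ (sucᶠ 0F)) F≢G F≢K (a∈G , b∈G) (a∈K , b∈K) =
        two-faces {F} {G} {K} {a} {b} a≢b a∈F b∈F a∈G b∈G a∈K b∈K F≢G F≢K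

      side-face : ∀ i → ∃ λ G → F ~ G × OnSide i G
      side-face 0F = let (G , F≢G , b∈G , c∈G) = opposite {F} {b} {c} b≢c b∈F c∈F in
        G , ~-intro {F} {G} {b} {c} F≢G b≢c b∈F c∈F b∈G c∈G , b∈G , c∈G
      side-face (sucᶠ 0F) = let (G , F≢G , a∈G , c∈G) = opposite {F} {a} {c} a≢c a∈F c∈F in
        G , ~-intro {F} {G} {a} {c} F≢G a≢c a∈F c∈F a∈G c∈G , c∈G , a∈G
      side-face (sucᶠ (sucᶠ 0F)) = let (G , F≢G , a∈G , b∈G) = opposite {F} {a} {b} a≢b a∈F b∈F in
        G , ~-intro {F} {G} {a} {b} F≢G a≢b a∈F b∈F a∈G b∈G , a∈G , b∈G

    -- Neighbours correspond to sides of `F`: `opposite` gives a face across each side, `two-faces`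
    -- only one, and a face on two sides would have all corners of `F`.
    card-neighbours : HasCard (∃ λ G → F ~ G) (λ s t → proj₁ s ≡ proj₁ t) 3
    card-neighbours = card (λ (G , F~G) → proj₁ (side {G} F~G))
      (λ {(G , F~G)} {(K , F~K)} eq → side-cong {G} {K} F~G F~K eq)
      (λ {(G , F~G)} {(K , F~K)} eq → side-face-unique {G} {K} (proj₁ (side {G} F~G)) (proj₁ F~G) (proj₁ F~K)
        (proj₂ (side {G} F~G)) (subst (λ i → OnSide i K) (sym eq) (proj₂ (side {K} F~K))))
      λ i → let (G , F~G , on) = side-face i in
        (G , F~G) , side-unique {G} _ i (proj₁ F~G) (proj₂ (side {G} F~G)) on
      where
      side-cong : ∀ {G K} (F~G : F ~ G) (F~K : F ~ K) → G ≡ K → proj₁ (side {G} F~G) ≡ proj₁ (side {K} F~K)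
      side-cong {G} F~G F~K refl = side-unique {G} _ _ (proj₁ F~G) (proj₂ (side {G} F~G)) (proj₂ (side {G} F~K))

  faceGraph-cubic : Graph.Cubic (faceGraph X)
  faceGraph-cubic F = let (_ , _ , _ , abc) = corner₁₂₃ F in card-neighbours {F} abc

-- Vertex colours and the involution of a face

module Colouring {p} (X : SimplicialSurface p) (ft : FaceTransitive X)
                 (cardV : HasCard (SimplicialSurface.Vertex X) (SameVertexOrbit X) 2) where
  open SimplicialSurface X
  open Orbits X public
  open Subgroup (λAut X)

  colour : Vertex → Fin 2
  colour = index cardV

  colour-image : ∀ m v → colour (m ∙ᵛ v) ≡ colour v
  colour-image m v = index-cong cardV (orbit-sym {v} (vertexOrbit m refl))

  abstract
    trans-H : FaceTransitiveᴴ
    trans-H F G =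
      let (π , F↦G) = ft F G
          (m , m≈π) = symmetry π
      in m , face-ext {m ∙ᶠ F} {G} λ v v∈mF →
        subst (_∈ᵥ G) (trans (sym (m≈π _)) (⁻¹-vertexʳ m v))
          (maps-∈⁺ π {F} {G} {(m ⁻¹) ∙ᵛ v} F↦G (preimage-∈ m {F} {v} v∈mF))

  corners-image : ∀ m {F a b c} → Corners F a b c → Corners (m ∙ᶠ F) (m ∙ᵛ a) (m ∙ᵛ b) (m ∙ᵛ c)
  corners-image m {F} {a} {b} {c} abc = three-corners {m ∙ᶠ F}
      (image-∈ m {F} {a} a∈F) (image-∈ m {F} {b} b∈F) (image-∈ m {F} {c} c∈F)
      (a≢b ∘ ∙ᵛ-injective m) (a≢c ∘ ∙ᵛ-injective m) (b≢c ∘ ∙ᵛ-injective m)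
    where open Corners abc

  record Flag : Set where
    field
      φ        : Symmetry
      F₀       : Face
      a₀ b₀ c₀ : Vertex
      corners₀ : Corners F₀ a₀ b₀ c₀
      φF₀≡F₀   : φ ∙ᶠ F₀ ≡ F₀
      φ-a₀     : φ ∙ᵛ a₀ ≡ b₀
      φ-b₀     : φ ∙ᵛ b₀ ≡ a₀
      φ-c₀     : φ ∙ᵛ c₀ ≡ c₀
      ι≢κ      : colour a₀ ≢ colour c₀

  module FlagConstruction (cardS : ∀ F → HasCard (Stabiliser X F) (_≈ˢ_ {F}) 2) where

    F₀ : Face
    F₀ = proj₁ (faceAt (element cardV 0F))

    -- Two inequivalent elements of the stabiliser cannot both be the identity, and by `rigid` one
    -- that is not moves a corner of `F₀`.
    moved-corner : ∃ λ (m : Symmetry) → m ∙ᶠ F₀ ≡ F₀ × ∃ λ v → v ∈ᵥ F₀ × v ≢ m ∙ᵛ v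
    moved-corner = go (moves s₀) (moves s₁)
      where
      s₀ s₁ : Stabiliser X F₀
      s₀ = element (cardS F₀) 0F
      s₁ = element (cardS F₀) (sucᶠ 0F)
      lift : Stabiliser X F₀ → Symmetry
      lift s = proj₁ (stabiliser-symmetry {F₀} s)
      Moves : Stabiliser X F₀ → Set
      Moves s = ∃ λ v → v ∈ᵥ F₀ × v ≢ lift s ∙ᵛ v
      moves : ∀ s → Moves s ⊎ (∀ v → lift s ∙ᵛ v ≡ v)
      moves s = let (a , b , c , abc) = corner₁₂₃ F₀ in
          case abc (a ≟ᵥ (lift s ∙ᵛ a)) (b ≟ᵥ (lift s ∙ᵛ b)) (c ≟ᵥ (lift s ∙ᵛ c))
        where
        case : ∀ {a b c} → Corners F₀ a b c → Dec (a ≡ lift s ∙ᵛ a) → Dec (b ≡ lift s ∙ᵛ b) → Dec (c ≡ lift s ∙ᵛ c) →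
               Moves s ⊎ (∀ v → lift s ∙ᵛ v ≡ v)
        case {a} abc (no a≢) _ _ = inj₁ (a , Corners.a∈F abc , a≢)
        case {b = b} abc _ (no b≢) _ = inj₁ (b , Corners.b∈F abc , b≢)
        case {c = c} abc _ _ (no c≢) = inj₁ (c , Corners.c∈F abc , c≢)
        case {a} {b} {c} abc (yes a≡) (yes b≡) (yes c≡) =
          inj₂ (rigid (lift s) F₀ λ v v∈F₀ → fixed (Corners.complete abc {v} v∈F₀))
          where
          fixed : ∀ {v} → v ≡ a ⊎ v ≡ b ⊎ v ≡ c → lift s ∙ᵛ v ≡ v
          fixed (inj₁ refl)        = sym a≡
          fixed (inj₂ (inj₁ refl)) = sym b≡
          fixed (inj₂ (inj₂ refl)) = sym c≡
      go : Moves s₀ ⊎ (∀ v → lift s₀ ∙ᵛ v ≡ v) → Moves s₁ ⊎ (∀ v → lift s₁ ∙ᵛ v ≡ v) →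
           ∃ λ (m : Symmetry) → m ∙ᶠ F₀ ≡ F₀ × ∃ λ v → v ∈ᵥ F₀ × v ≢ m ∙ᵛ v
      go (inj₁ moved) _ = lift s₀ , proj₂ (stabiliser-symmetry {F₀} s₀) , moved
      go _ (inj₁ moved) = lift s₁ , proj₂ (stabiliser-symmetry {F₀} s₁) , moved
      go (inj₂ id₀) (inj₂ id₁) = contradiction
        (trans (sym (index-element (cardS F₀) (λ _ → refl) 0F))
          (trans (index-cong (cardS F₀) λ v → trans (vertex s₀ id₀ v) (sym (vertex s₁ id₁ v)))
            (index-element (cardS F₀) (λ _ → refl) (sucᶠ 0F))))
        λ ()
        where
        vertex : ∀ s → (∀ v → lift s ∙ᵛ v ≡ v) → ∀ v → proj₁ s ∙ v ≡ v
        vertex s fixes v = trans (sym (stabiliser-symmetry-vertex {F₀} s v)) (fixes v)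

    φ : Symmetry
    φ = proj₁ moved-corner

    φF₀≡F₀ : φ ∙ᶠ F₀ ≡ F₀
    φF₀≡F₀ = proj₁ (proj₂ moved-corner)

    φ-∈ : ∀ v → v ∈ᵥ F₀ → φ ∙ᵛ v ∈ᵥ F₀
    φ-∈ v v∈F₀ = subst (φ ∙ᵛ v ∈ᵥ_) φF₀≡F₀ (image-∈ φ {F₀} {v} v∈F₀)

    a₀ b₀ c₀ : Vertex
    a₀ = proj₁ (proj₂ (proj₂ moved-corner))
    b₀ = φ ∙ᵛ a₀
    c₀ = proj₁ (corner₃ {F₀} {a₀} {b₀} (proj₁ (proj₂ (proj₂ (proj₂ moved-corner))))
                   (φ-∈ a₀ (proj₁ (proj₂ (proj₂ (proj₂ moved-corner))))) (proj₂ (proj₂ (proj₂ (proj₂ moved-corner)))))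

    corners₀ : Corners F₀ a₀ b₀ c₀
    corners₀ = proj₂ (corner₃ {F₀} {a₀} {b₀} (proj₁ (proj₂ (proj₂ (proj₂ moved-corner))))
                   (φ-∈ a₀ (proj₁ (proj₂ (proj₂ (proj₂ moved-corner))))) (proj₂ (proj₂ (proj₂ (proj₂ moved-corner)))))

    open Corners corners₀
      renaming (a∈F to a₀∈F₀; b∈F to b₀∈F₀; c∈F to c₀∈F₀; a≢b to a₀≢b₀; a≢c to a₀≢c₀; b≢c to b₀≢c₀; complete to complete₀)

    ι κ : Fin 2
    ι = colour a₀
    κ = colour c₀

    b₀-colour : colour b₀ ≡ ι
    b₀-colour = colour-image φ a₀

    -- Otherwise all vertices of F₀, hence all vertices, would have the same colour.
    ι≢κ : ι ≢ κ
    ι≢κ ι≡κ = contradiction (trans (sym (index-element cardV (λ {v} → orbit-refl v) 0F))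
        (trans (mono (element cardV 0F)) (trans (sym (mono (element cardV (sucᶠ 0F))))
          (index-element cardV (λ {v} → orbit-refl v) (sucᶠ 0F))))) λ ()
      where
      orbit-refl : ∀ v → SameVertexOrbit X v v
      orbit-refl v = proj₁ id-closed , refl
      mono₀ : ∀ {v} → v ≡ a₀ ⊎ v ≡ b₀ ⊎ v ≡ c₀ → colour v ≡ ι
      mono₀ (inj₁ refl)        = refl
      mono₀ (inj₂ (inj₁ refl)) = b₀-colour
      mono₀ (inj₂ (inj₂ refl)) = sym ι≡κ
      mono : ∀ v → colour v ≡ ι
      mono v =
        let (G , v∈G)   = faceAt v
            (m , mG≡F₀) = trans-H G F₀
        in trans (sym (colour-image m v)) (mono₀ (complete₀ {m ∙ᵛ v} (subst (m ∙ᵛ v ∈ᵥ_) mG≡F₀ (image-∈ m {G} {v} v∈G))))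

    -- `φ` already sends `a₀` to `b₀`, and `c₀` has the other colour: the colours exclude a cyclic
    -- permutation of the three corners.
    φ-b₀ : φ ∙ᵛ b₀ ≡ a₀
    φ-b₀ = case (complete₀ {φ ∙ᵛ b₀} (φ-∈ b₀ b₀∈F₀))
      where
      case : φ ∙ᵛ b₀ ≡ a₀ ⊎ φ ∙ᵛ b₀ ≡ b₀ ⊎ φ ∙ᵛ b₀ ≡ c₀ → φ ∙ᵛ b₀ ≡ a₀
      case (inj₁ eq)        = eq
      case (inj₂ (inj₁ eq)) = contradiction (∙ᵛ-injective φ (sym eq)) a₀≢b₀
      case (inj₂ (inj₂ eq)) = contradiction (trans (sym b₀-colour) (trans (sym (colour-image φ b₀)) (cong colour eq))) ι≢κ

    φ-c₀ : φ ∙ᵛ c₀ ≡ c₀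
    φ-c₀ = case (complete₀ {φ ∙ᵛ c₀} (φ-∈ c₀ c₀∈F₀))
      where
      case : φ ∙ᵛ c₀ ≡ a₀ ⊎ φ ∙ᵛ c₀ ≡ b₀ ⊎ φ ∙ᵛ c₀ ≡ c₀ → φ ∙ᵛ c₀ ≡ c₀
      case (inj₁ eq)        = contradiction (trans (sym (cong colour eq)) (colour-image φ c₀)) ι≢κ
      case (inj₂ (inj₁ eq)) = contradiction (trans (sym b₀-colour) (trans (sym (cong colour eq)) (colour-image φ c₀))) ι≢κ
      case (inj₂ (inj₂ eq)) = eq

    flag : Flag
    flag = record
      { φ = φ ; F₀ = F₀ ; a₀ = a₀ ; b₀ = b₀ ; c₀ = c₀ ; corners₀ = corners₀ ; φF₀≡F₀ = φF₀≡F₀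
      ; φ-a₀ = refl ; φ-b₀ = φ-b₀ ; φ-c₀ = φ-c₀ ; ι≢κ = ι≢κ }

module Coloured {p} (X : SimplicialSurface p) (ft : FaceTransitive X)
                (cardV : HasCard (SimplicialSurface.Vertex X) (SameVertexOrbit X) 2)
                (flag : Colouring.Flag X ft cardV) where
  open SimplicialSurface X
  open Colouring X ft cardV public
  open Flag flag public
  open Corners corners₀ public
    renaming (a∈F to a₀∈F₀; b∈F to b₀∈F₀; c∈F to c₀∈F₀; a≢b to a₀≢b₀; a≢c to a₀≢c₀; b≢c to b₀≢c₀; complete to complete₀)

  ι κ : Fin 2
  ι = colour a₀
  κ = colour c₀

  b₀-colour : colour b₀ ≡ ι
  b₀-colour = trans (cong colour (sym φ-a₀)) (colour-image φ a₀)

  record ColouredCorners (F : Face) : Set where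
    field
      a b c    : Vertex
      corners′ : Corners F a b c
      a-colour : colour a ≡ ι
      b-colour : colour b ≡ ι
      c-colour : colour c ≡ κ
    open Corners corners′ public

  abstract
    colouredCorners : ∀ F → ColouredCorners F
    colouredCorners F = let (m , mF₀≡F) = trans-H F₀ F in record
      { a = m ∙ᵛ a₀ ; b = m ∙ᵛ b₀ ; c = m ∙ᵛ c₀
      ; corners′ = subst (λ F → Corners F (m ∙ᵛ a₀) (m ∙ᵛ b₀) (m ∙ᵛ c₀)) mF₀≡F (corners-image m corners₀)
      ; a-colour = colour-image m a₀
      ; b-colour = trans (colour-image m b₀) b₀-colour
      ; c-colour = colour-image m c₀
      }

  κ-unique : ∀ {F v w} → v ∈ᵥ F → w ∈ᵥ F → colour v ≡ κ → colour w ≡ κ → v ≡ w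
  κ-unique {F} {v} {w} v∈F w∈F v-κ w-κ = trans (is-c (complete {v} v∈F) v-κ) (sym (is-c (complete {w} w∈F) w-κ))
    where
    open ColouredCorners (colouredCorners F)
    is-c : ∀ {x} → x ≡ a ⊎ x ≡ b ⊎ x ≡ c → colour x ≡ κ → x ≡ c
    is-c (inj₁ refl)        x-κ = contradiction (trans (sym a-colour) x-κ) ι≢κ
    is-c (inj₂ (inj₁ refl)) x-κ = contradiction (trans (sym b-colour) x-κ) ι≢κ
    is-c (inj₂ (inj₂ x≡c))  _   = x≡c

  -- The corner of colour `κ` is fixed because `F` has only one; with `v` fixed too, the third
  -- corner can only go to itself, and `rigid` applies.
  fixes-face : ∀ m {F v} → m ∙ᶠ F ≡ F → v ∈ᵥ F → colour v ≡ ι → m ∙ᵛ v ≡ v → ∀ w → m ∙ᵛ w ≡ w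
  fixes-face m {F} {v} mF≡F v∈F v-ι mv≡v with colouredCorners F
  ... | record { c = c ; c-colour = c-κ ; corners′ = abc } = rigid m F fixes
    where
    c∈F = Corners.c∈F abc
    v≢c : v ≢ c
    v≢c refl = ι≢κ (trans (sym v-ι) c-κ)
    q = proj₁ (corner₃ {F} {v} {c} v∈F c∈F v≢c)
    vcq : Corners F v c q
    vcq = proj₂ (corner₃ {F} {v} {c} v∈F c∈F v≢c)
    open Corners vcq using (complete) renaming (c∈F to q∈F; a≢c to v≢q; b≢c to c≢q)
    m∈ : ∀ x → x ∈ᵥ F → m ∙ᵛ x ∈ᵥ F
    m∈ x x∈F = subst (m ∙ᵛ x ∈ᵥ_) mF≡F (image-∈ m {F} {x} x∈F)
    mc≡c : m ∙ᵛ c ≡ c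
    mc≡c = κ-unique {F} {m ∙ᵛ c} {c} (m∈ c c∈F) c∈F (trans (colour-image m c) c-κ) c-κ
    fixes-q : m ∙ᵛ q ≡ v ⊎ m ∙ᵛ q ≡ c ⊎ m ∙ᵛ q ≡ q → m ∙ᵛ q ≡ q
    fixes-q (inj₁ eq)        = contradiction (∙ᵛ-injective m (trans mv≡v (sym eq))) v≢q
    fixes-q (inj₂ (inj₁ eq)) = contradiction (∙ᵛ-injective m (trans mc≡c (sym eq))) c≢q
    fixes-q (inj₂ (inj₂ eq)) = eq
    fixes : ∀ w → w ∈ᵥ F → m ∙ᵛ w ≡ w
    fixes w w∈F = case (complete {w} w∈F)
      where
      case : w ≡ v ⊎ w ≡ c ⊎ w ≡ q → m ∙ᵛ w ≡ w
      case (inj₁ refl)        = mv≡v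
      case (inj₂ (inj₁ refl)) = mc≡c
      case (inj₂ (inj₂ refl)) = fixes-q (complete {m ∙ᵛ q} (m∈ q q∈F))

-- The two arc orbits and their sizes

module ToTwoTwoGroup {p} (X : SimplicialSurface p) (ft : FaceTransitive X)
                     (cardV : HasCard (SimplicialSurface.Vertex X) (SameVertexOrbit X) 2)
                     (flag : Colouring.Flag X ft cardV) where
  open SimplicialSurface X
  open Coloured X ft cardV flag
  open Subgroup (λAut X)
  open Graph (faceGraph X) using (order; _≈ₐ_; IsArc)

  -- As a face has a single `κ`-corner, a `κ`-vertex shared by adjacent faces forces the other end
  -- of their edge to have colour `ι`. This decidable invariant separates `E₁` from `E₂`.
  BiColoured : Pred (Face × Face) 0ℓ
  BiColoured (F , G) = ∃ λ v → v ∈ᵥ F × v ∈ᵥ G × colour v ≡ κ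

  biColoured-swap : ∀ {F G} → BiColoured (F , G) → BiColoured (G , F)
  biColoured-swap (v , v∈F , v∈G , v-κ) = v , v∈G , v∈F , v-κ

  biColoured-image : ∀ m {F G} → BiColoured (F , G) → BiColoured (m ∙ᶠ F , m ∙ᶠ G)
  biColoured-image m {F} {G} (v , v∈F , v∈G , v-κ) =
    m ∙ᵛ v , image-∈ m {F} {v} v∈F , image-∈ m {G} {v} v∈G , trans (colour-image m v) v-κ

  biColoured-preimage : ∀ m {F G} → BiColoured (m ∙ᶠ F , m ∙ᶠ G) → BiColoured (F , G)
  biColoured-preimage m {F} {G} (v , v∈F , v∈G , v-κ) = (m ⁻¹) ∙ᵛ v ,
    preimage-∈ m {F} {v} v∈F , preimage-∈ m {G} {v} v∈G , trans (colour-image (m ⁻¹) v) v-κ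

  biColoured-c : ∀ {F G c} → c ∈ᵥ F → colour c ≡ κ → BiColoured (F , G) → c ∈ᵥ G
  biColoured-c {F} {G} {c} c∈F c-κ (v , v∈F , v∈G , v-κ) =
    subst (_∈ᵥ G) (κ-unique {F} {v} {c} v∈F c∈F v-κ c-κ) v∈G

  abstract
    across-ab : ∃ λ G → F₀ ≢ G × a₀ ∈ᵥ G × b₀ ∈ᵥ G
    across-ab = opposite {F₀} {a₀} {b₀} a₀≢b₀ a₀∈F₀ b₀∈F₀

    across-ac : ∃ λ G → F₀ ≢ G × a₀ ∈ᵥ G × c₀ ∈ᵥ G
    across-ac = opposite {F₀} {a₀} {c₀} a₀≢c₀ a₀∈F₀ c₀∈F₀

  -- `Fₘ`, `F₀`, `F₂` are consecutive around `a₀`: the side `a₀b₀` towards `Fₘ` has both ends of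
  -- colour `ι`, the side `a₀c₀` towards `F₂` has ends of both colours.
  Fₘ F₂ : Face
  Fₘ = proj₁ across-ab
  F₂ = proj₁ across-ac

  F₀≢Fₘ : F₀ ≢ Fₘ
  F₀≢Fₘ = proj₁ (proj₂ across-ab)

  a₀∈Fₘ : a₀ ∈ᵥ Fₘ
  a₀∈Fₘ = proj₁ (proj₂ (proj₂ across-ab))

  b₀∈Fₘ : b₀ ∈ᵥ Fₘ
  b₀∈Fₘ = proj₂ (proj₂ (proj₂ across-ab))

  F₀≢F₂ : F₀ ≢ F₂
  F₀≢F₂ = proj₁ (proj₂ across-ac)

  a₀∈F₂ : a₀ ∈ᵥ F₂
  a₀∈F₂ = proj₁ (proj₂ (proj₂ across-ac))

  c₀∈F₂ : c₀ ∈ᵥ F₂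
  c₀∈F₂ = proj₂ (proj₂ (proj₂ across-ac))

  Fₘ~F₀ : Fₘ ~ F₀
  Fₘ~F₀ = ~-intro {Fₘ} {F₀} {a₀} {b₀} (F₀≢Fₘ ∘ sym) a₀≢b₀ a₀∈Fₘ b₀∈Fₘ a₀∈F₀ b₀∈F₀

  F₀~F₂ : F₀ ~ F₂
  F₀~F₂ = ~-intro {F₀} {F₂} {a₀} {c₀} F₀≢F₂ a₀≢c₀ a₀∈F₀ c₀∈F₀ a₀∈F₂ c₀∈F₂

  c₀∉Fₘ : ¬ c₀ ∈ᵥ Fₘ
  c₀∉Fₘ c₀∈Fₘ = F₀≢Fₘ (corners⊆ {F₀} {Fₘ} corners₀ a₀∈Fₘ b₀∈Fₘ c₀∈Fₘ)

  Fₘ≢F₂ : Fₘ ≢ F₂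
  Fₘ≢F₂ eq = c₀∉Fₘ (subst (c₀ ∈ᵥ_) (sym eq) c₀∈F₂)

  e₁ e₂ : Face × Face
  e₁ = F₀ , F₂
  e₂ = Fₘ , F₀

  E₁ E₂ : Pred (Face × Face) 0ℓ
  E₁ = ArcOrbit (λAut X) e₁
  E₂ = ArcOrbit (λAut X) e₂

  e₁-biColoured : BiColoured e₁
  e₁-biColoured = c₀ , c₀∈F₀ , c₀∈F₂ , refl

  e₂-¬biColoured : ¬ BiColoured e₂
  e₂-¬biColoured bi = c₀∉Fₘ (biColoured-c {F₀} {Fₘ} {c₀} c₀∈F₀ refl (biColoured-swap {Fₘ} {F₀} bi))

  E₁⇒biColoured : ∀ {f} → E₁ f → BiColoured f
  E₁⇒biColoured (h , h∈H , inj₁ (refl , refl)) = biColoured-image (h , h∈H) {F₀} {F₂} e₁-biColoured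
  E₁⇒biColoured (h , h∈H , inj₂ (refl , refl)) =
    biColoured-swap {h · F₀} {h · F₂} (biColoured-image (h , h∈H) {F₀} {F₂} e₁-biColoured)

  E₂⇒¬biColoured : ∀ {f} → E₂ f → ¬ BiColoured f
  E₂⇒¬biColoured (h , h∈H , inj₁ (refl , refl)) bi = e₂-¬biColoured (biColoured-preimage (h , h∈H) {Fₘ} {F₀} bi)
  E₂⇒¬biColoured (h , h∈H , inj₂ (refl , refl)) bi =
    e₂-¬biColoured (biColoured-preimage (h , h∈H) {Fₘ} {F₀} (biColoured-swap {h · F₀} {h · Fₘ} bi))

  orbit-arc : ∀ {e f} → IsArc e → ArcOrbit (λAut X) e f → IsArc f
  orbit-arc {F , G} F~G (h , h∈H , inj₁ (refl , refl)) = image-~ (h , h∈H) {F} {G} F~G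
  orbit-arc {F , G} F~G (h , h∈H , inj₂ (refl , refl)) = ~-sym {h · F} {h · G} (image-~ (h , h∈H) {F} {G} F~G)

  orbit-swap : ∀ {e F G} → ArcOrbit (λAut X) e (F , G) → ArcOrbit (λAut X) e (G , F)
  orbit-swap (h , h∈H , inj₁ (x , y)) = h , h∈H , inj₂ (y , x)
  orbit-swap (h , h∈H , inj₂ (x , y)) = h , h∈H , inj₁ (y , x)

  -- The two-coloured sides of `F₀` are `a₀c₀` and `b₀c₀`; `F₂` lies across the first, and `φ`
  -- carries it across the second. Hence one orbit takes up all arcs of this kind.
  biColoured-at-F₀ : ∀ {G} → F₀ ~ G → BiColoured (F₀ , G) →
                     ∃ λ (h : Symmetry) → h ∙ᶠ F₀ ≡ F₀ × h ∙ᶠ F₂ ≡ G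
  biColoured-at-F₀ {G} F₀~G bi = case (~-third {F₀} {G} {c₀} F₀~G c₀∈F₀ c₀∈G)
    where
    c₀∈G : c₀ ∈ᵥ G
    c₀∈G = biColoured-c {F₀} {G} {c₀} c₀∈F₀ refl bi
    at-a : a₀ ∈ᵥ G → F₂ ≡ G
    at-a a₀∈G = two-faces {F₀} {F₂} {G} {a₀} {c₀} a₀≢c₀ a₀∈F₀ c₀∈F₀ a₀∈F₂ c₀∈F₂ a₀∈G c₀∈G F₀≢F₂ (proj₁ F₀~G)
    at-b : b₀ ∈ᵥ G → φ ∙ᶠ F₂ ≡ G
    at-b b₀∈G = two-faces {F₀} {φ ∙ᶠ F₂} {G} {b₀} {c₀} b₀≢c₀ b₀∈F₀ c₀∈F₀
      (subst (_∈ᵥ φ ∙ᶠ F₂) φ-a₀ (image-∈ φ {F₂} {a₀} a₀∈F₂))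
      (subst (_∈ᵥ φ ∙ᶠ F₂) φ-c₀ (image-∈ φ {F₂} {c₀} c₀∈F₂))
      b₀∈G c₀∈G (F₀≢F₂ ∘ ∙ᶠ-injective φ ∘ trans φF₀≡F₀) (proj₁ F₀~G)
    case : (∃ λ w → c₀ ≢ w × w ∈ᵥ F₀ × w ∈ᵥ G) → ∃ λ (h : Symmetry) → h ∙ᶠ F₀ ≡ F₀ × h ∙ᶠ F₂ ≡ G
    case (w , c₀≢w , w∈F₀ , w∈G) with complete₀ {w} w∈F₀
    ... | inj₁ refl        = (idᵍ , id-closed) , refl , at-a w∈G
    ... | inj₂ (inj₁ refl) = φ , φF₀≡F₀ , at-b w∈G
    ... | inj₂ (inj₂ refl) = contradiction refl c₀≢w

  ¬biColoured⇒ab : ∀ {F G a b c} → Corners F a b c → colour c ≡ κ → F ~ G → ¬ BiColoured (F , G) →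
                   a ∈ᵥ G × b ∈ᵥ G
  ¬biColoured⇒ab {F} {G} {a} {b} {c} abc c-κ F~G ¬bi = case (~-common {F} {G} F~G)
    where
    open Corners abc
    c∉G : ∀ {A : Set} → c ∈ᵥ G → A
    c∉G c∈G = contradiction (c , c∈F , c∈G , c-κ) ¬bi
    case : (∃₂ λ v w → v ≢ w × v ∈ᵥ F × w ∈ᵥ F × v ∈ᵥ G × w ∈ᵥ G) → a ∈ᵥ G × b ∈ᵥ G
    case (v , w , v≢w , v∈F , w∈F , v∈G , w∈G) with complete {v} v∈F | complete {w} w∈F
    ... | inj₂ (inj₂ refl) | _                = c∉G v∈G
    ... | _                | inj₂ (inj₂ refl) = c∉G w∈G
    ... | inj₁ refl        | inj₁ refl        = contradiction refl v≢w
    ... | inj₁ refl        | inj₂ (inj₁ refl) = v∈G , w∈G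
    ... | inj₂ (inj₁ refl) | inj₁ refl        = w∈G , v∈G
    ... | inj₂ (inj₁ refl) | inj₂ (inj₁ refl) = contradiction refl v≢w

  ¬biColoured-at-F₀ : ∀ {G} → F₀ ~ G → ¬ BiColoured (F₀ , G) → G ≡ Fₘ
  ¬biColoured-at-F₀ {G} F₀~G ¬bi =
    let (a₀∈G , b₀∈G) = ¬biColoured⇒ab {F₀} {G} corners₀ refl F₀~G ¬bi
    in two-faces {F₀} {G} {Fₘ} {a₀} {b₀} a₀≢b₀ a₀∈F₀ b₀∈F₀ a₀∈G b₀∈G a₀∈Fₘ b₀∈Fₘ (proj₁ F₀~G) F₀≢Fₘ

  module _ {F G} (F~G : F ~ G) where
    private
      t : Symmetry
      t = proj₁ (trans-H F₀ F)

      tF₀≡F : t ∙ᶠ F₀ ≡ F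
      tF₀≡F = proj₂ (trans-H F₀ F)

      G′ : Face
      G′ = (t ⁻¹) ∙ᶠ G

      tG′≡G : t ∙ᶠ G′ ≡ G
      tG′≡G = ⁻¹-faceʳ t G

      t⁻¹F≡F₀ : (t ⁻¹) ∙ᶠ F ≡ F₀
      t⁻¹F≡F₀ = trans (cong ((t ⁻¹) ∙ᶠ_) (sym tF₀≡F)) (⁻¹-faceˡ t F₀)

      F₀~G′ : F₀ ~ G′
      F₀~G′ = subst (_~ G′) t⁻¹F≡F₀ (image-~ (t ⁻¹) {F} {G} F~G)

    biColoured⇒E₁ : BiColoured (F , G) → E₁ (F , G)
    biColoured⇒E₁ bi =
      let (h , hF₀≡F₀ , hF₂≡G′) = biColoured-at-F₀ {G′} F₀~G′
            (subst (λ K → BiColoured (K , G′)) t⁻¹F≡F₀ (biColoured-image (t ⁻¹) {F} {G} bi))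
          (g , g∈H) = t ⊙ h
      in g , g∈H , inj₁
        ( sym (trans (⊙-face t h F₀) (trans (cong (t ∙ᶠ_) hF₀≡F₀) tF₀≡F))
        , sym (trans (⊙-face t h F₂) (trans (cong (t ∙ᶠ_) hF₂≡G′) tG′≡G)))

    ¬biColoured⇒E₂ : ¬ BiColoured (F , G) → E₂ (F , G)
    ¬biColoured⇒E₂ ¬bi =
      let G′≡Fₘ = ¬biColoured-at-F₀ {G′} F₀~G′ λ bi → ¬bi
            (subst₂ (λ K L → BiColoured (K , L)) tF₀≡F tG′≡G (biColoured-image t {F₀} {G′} bi))
      -- The order of faces is swapped because `e₂` has `F₀` as its second face.
      in proj₁ t , proj₂ t , inj₂ (sym tF₀≡F , sym (trans (cong (t ∙ᶠ_) (sym G′≡Fₘ)) tG′≡G))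

    biColoured? : Dec (BiColoured (F , G))
    biColoured? = case (c ∈ᵥ? G)
      where
      open ColouredCorners (colouredCorners F)
      case : Dec (c ∈ᵥ G) → Dec (BiColoured (F , G))
      case (yes c∈G) = yes (c , c∈F , c∈G , c-colour)
      case (no  c∉G) = no λ bi → c∉G (biColoured-c {F} {G} {c} c∈F c-colour bi)

  covering : ∀ e → IsArc e → E₁ e ⊎ E₂ e
  covering (F , G) F~G = case (biColoured? {F} {G} F~G)
    where
    case : Dec (BiColoured (F , G)) → E₁ (F , G) ⊎ E₂ (F , G)
    case (yes bi) = inj₁ (biColoured⇒E₁ {F} {G} F~G bi)
    case (no ¬bi) = inj₂ (¬biColoured⇒E₂ {F} {G} F~G ¬bi)

  disjoint : ∀ e → E₁ e → ¬ E₂ e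
  disjoint e e∈E₁ e∈E₂ = E₂⇒¬biColoured {e} e∈E₂ (E₁⇒biColoured {e} e∈E₁)

  module _ (F : Face) where
    open ColouredCorners (colouredCorners F)

    private
      bit : ∀ {G} → Dec (a ∈ᵥ G) → Fin 2
      bit (yes _) = 0F
      bit (no  _) = sucᶠ 0F

    -- A two-coloured arc at F crosses one of the sides ac and bc of F.
    sideBit : Face → Fin 2
    sideBit G = bit {G} (a ∈ᵥ? G)

    sideBit-injective : ∀ {G K} → F ~ G → F ~ K → BiColoured (F , G) → BiColoured (F , K) →
                        sideBit G ≡ sideBit K → G ≡ K
    sideBit-injective {G} {K} F~G F~K biG biK = go (a ∈ᵥ? G) (a ∈ᵥ? K)
      where
      c∈ : ∀ {G} → BiColoured (F , G) → c ∈ᵥ G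
      c∈ {G} = biColoured-c {F} {G} {c} c∈F c-colour
      b∈ : ∀ {G} → F ~ G → BiColoured (F , G) → ¬ a ∈ᵥ G → b ∈ᵥ G
      b∈ {G} F~G bi a∉G = case (~-third {F} {G} {c} F~G c∈F (c∈ {G} bi))
        where
        case : (∃ λ w → c ≢ w × w ∈ᵥ F × w ∈ᵥ G) → b ∈ᵥ G
        case (w , c≢w , w∈F , w∈G) with complete {w} w∈F
        ... | inj₁ refl        = contradiction w∈G a∉G
        ... | inj₂ (inj₁ refl) = w∈G
        ... | inj₂ (inj₂ refl) = contradiction refl c≢w
      go : (d : Dec (a ∈ᵥ G)) (d′ : Dec (a ∈ᵥ K)) → bit {G} d ≡ bit {K} d′ → G ≡ K
      go (yes a∈G) (yes a∈K) _ =
        two-faces {F} {G} {K} {a} {c} a≢c a∈F c∈F a∈G (c∈ {G} biG) a∈K (c∈ {K} biK) (proj₁ F~G) (proj₁ F~K)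
      go (no a∉G) (no a∉K) _ =
        two-faces {F} {G} {K} {b} {c} b≢c b∈F c∈F (b∈ {G} F~G biG a∉G) (c∈ {G} biG)
          (b∈ {K} F~K biK a∉K) (c∈ {K} biK) (proj₁ F~G) (proj₁ F~K)

    sideBit-surjective : ∀ i → ∃ λ G → F ~ G × BiColoured (F , G) × sideBit G ≡ i
    sideBit-surjective 0F =
      let (G , F≢G , a∈G , c∈G) = opposite {F} {a} {c} a≢c a∈F c∈F in
      G , ~-intro {F} {G} {a} {c} F≢G a≢c a∈F c∈F a∈G c∈G , (c , c∈F , c∈G , c-colour) ,
      bit-yes {G} a∈G (a ∈ᵥ? G)
      where
      bit-yes : ∀ {G} → a ∈ᵥ G → (d : Dec (a ∈ᵥ G)) → bit {G} d ≡ 0F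
      bit-yes _   (yes _)  = refl
      bit-yes a∈G (no a∉G) = contradiction a∈G a∉G
    sideBit-surjective (sucᶠ 0F) =
      let (G , F≢G , b∈G , c∈G) = opposite {F} {b} {c} b≢c b∈F c∈F in
      G , ~-intro {F} {G} {b} {c} F≢G b≢c b∈F c∈F b∈G c∈G , (c , c∈F , c∈G , c-colour) ,
      bit-no {G} (λ a∈G → F≢G (corners⊆ {F} {G} corners′ a∈G b∈G c∈G)) (a ∈ᵥ? G)
      where
      bit-no : ∀ {G} → ¬ a ∈ᵥ G → (d : Dec (a ∈ᵥ G)) → bit {G} d ≡ sucᶠ 0F
      bit-no a∉G (yes a∈G) = contradiction a∈G a∉G
      bit-no _   (no _)    = refl

  -- Every face has two sides at its `κ`-corner, hence starts two ordered arcs of this kind.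
  card-orderedE₁ : HasCard (∃ E₁) (λ s t → proj₁ s ≡ proj₁ t) (order * 2)
  card-orderedE₁ = card-via {_≈₂_ = Pointwise _≡_ _≡_} (λ ((F , G) , _) → F , sideBit F G)
      (λ {s} {t} → congruent (proj₁ s) (proj₁ t))
      (λ {s} {t} (eq , eq′) → injective (proj₁ s) (proj₁ t) (proj₂ s) (proj₂ t) eq eq′)
      (λ (F , i) → let (G , F~G , bi , eq) = sideBit-surjective F i in
        ((F , G) , biColoured⇒E₁ {F} {G} F~G bi) , refl , eq)
      (card-× refl refl card-Face card-Fin)
    where
    congruent : ∀ e f → e ≡ f → Pointwise _≡_ _≡_ (proj₁ e , sideBit (proj₁ e) (proj₂ e)) (proj₁ f , sideBit (proj₁ f) (proj₂ f))
    congruent e f refl = refl , refl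
    injective : ∀ e f → E₁ e → E₁ f → proj₁ e ≡ proj₁ f → sideBit (proj₁ e) (proj₂ e) ≡ sideBit (proj₁ f) (proj₂ f) → e ≡ f
    injective (F , G) (_ , K) x y refl eq = cong (F ,_)
      (sideBit-injective F {G} {K} (orbit-arc {e₁} {F , G} F₀~F₂ x) (orbit-arc {e₁} {F , K} F₀~F₂ y)
        (E₁⇒biColoured {F , G} x) (E₁⇒biColoured {F , K} y) eq)

  -- Every face has a single side between its two `ι`-corners.
  card-orderedE₂ : HasCard (∃ E₂) (λ s t → proj₁ s ≡ proj₁ t) order
  card-orderedE₂ = card-via {_≈₂_ = _≡_} (λ ((F , _) , _) → F) (cong proj₁)
      (λ {s} {t} → injective (proj₁ s) (proj₁ t) (proj₂ s) (proj₂ t))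
      surjective card-Face
    where
    injective : ∀ e f → E₂ e → E₂ f → proj₁ e ≡ proj₁ f → e ≡ f
    injective (F , G) (_ , K) x y refl = cong (F ,_)
        (two-faces {F} {G} {K} {a} {b} a≢b a∈F b∈F (proj₁ abG) (proj₂ abG) (proj₁ abK) (proj₂ abK) (proj₁ F~G) (proj₁ F~K))
      where
      open ColouredCorners (colouredCorners F)
      F~G = orbit-arc {e₂} {F , G} Fₘ~F₀ x
      F~K = orbit-arc {e₂} {F , K} Fₘ~F₀ y
      abG = ¬biColoured⇒ab {F} {G} corners′ c-colour F~G (E₂⇒¬biColoured {F , G} x)
      abK = ¬biColoured⇒ab {F} {K} corners′ c-colour F~K (E₂⇒¬biColoured {F , K} y)
    surjective : ∀ F → ∃ λ (s : ∃ E₂) → proj₁ (proj₁ s) ≡ F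
    surjective F =
      let (G , F≢G , a∈G , b∈G) = opposite {F} {a} {b} a≢b a∈F b∈F in
      ((F , G) , ¬biColoured⇒E₂ {F} {G} (~-intro {F} {G} {a} {b} F≢G a≢b a∈F b∈F a∈G b∈G)
        λ bi → F≢G (corners⊆ {F} {G} corners′ a∈G b∈G (biColoured-c {F} {G} {c} c∈F c-colour bi))) , refl
      where open ColouredCorners (colouredCorners F)

  card-unordered : ∀ {e n} → IsArc e → HasCard (∃ (ArcOrbit (λAut X) e)) (λ s t → proj₁ s ≡ proj₁ t) n →
                   ∃ λ j → HasCard (∃ (ArcOrbit (λAut X) e)) (λ s t → proj₁ s ≈ₐ proj₁ t) j × 2 * j ≡ n
  card-unordered {e} e-arc h =
    let (j , hj , 2j≡n) = card-free-involution
          (record { refl = refl ; sym = sym ; trans = trans }) h swap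
          (cong λ (F , G) → G , F) (λ _ → refl)
          (λ ((F , G) , x) eq → proj₁ (orbit-arc {e} {F , G} e-arc x) (cong proj₂ eq))
    in j , card-⇔ (λ {s} {t} → ≈ₐ⇒ s t) (λ {s} {t} → ⇒≈ₐ s t) (inj₁ refl) hj , 2j≡n
    where
    Arc : Set
    Arc = ∃ (ArcOrbit (λAut X) e)
    swap : Arc → Arc
    swap ((F , G) , x) = (G , F) , orbit-swap {e} {F} {G} x
    ≈ₐ⇒ : ∀ (s t : Arc) → proj₁ s ≈ₐ proj₁ t → (proj₁ s ≡ proj₁ t) ⊎ (proj₁ s ≡ proj₁ (swap t))
    ≈ₐ⇒ _ _ (inj₁ (refl , refl)) = inj₁ refl
    ≈ₐ⇒ _ _ (inj₂ (refl , refl)) = inj₂ refl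
    ⇒≈ₐ : ∀ (s t : Arc) → (proj₁ s ≡ proj₁ t) ⊎ (proj₁ s ≡ proj₁ (swap t)) → proj₁ s ≈ₐ proj₁ t
    ⇒≈ₐ _ _ (inj₁ refl) = inj₁ (refl , refl)
    ⇒≈ₐ _ _ (inj₂ refl) = inj₂ (refl , refl)

  card-E₁ : HasCard (∃ E₁) (λ s t → proj₁ s ≈ₐ proj₁ t) order
  card-E₁ = let (j , h , 2j≡) = card-unordered {e₁} F₀~F₂ card-orderedE₁ in
    subst (HasCard (∃ E₁) (λ s t → proj₁ s ≈ₐ proj₁ t))
      (ℕ.*-cancelˡ-≡ j order 2 (trans 2j≡ (ℕ.*-comm order 2))) h

  card-E₂ : ∃ λ j → HasCard (∃ E₂) (λ s t → proj₁ s ≈ₐ proj₁ t) j × 2 * j ≡ order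
  card-E₂ = card-unordered {e₂} Fₘ~F₀ card-orderedE₂

-- The rotation about a vertex and its α-cycle

module Rotation {p} (X : SimplicialSurface p) (ft : FaceTransitive X)
                (cardV : HasCard (SimplicialSurface.Vertex X) (SameVertexOrbit X) 2)
                (flag : Colouring.Flag X ft cardV)
                (cardS : ∀ F → HasCard (Stabiliser X F) (λ s t → _≈ᴬ_ X (proj₁ s) (proj₁ t)) 2) where
  open SimplicialSurface X
  open Coloured X ft cardV flag
  open ToTwoTwoGroup X ft cardV flag
  open Subgroup (λAut X)
  open Graph (faceGraph X) using (order)

  -- `φ` preserves the edge `a₀b₀` and one of its two faces, hence the other.
  φFₘ≡Fₘ : φ ∙ᶠ Fₘ ≡ Fₘ
  φFₘ≡Fₘ = two-faces {F₀} {φ ∙ᶠ Fₘ} {Fₘ} {a₀} {b₀} a₀≢b₀ a₀∈F₀ b₀∈F₀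
    (subst (_∈ᵥ φ ∙ᶠ Fₘ) φ-b₀ (image-∈ φ {Fₘ} {b₀} b₀∈Fₘ))
    (subst (_∈ᵥ φ ∙ᶠ Fₘ) φ-a₀ (image-∈ φ {Fₘ} {a₀} a₀∈Fₘ))
    a₀∈Fₘ b₀∈Fₘ (F₀≢Fₘ ∘ ∙ᶠ-injective φ ∘ trans φF₀≡F₀) F₀≢Fₘ

  abstract
    -- If θ maps Fₘ to F₂ without fixing a₀, then it sends b₀ to a₀, so θ ⊙ φ fixes a₀.
    rotation : ∃ λ (σ : Symmetry) → σ ∙ᶠ Fₘ ≡ F₂ × σ ∙ᵛ a₀ ≡ a₀
    rotation = case (complete {θ ∙ᵛ a₀} θa∈F₂) (complete {θ ∙ᵛ b₀} θb∈F₂)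
      where
      θ : Symmetry
      θ = proj₁ (trans-H Fₘ F₂)
      θFₘ≡F₂ : θ ∙ᶠ Fₘ ≡ F₂
      θFₘ≡F₂ = proj₂ (trans-H Fₘ F₂)
      open Corners (proj₂ (corner₃ {F₂} {a₀} {c₀} a₀∈F₂ c₀∈F₂ a₀≢c₀)) using (complete)
      θa∈F₂ : θ ∙ᵛ a₀ ∈ᵥ F₂
      θa∈F₂ = subst (θ ∙ᵛ a₀ ∈ᵥ_) θFₘ≡F₂ (image-∈ θ {Fₘ} {a₀} a₀∈Fₘ)
      θb∈F₂ : θ ∙ᵛ b₀ ∈ᵥ F₂
      θb∈F₂ = subst (θ ∙ᵛ b₀ ∈ᵥ_) θFₘ≡F₂ (image-∈ θ {Fₘ} {b₀} b₀∈Fₘ)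
      not-c : ∀ {A : Set} {v} → colour v ≡ ι → θ ∙ᵛ v ≡ c₀ → A
      not-c {v = v} v-ι θv≡c₀ = contradiction (trans (sym v-ι) (trans (sym (colour-image θ v)) (cong colour θv≡c₀))) ι≢κ
      case : ∀ {q} → θ ∙ᵛ a₀ ≡ a₀ ⊎ θ ∙ᵛ a₀ ≡ c₀ ⊎ θ ∙ᵛ a₀ ≡ q → θ ∙ᵛ b₀ ≡ a₀ ⊎ θ ∙ᵛ b₀ ≡ c₀ ⊎ θ ∙ᵛ b₀ ≡ q →
             ∃ λ (σ : Symmetry) → σ ∙ᶠ Fₘ ≡ F₂ × σ ∙ᵛ a₀ ≡ a₀
      case (inj₁ θa≡a)          _                    = θ , θFₘ≡F₂ , θa≡a
      case (inj₂ (inj₁ θa≡c))   _                    = not-c refl θa≡c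
      case (inj₂ (inj₂ _))      (inj₁ θb≡a)          = θ ⊙ φ ,
        trans (⊙-face θ φ Fₘ) (trans (cong (θ ∙ᶠ_) φFₘ≡Fₘ) θFₘ≡F₂) ,
        trans (⊙-vertex θ φ a₀) (trans (cong (θ ∙ᵛ_) φ-a₀) θb≡a)
      case (inj₂ (inj₂ _))      (inj₂ (inj₁ θb≡c))   = not-c b₀-colour θb≡c
      case (inj₂ (inj₂ θa≡q))   (inj₂ (inj₂ θb≡q))   = contradiction (∙ᵛ-injective θ (trans θa≡q (sym θb≡q))) a₀≢b₀

  σ : Symmetry
  σ = proj₁ rotation

  σFₘ≡F₂ : σ ∙ᶠ Fₘ ≡ F₂
  σFₘ≡F₂ = proj₁ (proj₂ rotation)

  σa₀≡a₀ : σ ∙ᵛ a₀ ≡ a₀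
  σa₀≡a₀ = proj₂ (proj₂ rotation)

  -- The pair `Fₘ`, `F₀` followed by its images under the powers of `σ`; they join up because
  -- `σ ∙ᶠ Fₘ`, which is `F₂`, follows `F₀` around `a₀`.
  walk : ℕ → Face
  walk zero          = Fₘ
  walk (suc zero)    = F₀
  walk (suc (suc i)) = σ ∙ᶠ walk i

  walk-adjacent : ∀ i → AdjacentAt a₀ (walk i) (walk (1 + i))
  walk-adjacent zero          = adjacentAt Fₘ~F₀ a₀∈Fₘ a₀∈F₀
  walk-adjacent (suc zero)    = subst (AdjacentAt a₀ F₀) (sym σFₘ≡F₂) (adjacentAt F₀~F₂ a₀∈F₀ a₀∈F₂)
  walk-adjacent (suc (suc i)) = subst (λ v → AdjacentAt v (walk (2 + i)) (walk (3 + i))) σa₀≡a₀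
    (AdjacentAt-image σ (walk-adjacent i))

  -- If `σ`, which fixes `a₀`, also fixed `F₀`, it would be the identity and `F₂` would be `Fₘ`.
  -- Later steps are images of the first two.
  walk-≢ : ∀ i → walk i ≢ walk (2 + i)
  walk-≢ zero          = λ eq → Fₘ≢F₂ (trans eq σFₘ≡F₂)
  walk-≢ (suc zero)    = λ F₀≡σF₀ → Fₘ≢F₂ (trans
    (sym (vertex⇒face σ (idᵍ , id-closed) (fixes-face σ {F₀} {a₀} (sym F₀≡σF₀) a₀∈F₀ refl σa₀≡a₀) Fₘ)) σFₘ≡F₂)
  walk-≢ (suc (suc i)) = walk-≢ i ∘ ∙ᶠ-injective σ

  even-¬biColoured : ∀ i → ¬ BiColoured (walk (twice i) , walk (suc (twice i)))
  even-¬biColoured zero    = e₂-¬biColoured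
  even-¬biColoured (suc i) = even-¬biColoured i ∘ biColoured-preimage σ {walk (twice i)} {walk (suc (twice i))}

  odd-biColoured : ∀ i → BiColoured (walk (suc (twice i)) , walk (twice (suc i)))
  odd-biColoured zero    = subst (λ F → BiColoured (F₀ , F)) (sym σFₘ≡F₂) e₁-biColoured
  odd-biColoured (suc i) = biColoured-image σ {walk (suc (twice i))} {walk (twice (suc i))} (odd-biColoured i)

  walk-even : ∀ i → (proj₁ σ ^ i) · Fₘ ≡ walk (twice i)
  walk-even zero    = refl
  walk-even (suc i) = cong (σ ∙ᶠ_) (walk-even i)

  walk-odd : ∀ i → (proj₁ σ ^ i) · F₀ ≡ walk (suc (twice i))
  walk-odd zero    = refl
  walk-odd (suc i) = cong (σ ∙ᶠ_) (walk-odd i)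

  -- The graph automorphism `σ ^ i` does not itself act on vertices; a symmetry inducing it and
  -- fixing `a₀` makes `fixes-face` applicable.
  power : ∀ i → ∃ λ (m : Symmetry) → (∀ F → m ∙ᶠ F ≡ (proj₁ σ ^ i) · F) × m ∙ᵛ a₀ ≡ a₀
  power zero    = (idᵍ , id-closed) , (λ _ → refl) , refl
  power (suc i) = let (m , m≡ , ma₀≡a₀) = power i in σ ⊙ m ,
    (λ F → trans (⊙-face σ m F) (cong (σ ∙ᶠ_) (m≡ F))) ,
    trans (⊙-vertex σ m a₀) (trans (cong (σ ∙ᵛ_) ma₀≡a₀) σa₀≡a₀)

  power-id : ∀ i → (proj₁ σ ^ i) · F₀ ≡ F₀ → proj₁ σ ^ i ≈ᵍ idᵍ
  power-id i eq F = let (m , m≡ , ma₀≡a₀) = power i in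
    trans (sym (m≡ F)) (vertex⇒face m (idᵍ , id-closed)
      (fixes-face m {F₀} {a₀} (trans (m≡ F₀) eq) a₀∈F₀ refl ma₀≡a₀) F)

  αC : ℕ → List Face
  αC l = α (faceGraph X) (proj₁ σ) l (Fₘ ∷ F₀ ∷ F₂ ∷ [])

  module _ {n} (U : Umbrella a₀ (applyUpTo walk n)) (walk-n : walk n ≡ walk 0)
           (walk-1+n : walk (suc n) ≡ walk 1) where

    -- An odd period would identify a two-coloured arc of the walk with its first arc, which is not
    -- two-coloured.
    umbrella-even : ∃ λ l → n ≡ twice l
    umbrella-even = case (parity n)
      where
      case : (∃ λ k → n ≡ twice k ⊎ n ≡ suc (twice k)) → ∃ λ l → n ≡ twice l
      case (k , inj₁ eq) = k , eq
      case (k , inj₂ refl) = contradiction (subst₂ (λ F G → BiColoured (F , G)) walk-n walk-1+n (odd-biColoured k)) e₂-¬biColoured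

    walk-first-return : ∀ k → 0 < k → k < n → walk k ≢ walk 0
    walk-first-return (suc k) _ k<n eq = go n (Umbrella.unique U) k<n
      where
      go : ∀ n → Unique (applyUpTo walk n) → ¬ suc k < n
      go (suc n) (first≢ ∷ _) (s≤s k<n) = All.lookup first≢ (∈-applyUpTo⁺ (walk ∘ suc) k<n) (sym eq)

  -- `σ ^ l` brings `F₀` back and is trivial by `power-id`; a smaller positive power moves `Fₘ`, as
  -- the umbrella has no repetitions.
  rotation-order : ∀ l → 3 ≤ twice l → Umbrella a₀ (applyUpTo walk (twice l)) →
                   walk (twice l) ≡ walk 0 → walk (suc (twice l)) ≡ walk 1 → HasOrder (proj₁ σ) l
  rotation-order l 3≤ U walk-n walk-1+n = positive l 3≤ ,
      power-id l (trans (walk-odd l) walk-1+n) ,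
      λ i 0<i i<l σⁱ≈id → walk-first-return U walk-n walk-1+n (twice i) (twice-< 0<i) (twice-< i<l)
        (trans (sym (walk-even i)) (σⁱ≈id Fₘ))
    where
    positive : ∀ l → 3 ≤ twice l → 0 < l
    positive (suc l) _ = s≤s z≤n

  -- The list behind `Σ` is the walk from index 0: it is an umbrella, so it has no repetitions and
  -- the α-cycle is not empty. The α-cycle is the walk from index 2, a rotation of it.
  rotation-α : ∀ l → 3 ≤ twice l → Umbrella a₀ (applyUpTo walk (twice l)) →
               walk (twice l) ≡ walk 0 → walk (suc (twice l)) ≡ walk 1 → Umbrella a₀ (αC l)
  rotation-α l 3≤ U walk-n walk-1+n = subst (Umbrella a₀) (sym αC≡)
      (umbrella-≈ᶜ (applyUpTo-rotate₂ walk (twice l) walk-n walk-1+n (ℕ.≤-trans (s≤s (s≤s z≤n)) 3≤)) U)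
    where
    Σσ : List Face
    Σσ = concatMap (λ i → (proj₁ σ ^ i) ·ᶜ (Fₘ ∷ F₀ ∷ [])) (upTo l)
    Σσ≡ : Σσ ≡ applyUpTo walk (twice l)
    Σσ≡ = concatMap-pairs (λ i → (proj₁ σ ^ i) ·ᶜ (Fₘ ∷ F₀ ∷ [])) id walk
      (λ i → cong₂ (λ F G → F ∷ G ∷ []) (walk-even i) (walk-odd i)) l
    αC≡ : αC l ≡ applyUpTo (λ i → walk (2 + i)) (twice l)
    αC≡ = trans
      (α-Unique (proj₁ σ) l Fₘ F₀ F₂ (subst Unique (sym Σσ≡) (Umbrella.unique U))
        (trans (cong length Σσ≡) (trans (length-applyUpTo walk (twice l)) (twice≡2* l))))
      (concatMap-pairs (λ i → (proj₁ σ ^ suc i) ·ᶜ (Fₘ ∷ F₀ ∷ [])) id (λ i → walk (2 + i))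
        (λ i → cong₂ (λ F G → F ∷ G ∷ []) (walk-even (suc i)) (walk-odd (suc i))) l)

  abstract
    rotation-umbrella : ∃ λ l → HasOrder (proj₁ σ) l × Umbrella a₀ (αC l)
    rotation-umbrella =
      let (C , U)  = umbrellaAt a₀
          (zs , C≈) = umbrella-arc U (walk-adjacent 0)
          U′       = umbrella-≈ᶜ C≈ U
          (n , eq , walk-n , walk-1+n , 3≤n) = cycle-walk AdjacentAt-degree AdjacentAt-sym walk walk-adjacent walk-≢
            (umbrella-length U′) (Umbrella.unique U′) (Umbrella.cyclic U′)
          V        = subst (Umbrella a₀) eq U′
          (l , n≡) = umbrella-even V walk-n walk-1+n
          3≤       = subst (3 ≤_) n≡ 3≤n
          W        = subst (λ n → Umbrella a₀ (applyUpTo walk n)) n≡ V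
          walk-2l  = subst (λ n → walk n ≡ Fₘ) n≡ walk-n
          walk-2l+1 = subst (λ n → walk (suc n) ≡ F₀) n≡ walk-1+n
      in l , rotation-order l 3≤ W walk-2l walk-2l+1 , rotation-α l 3≤ W walk-2l walk-2l+1

  l : ℕ
  l = proj₁ rotation-umbrella

  u : List Face
  u = proj₁ (umbrellaAt c₀)

  u-umbrella : Umbrella c₀ u
  u-umbrella = proj₂ (umbrellaAt c₀)

  α-umbrella : Umbrella a₀ (αC l)
  α-umbrella = proj₂ (proj₂ rotation-umbrella)

  cover : Pred (List Face) 0ℓ
  cover C = CycleOrbit (λAut X) u C ⊎ CycleOrbit (λAut X) (αC l) C

  orbit-vertexDefining : ∀ {v C D} → Umbrella v C → CycleOrbit (λAut X) C D → VertexDefining D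
  orbit-vertexDefining {v} U (h , h∈H , D≈hC) = (h , h∈H) ∙ᵛ v ,
    umbrella⁻ (umbrella-≈ᶜ (≈ᶜ-sym D≈hC) (umbrella-map (h , h∈H) U))

  -- Equal colours mean a common orbit, and a symmetry taking `v` to `w` carries the umbrella of `v`
  -- to one of `w`, which is unique.
  vertexDefining-orbit : ∀ {v w C D} → Umbrella v C → Umbrella w D → colour w ≡ colour v → CycleOrbit (λAut X) C D
  vertexDefining-orbit {v} {w} {C} {D} U V eq =
    let (m , mv≡w) = orbit-symmetry {v} {w} (index-injective cardV (sym eq))
    in proj₁ m , proj₂ m , umbrella-unique V (subst (λ x → Umbrella x (map (m ∙ᶠ_) C)) mv≡w (umbrella-map m U))

  cover≐VertexDefining : cover ≐ VertexDefining
  cover≐VertexDefining = [ orbit-vertexDefining u-umbrella , orbit-vertexDefining α-umbrella ]′ ,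
      λ (v , C-umbrella) → case (umbrella⁺ C-umbrella) (Fin2-dichotomy ι≢κ (colour v))
    where
    case : ∀ {v C} → Umbrella v C → colour v ≡ ι ⊎ colour v ≡ κ → cover C
    case V (inj₁ v-ι) = inj₂ (vertexDefining-orbit α-umbrella V v-ι)
    case V (inj₂ v-κ) = inj₁ (vertexDefining-orbit u-umbrella V v-κ)

  twoTwoGroup : TwoTwoGroup (λAut X)
  twoTwoGroup = record
    { cubic        = Cubicity.faceGraph-cubic X
    ; transitive   = λ F G → let ((h , h∈H) , hF≡G) = trans-H F G in h , h∈H , hF≡G
    ; order-H      = subst (HasCard Symmetry _≈ᴴ_) (ℕ.*-comm order 2) (orbit-stabiliser trans-H F₀ (cardS F₀))
    ; e₁           = e₁
    ; e₂           = e₂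
    ; e₁-arc       = F₀~F₂
    ; e₂-arc       = Fₘ~F₀
    ; covering     = covering
    ; disjoint     = disjoint
    ; card-E₁      = card-E₁
    ; card-E₂      = card-E₂
    ; Fₘ           = Fₘ
    ; F₁           = F₀
    ; F₂           = F₂
    ; F₁F₂∈E₁      = idᵍ , id-closed , inj₁ (refl , refl)
    ; FₘF₁∈E₂      = idᵍ , id-closed , inj₁ (refl , refl)
    ; σ            = proj₁ σ
    ; σ∈H          = proj₂ σ
    ; σFₘ≡F₂       = σFₘ≡F₂
    ; l            = l
    ; σ-order      = proj₁ (proj₂ rotation-umbrella)
    ; u            = u
    ; u-cycle      = umbrella-isCycle u-umbrella
    ; u-monochrome = inj₁ λ (F , G) arc → let adjacentAt F~G c∈F c∈G = umbrella-arc⁻ u-umbrella arc in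
        biColoured⇒E₁ {F} {G} F~G (c₀ , c∈F , c∈G , refl)
    ; cover-isCycleDoubleCover = vertexDefining-isCycleDoubleCover cover≐VertexDefining
    ; cover-isVertexFaithful   = vertexDefining-isVertexFaithful cover≐VertexDefining
    }

theorem4p8 : ∀ {p : ℕ} (X : SimplicialSurface p) →
    (FaceTransitive X × HasVertexFaceType X 2 2)
    ⇔ (Σ[ S ∈ TwoTwoGroup (λAut X) ] TwoTwoGroup.cover S ≐ SimplicialSurface.VertexDefining X)
theorem4p8 X = mk⇔
  (λ (ft , cardV , cardS) →
    let flag = Colouring.FlagConstruction.flag X ft cardV cardS
        open Rotation X ft cardV flag cardS
    in twoTwoGroup , cover≐VertexDefining)
  (λ (S , cover≐) → FromTwoTwoGroup.faceTransitive X S cover≐ , FromTwoTwoGroup.vertexFaceType X S cover≐)
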